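{- Let $G$ be a graph with vertex set $[n]$ and $\sigma=(1\;2\;\cdots\;n)$. The set $\{x_T\}$, where $T$ ranges over all $G$-reduced noncrossing trees, is a basis of $\mathcal E_G^\sigma$. Consequently, all linear relations in $\mathcal E_G^\sigma$ among the elements $x_T$ ($T\subset G$ a noncrossing tree on $[n]$) are generated by the relations \[x_{T_m}=x_{T_1}-x_{T_2}-\cdots-x_{T_{m-1}},\] where $1\le i_1<\dots<i_m\le n$, $H\subset G$ is a connected noncrossing graph on $[n]$ whose unique cycle is $(i_1,\dots,i_m)$, $T_1=H\setminus\overline{i_1i_m}$ and $T_j=H\setminus\overline{i_{j-1}i_j}$ for $1<j\le m$; and repeatedly rewriting an element of $\mathcal E_G^\sigma$ by replacing some $x_{T_m}$ by the right-hand side of such a relation always terminates in the unique expansion of that element in this basis, independent of the choices made.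
   Context: The Fomin–Kirillov algebra $\mathcal E_n$ is the quadratic $\mathbf Q$-algebra with generators $x_{ij}=-x_{ji}$ for distinct $i,j\in[n]$, subject to: $x_{ij}^2=0$; $x_{ij}x_{kl}=x_{kl}x_{ij}$ for distinct $i,j,k,l$; $x_{ij}x_{jk}+x_{jk}x_{ki}+x_{ki}x_{ij}=0$ for distinct $i,j,k$. For a graph $G$ on $[n]$, $\mathcal E_G$ is the subalgebra generated by $x_{ij}$ for edges $\overline{ij}$ of $G$. For a monomial $P=x_{i_1j_1}\cdots x_{i_dj_d}$, $\sigma_P=(i_1\;j_1)\cdots(i_d\;j_d)$; $P$ is simple if $\sigma_P$ has exactly $n-d$ cycles. $\mathcal E_G^\sigma$ is the linear span in $\mathcal E_G$ of all simple monomials in the generators of $\mathcal E_G$ with $\sigma_P=\sigma$. A graph on $[n]$ is noncrossing if it has no two edges $\overline{ac},\overline{bd}$ with $a<b<c<d$. For a noncrossing tree $T$ on $[n]$ and vertex $i$, order the edges $\overline{ij}$ of $T$ at $i$ by the position of $j$ in the sequence $i-1,\dots,1,n,\dots,i+1$; $x_T$ is the product $x_{a_1b_1}\cdots x_{a_{n-1}b_{n-1}}$ ($a_k<b_k$) over the edges of $T$ in any order such that at every vertex the edges occur in this order (all such products are equal). A noncrossing tree $T$ on $[n]$ is $G$-reduced if $T\subset G$ and there do not exist $1\le i_1<i_2<\dots<i_m\le n$ such that $\overline{i_1i_m}\in T$, $\overline{i_{j-1}i_j}\in T$ for all $1<j<m$, $\overline{i_{m-1}i_m}\in G$, and $T\cup\overline{i_{m-1}i_m}$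 is noncrossing. -}

module Defs where

open import Algebra.Bundles using (Ring)
open import Algebra.Module.Bundles using (LeftModule)
open import Data.Bool.Base as Bool using (Bool)
open import Data.Fin.Base using (Fin; zero; suc; toℕ; fromℕ; inject₁; _<_)
open import Data.Fin.Permutation as Perm using (Permutation′; _⟨$⟩ʳ_; _∘ₚ_; transpose; insert)
open import Data.Fin.Properties as Fin using (all?; inject₁-injective; toℕ-inject₁)
open import Data.List.Base using (List; []; _∷_; _++_; map; foldr; concatMap; length; allFin)
open import Data.List.Membership.Propositional using (_∈_)
open import Data.List.Relation.Unary.All using (All)
open import Data.List.Relation.Unary.AllPairs using (AllPairs)
open import Data.List.Relation.Unary.Unique.Propositional using (Unique)
open import Data.Nat.Base as ℕ using (ℕ; zero; suc)
import Data.Nat.Properties as ℕ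
open import Data.Product using (Σ-syntax; ∃-syntax; _×_; _,_; proj₁; proj₂)
open import Data.Rational.Base as ℚ using (ℚ; 0ℚ; 1ℚ)
import Data.Rational.Properties as ℚ
open import Data.Sum.Base using (_⊎_; inj₁; inj₂)
open import Function.Base using (_∘_; id)
open import Function.Bundles using (_⇔_; Equivalence)
open import Function.Definitions using (Injective; Surjective)
open import Level using (0ℓ)
open import Relation.Binary.Bundles using (DecSetoid)
open import Relation.Binary.Core using (Rel; _⇒_; _Preserves_⟶_)
open import Relation.Binary.Definitions using (Symmetric)
open import Relation.Binary.Construct.Closure.ReflexiveTransitive as Star using (Star; ε; _◅_; _◅◅_; kleisliStar)
import Relation.Binary.Construct.On as On
open import Relation.Binary.Construct.Union using (_∪_)
open import Relation.Binary.PropositionalEquality using (_≡_; _≢_; refl; sym; trans; cong)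
open import Relation.Binary.Rewriting using (StronglyNormalizing; IsNormalForm)
open import Relation.Nullary.Decidable using (Dec; yes; no; does; isYes; toWitness; fromWitness; T?; ¬?; map′; _×-dec_; _⊎-dec_; _→-dec_)
open import Relation.Nullary.Negation using (¬_)
open import Relation.Unary using (Pred)

record Generator (n : ℕ) : Set where
  constructor gen
  field
    src tgt   : Fin n
    .distinct : src ≢ tgt

open Generator public

infix  4 _≈_
infixl 6 _+_
infixl 7 _*_
infix  8 -_

-- The algebra presented by generators and relations: terms of the free
-- ℚ-algebra, modulo the smallest congruence containing the axioms of an
-- associative unital ℚ-algebra (ι is the structure map from ℚ) and the
-- defining relations.

data FK (n : ℕ) : Set where
  X       : Generator n → FK n
  ι       : ℚ → FK n
  _+_ _*_ : FK n → FK n → FK n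
  -_      : FK n → FK n

x⟨_,_⟩ : ∀ {n} (i j : Fin n) → .(i ≢ j) → FK n
x⟨ i , j ⟩ i≢j = X (gen i j i≢j)

data _≈_ {n : ℕ} : Rel (FK n) 0ℓ where
  ≈-refl      : ∀ {y} → y ≈ y
  ≈-sym       : ∀ {y z} → y ≈ z → z ≈ y
  ≈-trans     : ∀ {y z w} → y ≈ z → z ≈ w → y ≈ w

  +-cong      : ∀ {y y′ z z′} → y ≈ y′ → z ≈ z′ → y + z ≈ y′ + z′
  *-cong      : ∀ {y y′ z z′} → y ≈ y′ → z ≈ z′ → y * z ≈ y′ * z′
  -‿cong      : ∀ {y y′} → y ≈ y′ → - y ≈ - y′

  +-assoc     : ∀ y z w → (y + z) + w ≈ y + (z + w)
  +-comm      : ∀ y z → y + z ≈ z + y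
  +-identityˡ : ∀ y → ι 0ℚ + y ≈ y
  -‿inverseˡ  : ∀ y → - y + y ≈ ι 0ℚ

  *-assoc     : ∀ y z w → (y * z) * w ≈ y * (z * w)
  *-identityˡ : ∀ y → ι 1ℚ * y ≈ y
  distribˡ    : ∀ y z w → y * (z + w) ≈ y * z + y * w
  distribʳ    : ∀ y z w → (z + w) * y ≈ z * y + w * y

  ι-+         : ∀ p q → ι (p ℚ.+ q) ≈ ι p + ι q
  ι-*         : ∀ p q → ι (p ℚ.* q) ≈ ι p * ι q
  ι-central   : ∀ q y → ι q * y ≈ y * ι q

  antisymmetric : ∀ {i j} .(i≢j : i ≢ j) .(j≢i : j ≢ i) →
                  x⟨ i , j ⟩ i≢j ≈ - x⟨ j , i ⟩ j≢i
  square        : ∀ {i j} .(i≢j : i ≢ j) →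
                  x⟨ i , j ⟩ i≢j * x⟨ i , j ⟩ i≢j ≈ ι 0ℚ
  commute       : ∀ {i j k l} .(i≢j : i ≢ j) .(k≢l : k ≢ l) →
                  i ≢ k → i ≢ l → j ≢ k → j ≢ l →
                  x⟨ i , j ⟩ i≢j * x⟨ k , l ⟩ k≢l ≈ x⟨ k , l ⟩ k≢l * x⟨ i , j ⟩ i≢j
  triangle      : ∀ {i j k} .(i≢j : i ≢ j) .(j≢k : j ≢ k) .(k≢i : k ≢ i) →
                  x⟨ i , j ⟩ i≢j * x⟨ j , k ⟩ j≢k
                    + x⟨ j , k ⟩ j≢k * x⟨ k , i ⟩ k≢i
                    + x⟨ k , i ⟩ k≢i * x⟨ i , j ⟩ i≢j ≈ ι 0ℚ

FK-ring : ℕ → Ring 0ℓ 0ℓ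
FK-ring n = record
  { Carrier = FK n
  ; _≈_ = _≈_
  ; _+_ = _+_
  ; _*_ = _*_
  ; -_  = -_
  ; 0#  = ι 0ℚ
  ; 1#  = ι 1ℚ
  ; isRing = record
    { +-isAbelianGroup = record
      { isGroup = record
        { isMonoid = record
          { isSemigroup = record
            { isMagma = record
              { isEquivalence = record { refl = ≈-refl ; sym = ≈-sym ; trans = ≈-trans }
              ; ∙-cong = +-cong
              }
            ; assoc = +-assoc
            }
          ; identity = +-identityˡ , λ y → ≈-trans (+-comm y (ι 0ℚ)) (+-identityˡ y)
          }
        ; inverse = -‿inverseˡ , λ y → ≈-trans (+-comm y (- y)) (-‿inverseˡ y)
        ; ⁻¹-cong = -‿cong
        }
      ; comm = +-comm
      }
    ; *-cong = *-cong
    ; *-assoc = *-assoc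
    ; *-identity = *-identityˡ , λ y → ≈-trans (≈-sym (ι-central 1ℚ y)) (*-identityˡ y)
    ; distrib = distribˡ , distribʳ
    }
  }

FK-module : ℕ → LeftModule ℚ.+-*-ring 0ℓ 0ℓ
FK-module n = record
  { Carrierᴹ = FK n
  ; _≈ᴹ_ = _≈_
  ; _+ᴹ_ = _+_
  ; _*ₗ_ = λ q y → ι q * y
  ; 0ᴹ = ι 0ℚ
  ; -ᴹ_ = -_
  ; isLeftModule = record
    { isLeftSemimodule = record
      { +ᴹ-isCommutativeMonoid = R.+-isCommutativeMonoid
      ; isPreleftSemimodule = record
        { *ₗ-cong = λ { refl y≈z → *-cong ≈-refl y≈z }
        ; *ₗ-zeroˡ = R.zeroˡ
        ; *ₗ-distribʳ = λ y p q → ≈-trans (*-cong (ι-+ p q) ≈-refl) (distribʳ y (ι p) (ι q))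
        ; *ₗ-identityˡ = *-identityˡ
        ; *ₗ-assoc = λ p q y → ≈-trans (*-cong (ι-* p q) ≈-refl) (*-assoc (ι p) (ι q) y)
        ; *ₗ-zeroʳ = λ q → R.zeroʳ (ι q)
        ; *ₗ-distribˡ = λ q → distribˡ (ι q)
        }
      }
    ; -ᴹ‿cong = -‿cong
    ; -ᴹ‿inverse = R.-‿inverse
    }
  }
  where module R = Ring (FK-ring n)

Comb : Set → Set
Comb A = List (ℚ × A)

infixr 7 _⊛_

_⊛_ : ∀ {A} → ℚ → Comb A → Comb A
q ⊛ c = map (λ (p , i) → q ℚ.* p , i) c

mapComb : ∀ {A B} → (A → B) → Comb A → Comb B
mapComb f = map (λ (q , i) → q , f i)

-- Entries with equal indices are collected by coeff, so Comb modulo _≋_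
-- is the free ℚ-vector space on the setoid I.
module Formal (I : DecSetoid 0ℓ 0ℓ) where
  open DecSetoid I using (Carrier; _≟_)

  coeff : Comb Carrier → Carrier → ℚ
  coeff c i = foldr (λ (q , j) s → Bool.if does (j ≟ i) then q ℚ.+ s else s) 0ℚ c

  infix 4 _≋_

  _≋_ : Rel (Comb Carrier) 0ℓ
  c ≋ d = ∀ i → coeff c i ≡ coeff d i

module Linear (V : LeftModule ℚ.+-*-ring 0ℓ 0ℓ) where
  open LeftModule V

  ⟦_⟧ : ∀ {A} → Comb A → (A → Carrierᴹ) → Carrierᴹ
  ⟦ c ⟧ v = foldr (λ (q , i) s → q *ₗ v i +ᴹ s) 0ᴹ c

  Span : ∀ {A} → (A → Carrierᴹ) → Pred Carrierᴹ 0ℓ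
  Span v y = ∃[ c ] y ≈ᴹ ⟦ c ⟧ v

  record IsBasisOf (I : DecSetoid 0ℓ 0ℓ) (v : DecSetoid.Carrier I → Carrierᴹ)
                   (W : Pred Carrierᴹ 0ℓ) : Set where
    open Formal I
    field
      contained   : ∀ i → W (v i)
      independent : ∀ c → ⟦ c ⟧ v ≈ᴹ 0ᴹ → c ≋ []
      spanning    : ∀ {y} → W y → Span v y

record Graph (n : ℕ) : Set where
  field
    adj    : Fin n → Fin n → Bool
  Adj : Rel (Fin n) 0ℓ
  Adj i j = Bool.T (adj i j)
  field
    symm   : Symmetric Adj
    irrefl : ∀ {i} → ¬ Adj i i

open Graph public using (Adj)

infix 4 _⊆ᴳ_ _≐ᴳ_

_⊆ᴳ_ : ∀ {n} → Rel (Graph n) 0ℓ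
G ⊆ᴳ H = ∀ i j → Adj G i j → Adj H i j

_≐ᴳ_ : ∀ {n} → Rel (Graph n) 0ℓ
G ≐ᴳ H = G ⊆ᴳ H × H ⊆ᴳ G

_⊆ᴳ?_ : ∀ {n} (G H : Graph n) → Dec (G ⊆ᴳ H)
G ⊆ᴳ? H = all? λ i → all? λ j → T? (Graph.adj G i j) →-dec T? (Graph.adj H i j)

graphDecSetoid : ℕ → DecSetoid 0ℓ 0ℓ
graphDecSetoid n = record
  { Carrier = Graph n
  ; _≈_ = _≐ᴳ_
  ; isDecEquivalence = record
    { isEquivalence = record
      { refl  = (λ _ _ → id) , (λ _ _ → id)
      ; sym   = λ (f , g) → g , f
      ; trans = λ (f , g) (h , k) → (λ i j → h i j ∘ f i j) , (λ i j → g i j ∘ k i j)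
      }
    ; _≟_ = λ G H → (G ⊆ᴳ? H) ×-dec (H ⊆ᴳ? G)
    }
  }

-- Joins a b u v: {u , v} is the edge {a , b}.
Joins : ∀ {n} → Fin n → Fin n → Rel (Fin n) 0ℓ
Joins a b u v = (u ≡ a × v ≡ b) ⊎ (u ≡ b × v ≡ a)

joins? : ∀ {n} (a b u v : Fin n) → Dec (Joins a b u v)
joins? a b u v = ((u Fin.≟ a) ×-dec (v Fin.≟ b)) ⊎-dec ((u Fin.≟ b) ×-dec (v Fin.≟ a))

joins-sym : ∀ {n} {a b : Fin n} → Symmetric (Joins a b)
joins-sym (inj₁ (p , q)) = inj₂ (q , p)
joins-sym (inj₂ (p , q)) = inj₁ (q , p)

remove? : ∀ {n} (H : Graph n) (a b u v : Fin n) → Dec (Adj H u v × ¬ Joins a b u v)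
remove? H a b u v = T? (Graph.adj H u v) ×-dec ¬? (joins? a b u v)

infixl 6 _∖[_,_]

_∖[_,_] : ∀ {n} → Graph n → Fin n → Fin n → Graph n
H ∖[ a , b ] = record
  { adj    = λ u v → isYes (remove? H a b u v)
  ; symm   = λ {u} {v} p → let (h , ¬e) = toWitness {a? = remove? H a b u v} p in
               fromWitness {a? = remove? H a b v u} (Graph.symm H h , ¬e ∘ joins-sym)
  ; irrefl = λ {u} p → Graph.irrefl H (proj₁ (toWitness {a? = remove? H a b u u} p))
  }

lastSide : ∀ {k} → Fin (2 ℕ.+ k)
lastSide {k} = fromℕ (1 ℕ.+ k)

module _ {n : ℕ} where

  Connected : Rel (Fin n) 0ℓ → Set
  Connected R = ∀ u v → Star R u v

  Noncrossing : Rel (Fin n) 0ℓ → Set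
  Noncrossing R = ∀ {a b c d} → a < b → b < c → c < d → R a c → ¬ R b d

  -- A vertex sequence i₁ , … , iₘ with m ≥ 3 is a function on Fin (3 + k).
  -- Chord is its edge i₁iₘ; Side i j, for j : Fin (2 + k), runs over the
  -- edges i₁i₂ , … , iₘ₋₁iₘ, so that Side i ∘ inject₁, on Fin (1 + k),
  -- omits the last of them.
  Chord : ∀ {k} → (Fin (3 ℕ.+ k) → Fin n) → Rel (Fin n) 0ℓ
  Chord {k} i = Joins (i zero) (i (fromℕ (2 ℕ.+ k)))

  Side : ∀ {k} → (Fin (3 ℕ.+ k) → Fin n) → Fin (2 ℕ.+ k) → Rel (Fin n) 0ℓ
  Side i j = Joins (i (inject₁ j)) (i (suc j))

  OnCycle : ∀ {k} → (Fin (3 ℕ.+ k) → Fin n) → Rel (Fin n) 0ℓ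
  OnCycle i u v = Chord i u v ⊎ ∃[ j ] Side i j u v

  IsCycle : ∀ {k} → Rel (Fin n) 0ℓ → (Fin (3 ℕ.+ k) → Fin n) → Set
  IsCycle R i = Injective _≡_ _≡_ i × OnCycle i ⇒ R

  -- Cycles are identified when they have the same edges.
  IsUniqueCycle : ∀ {k} → Rel (Fin n) 0ℓ → (Fin (3 ℕ.+ k) → Fin n) → Set
  IsUniqueCycle R i =
    IsCycle R i ×
    (∀ {l} (i′ : Fin (3 ℕ.+ l) → Fin n) → IsCycle R i′ →
     ∀ u v → OnCycle i′ u v ⇔ OnCycle i u v)

  Acyclic : Rel (Fin n) 0ℓ → Set
  Acyclic R = ∀ {k} (i : Fin (3 ℕ.+ k) → Fin n) → ¬ IsCycle R i

  Increasing : ∀ {m} → (Fin m → Fin n) → Set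
  Increasing i = i Preserves _<_ ⟶ _<_

record NoncrossingTree (n : ℕ) : Set where
  field
    graph       : Graph n
    connected   : Connected (Adj graph)
    acyclic     : Acyclic (Adj graph)
    noncrossing : Noncrossing (Adj graph)

record TreeIn {n : ℕ} (G : Graph n) : Set where
  field
    tree   : NoncrossingTree n
  open NoncrossingTree tree public
  field
    inside : graph ⊆ᴳ G

treeInDecSetoid : ∀ {n} → Graph n → DecSetoid 0ℓ 0ℓ
treeInDecSetoid {n} G = On.decSetoid (graphDecSetoid n) (TreeIn.graph {G = G})

IsReduced : ∀ {n} (G : Graph n) → TreeIn G → Set
IsReduced {n} G T =
  ∀ {k} (i : Fin (3 ℕ.+ k) → Fin n) → Increasing i →
  Chord i ⇒ Adj graph →
  (∀ j → Side i (inject₁ j) ⇒ Adj graph) →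
  Side i lastSide ⇒ Adj G →
  ¬ Noncrossing (Adj graph ∪ Side i lastSide)
  where open TreeIn T

record ReducedTree {n : ℕ} (G : Graph n) : Set where
  field
    treeIn  : TreeIn G
    reduced : IsReduced G treeIn
  open TreeIn treeIn public

reducedDecSetoid : ∀ {n} → Graph n → DecSetoid 0ℓ 0ℓ
reducedDecSetoid {n} G = On.decSetoid (graphDecSetoid n) (ReducedTree.graph {G = G})

private

  path : ∀ {A : Set} {S : Rel A 0ℓ} {m} (f : Fin (suc m) → A) →
         (∀ j → S (f (inject₁ j)) (f (suc j))) → Star S (f zero) (f (fromℕ m))
  path {m = zero}  f s = ε
  path {m = suc m} f s = s zero ◅ path (f ∘ suc) (s ∘ suc)

  split : ∀ {A : Set} {S : Rel A 0ℓ} {m} (f : Fin (suc m) → A) (j : Fin m) →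
          (∀ l → l ≢ j → S (f (inject₁ l)) (f (suc l))) →
          Star S (f zero) (f (inject₁ j)) × Star S (f (suc j)) (f (fromℕ m))
  split f zero    s = ε , path (f ∘ suc) (λ l → s (suc l) (λ ()))
  split f (suc j) s =
    let (p , q) = split (f ∘ suc) j (λ l l≢j → s (suc l) (λ { refl → l≢j refl }))
    in s zero (λ ()) ◅ p , q

  module _ {n k : ℕ} (H : Graph n) (i : Fin (3 ℕ.+ k) → Fin n)
           (cyc : IsCycle (Adj H) i) where

    keep : ∀ {a b u v} → Adj H u v → ¬ Joins a b u v → Adj (H ∖[ a , b ]) u v
    keep {a} {b} {u} {v} h ¬e = fromWitness {a? = remove? H a b u v} (h , ¬e)

    chord≢side : ∀ j → ¬ Side i j (i zero) (i (fromℕ (2 ℕ.+ k)))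
    chord≢side zero    (inj₁ (_ , q)) with () ← proj₁ cyc q
    chord≢side (suc j) (inj₁ (p , _)) with () ← proj₁ cyc p
    chord≢side j       (inj₂ (p , _)) with () ← proj₁ cyc p

    side≢chord : ∀ j → ¬ Chord i (i (inject₁ j)) (i (suc j))
    side≢chord j (inj₁ (p , q)) = chord≢side j (inj₁ (sym p , sym q))
    side≢chord j (inj₂ (p , q)) = chord≢side j (inj₂ (sym q , sym p))

    side≢side : ∀ j l → l ≢ j → ¬ Side i j (i (inject₁ l)) (i (suc l))
    side≢side j l l≢j (inj₁ (p , _)) = l≢j (inject₁-injective (proj₁ cyc p))
    side≢side j l l≢j (inj₂ (p , q)) = ℕ.<-irrefl refl (ℕ.<-trans j<l l<j)
      where
      j<l : toℕ j ℕ.< toℕ l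
      j<l = ℕ.≤-reflexive (sym (trans (sym (toℕ-inject₁ l)) (cong toℕ (proj₁ cyc p))))
      l<j : toℕ l ℕ.< toℕ j
      l<j = ℕ.≤-reflexive (trans (cong toℕ (proj₁ cyc q)) (toℕ-inject₁ j))

    detourChord : Star (Adj (H ∖[ i zero , i (fromℕ (2 ℕ.+ k)) ]))
                       (i zero) (i (fromℕ (2 ℕ.+ k)))
    detourChord = path i λ j →
      keep (proj₂ cyc (inj₂ (j , inj₁ (refl , refl)))) (side≢chord j)

    detourSide : ∀ j → Star (Adj (H ∖[ i (inject₁ j) , i (suc j) ]))
                            (i (inject₁ j)) (i (suc j))
    detourSide j = Star.reverse (Graph.symm H′) toFirst ◅◅ chord ◅ Star.reverse (Graph.symm H′) toLast
      where
      H′ : Graph n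
      H′ = H ∖[ i (inject₁ j) , i (suc j) ]
      pieces = split {S = Adj H′} i j λ l l≢j →
        keep (proj₂ cyc (inj₂ (l , inj₁ (refl , refl)))) (side≢side j l l≢j)
      toFirst = proj₁ pieces
      toLast  = proj₂ pieces
      chord : Adj H′ (i zero) (i (fromℕ (2 ℕ.+ k)))
      chord = keep (proj₂ cyc (inj₁ (inj₁ (refl , refl)))) (chord≢side j)

removeFromCycle : ∀ {n k} (G H : Graph n) (i : Fin (3 ℕ.+ k) → Fin n) →
  H ⊆ᴳ G → Connected (Adj H) → Noncrossing (Adj H) → IsUniqueCycle (Adj H) i →
  ∀ a b → OnCycle i a b → Star (Adj (H ∖[ a , b ])) a b → TreeIn G
removeFromCycle {n} G H i H⊆G conn nonx (cyc , uniq) a b a—b detour = record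
  { tree = record
    { graph       = H′
    ; connected   = λ u v → kleisliStar id step (conn u v)
    ; acyclic     = λ i′ (inj , on) → proj₂
        (out a b (on (Equivalence.from (uniq i′ (inj , λ {u} {v} e → proj₁ (out u v (on e))) a b) a—b)))
        (inj₁ (refl , refl))
    ; noncrossing = λ {u} {v} {w} {z} u<v v<w w<z uw vz →
        nonx u<v v<w w<z (proj₁ (out u w uw)) (proj₁ (out v z vz))
    }
  ; inside = λ u v e → H⊆G u v (proj₁ (out u v e))
  }
  where
  H′ : Graph n
  H′ = H ∖[ a , b ]
  out : ∀ u v → Adj H′ u v → Adj H u v × ¬ Joins a b u v
  out u v = toWitness {a? = remove? H a b u v}
  step : Adj H ⇒ Star (Adj H′)
  step {u} {v} h with joins? a b u v
  ... | yes (inj₁ (refl , refl)) = detour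
  ... | yes (inj₂ (refl , refl)) = Star.reverse (Graph.symm H′) detour
  ... | no ¬e                    = fromWitness {a? = remove? H a b u v} (h , ¬e) ◅ ε

Monomial : ℕ → Set
Monomial n = List (Generator n)

∏ : ∀ {n} → Monomial n → FK n
∏ = foldr (λ g y → X g * y) (ι 1ℚ)

-- Products of permutations are composed from right to left, so the last
-- transposition acts first; note that π₁ ∘ₚ π₂ applies π₁ first.
σ⟨_⟩ : ∀ {n} → Monomial n → Permutation′ n
σ⟨ []    ⟩ = Perm.id
σ⟨ g ∷ P ⟩ = σ⟨ P ⟩ ∘ₚ transpose (src g) (tgt g)

-- The fibres of f are the cycles of π, fixed points included.
HasCycles : ∀ {n} → Permutation′ n → ℕ → Set
HasCycles {n} π m =
  ∃[ f ] Surjective {A = Fin n} {B = Fin m} _≡_ _≡_ f ×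
         (∀ i j → f i ≡ f j ⇔ Star (λ u v → π ⟨$⟩ʳ u ≡ v) i j)

IsSimple : ∀ {n} → Monomial n → Set
IsSimple {n} P = ∃[ m ] HasCycles σ⟨ P ⟩ m × m ℕ.+ length P ≡ n

-- The map i ↦ i + 1, with the last element sent to the first.
longCycle : ∀ n → Permutation′ n
longCycle zero    = Perm.id
longCycle (suc m) = insert (fromℕ m) zero Perm.id

record SimpleMonomial {n : ℕ} (G : Graph n) (σ : Permutation′ n) : Set where
  field
    monomial : Monomial n
    inG      : All (λ g → Adj G (src g) (tgt g)) monomial
    simple   : IsSimple monomial
    perm     : σ⟨ monomial ⟩ Perm.≈ σ

-- The subspace of FK n spanned by simple monomials in the generators of
-- the subalgebra of G.  These lie in that subalgebra, so their span there
-- and their span in FK n agree.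
𝓔[_,_] : ∀ {n} → Graph n → Permutation′ n → Pred (FK n) 0ℓ
𝓔[_,_] {n} G σ = Linear.Span (FK-module n) {SimpleMonomial G σ} (∏ ∘ SimpleMonomial.monomial)

-- j comes before k in the sequence i-1 , … , 1 , n , … , i+1.
Before : ∀ {n} → Fin n → Fin n → Fin n → Set
Before i j k = (k < j × j < i) ⊎ (j < i × i < k) ⊎ (i < k × k < j)

record EdgeOrder {n : ℕ} (T : NoncrossingTree n) : Set where
  open NoncrossingTree T
  field
    word    : Monomial n
    edges   : ∀ g → g ∈ word ⇔ (src g < tgt g × Adj graph (src g) (tgt g))
    once    : Unique word
    ordered : AllPairs (λ e f → ∀ {i j k} → Joins (src e) (tgt e) i j →
                                Joins (src f) (tgt f) i k → Before i j k) word

record TreeRelation {n : ℕ} (G : Graph n) : Set where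
  field
    {k}           : ℕ
    i             : Fin (3 ℕ.+ k) → Fin n
    increasing    : Increasing i
    H             : Graph n
    H⊆G           : H ⊆ᴳ G
    H-connected   : Connected (Adj H)
    H-noncrossing : Noncrossing (Adj H)
    H-cycle       : IsUniqueCycle (Adj H) i

  T₁ : TreeIn G
  T₁ = removeFromCycle G H i H⊆G H-connected H-noncrossing H-cycle
         (i zero) (i (fromℕ (2 ℕ.+ k))) (inj₁ (inj₁ (refl , refl)))
         (detourChord H i (proj₁ H-cycle))

  -- T₂₊ lists T₂ , … , Tₘ.
  T₂₊ : Fin (2 ℕ.+ k) → TreeIn G
  T₂₊ j = removeFromCycle G H i H⊆G H-connected H-noncrossing H-cycle
            (i (inject₁ j)) (i (suc j)) (inj₂ (j , inj₁ (refl , refl)))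
            (detourSide H i (proj₁ H-cycle) j)

  lhs : TreeIn G
  lhs = T₂₊ lastSide

  rhs : Comb (TreeIn G)
  rhs = (1ℚ , T₁) ∷ map (λ j → ℚ.- 1ℚ , T₂₊ (inject₁ j)) (allFin (1 ℕ.+ k))

  rhs-lhs : Comb (TreeIn G)
  rhs-lhs = (ℚ.- 1ℚ , lhs) ∷ rhs

module _ {n : ℕ} (G : Graph n) where
  open Formal (treeInDecSetoid G)

  GeneratedByRelations : Pred (Comb (TreeIn G)) 0ℓ
  GeneratedByRelations c =
    Σ[ ρ ∈ Comb (TreeRelation G) ] c ≋ concatMap (λ (q , R) → q ⊛ TreeRelation.rhs-lhs R) ρ

  -- A state is a linear combination of the x_T with like terms collected
  -- (that is, taken up to _≋_); a step picks a relation whose left-hand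
  -- side occurs with nonzero coefficient and replaces that term.
  infix 4 _⟶_

  _⟶_ : Rel (Comb (TreeIn G)) 0ℓ
  c ⟶ d = Σ[ R ∈ TreeRelation G ] let open TreeRelation R in
    coeff c lhs ≢ 0ℚ × d ≋ c ++ coeff c lhs ⊛ rhs-lhs

-- The value of x_T does not depend on the admissible edge order, so an
-- arbitrary choice of orders is a parameter here rather than a definition.
module TreeProducts {n : ℕ} (G : Graph n)
                    (order : (T : NoncrossingTree n) → EdgeOrder T) where
  open Linear (FK-module n) public
  private
    module F = Formal (treeInDecSetoid G)
    module B = Formal (reducedDecSetoid G)

  x : TreeIn G → FK n
  x T = ∏ (EdgeOrder.word (order (TreeIn.tree T)))

  xʳ : ReducedTree G → FK n
  xʳ = x ∘ ReducedTree.treeIn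

  ReducedTreesFormBasis : Set
  ReducedTreesFormBasis = IsBasisOf (reducedDecSetoid G) xʳ 𝓔[ G , longCycle n ]

  RelationsAreGenerated : Set
  RelationsAreGenerated = ∀ c → ⟦ c ⟧ x ≈ ι 0ℚ ⇔ GeneratedByRelations G c

  IsExpansion : FK n → Comb (ReducedTree G) → Set
  IsExpansion y b = y ≈ ⟦ b ⟧ xʳ × (∀ b′ → y ≈ ⟦ b′ ⟧ xʳ → b′ B.≋ b)

  RewritingTerminatesInExpansion : Set
  RewritingTerminatesInExpansion =
    StronglyNormalizing (_⟶_ G) ×
    (∀ y → 𝓔[ G , longCycle n ] y →
     ∃[ b ] IsExpansion y b ×
       (∀ c d → y ≈ ⟦ c ⟧ x → Star (_⟶_ G) c d → IsNormalForm (_⟶_ G) d →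
        d F.≋ mapComb ReducedTree.treeIn b))

{-# OPTIONS --safe #-}

-- A word whose transpositions multiply to (1 2 ⋯ n) and which has n − 1 letters
-- spells a tree, and its first letter ij cuts the cycle into the arcs [i , j)
-- and [j , i), in which the remaining letters multiply to the cyclic
-- successions.  Repeating this shows that such words are exactly the admissible
-- edge orders of noncrossing trees.  In the word of T₁ the sides of the cycle of
-- H can be moved next to each other, and rotating this path gives words of the
-- other trees; so the relations follow from the cyclic relation
-- x₁₂ x₂₃ ⋯ + x₂₃ ⋯ xₘ₁ + ⋯ = 0, which comes from the triangle relations by
-- adding one vertex at a time.  The sum of all a + b over the edges ab
-- increases along the relations, so rewriting ends in reduced trees.
--
-- For independence, choose for every vertex v < n a vertex p(v) > v and map FK n
-- to iterated dual numbers by merging 1 , 2 , … into p(1) , p(2) , … in turn,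
-- where merging v sends x between v and p(v) to a new ε.  The coefficient of the
-- product of all ε is a functional.  Given T, let p(1) be the least neighbour of
-- 1 in T, contract this edge, and continue.  The functional of p is 1 at T and
-- vanishes at all reduced trees whose own p is lexicographically larger; and a
-- reduced tree is determined by its p.

module Submission where

open import Defs
open import Algebra.Bundles using (AbelianGroup; CommutativeMonoid; CommutativeRing; Ring)
import Algebra.Construct.DirectProduct as DirectProduct
import Algebra.Module.Construct.TensorUnit as TensorUnit
import Algebra.Properties.CommutativeSemigroup as CommutativeSemigroupProperties
import Algebra.Properties.Ring as RingProperties
import Algebra.Properties.Semiring.Sum as SemiringSum
import Algebra.Solver.Ring.NaturalCoefficients.Default as NaturalCoefficients
open import Algebra.Module.Bundles using (LeftModule)
open import Data.Bool.Base as Bool using (Bool; true; false; if_then_else_)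
open import Data.Empty using (⊥; ⊥-elim)
open import Data.Fin.Base as Fin using (Fin; zero; suc; toℕ; fromℕ; inject₁; punchIn; punchOut)
open import Data.Fin.Patterns using (0F; 1F; 2F; 3F; 4F; 5F)
open import Data.Fin.Permutation as Perm using (Permutation′; _⟨$⟩ʳ_; _⟨$⟩ˡ_)
import Data.Fin.Permutation.Components as PC
import Data.Fin.Properties as Fin
open import Data.Fin.Subset as Subset using (Subset)
import Data.Fin.Subset.Properties as Subset
open import Data.List.Base as List using (List; []; _∷_; _++_; length)
open import Data.List.Membership.Propositional using (_∈_; _∉_; find; lose)
import Data.List.Membership.Propositional.Properties as ∈
open import Data.List.Membership.Propositional.Properties.WithK using (unique∧set⇒bag)
open import Data.List.Relation.Binary.BagAndSetEquality using (∼bag⇒↭)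
open import Data.List.Relation.Binary.Permutation.Propositional using (_↭_; ↭-refl; ↭-sym; ↭-trans; ↭-prep; ↭-swap)
open import Data.List.Relation.Binary.Permutation.Propositional.Properties using (∈-resp-↭; All-resp-↭; Any-resp-↭; ↭-length; shift; ∷↭∷ʳ; ++-comm; ++⁺ˡ; ++⁺ʳ) renaming (map⁺ to ↭-map⁺)
open import Data.List.Properties using (++-assoc; ++-identityʳ; length-++; length-map; length-tabulate; map-++; concatMap-++; filter-notAll)
open import Data.List.Relation.Unary.All as All using (All; []; _∷_)
import Data.List.Relation.Unary.All.Properties as All
open import Data.List.Relation.Unary.AllPairs as AllPairs using (AllPairs; []; _∷_)
open import Data.List.Relation.Unary.Any as Any using (Any; here; there)
import Data.List.Relation.Unary.Any.Properties as Any
import Data.List.Relation.Unary.AllPairs.Properties as AllPairs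
open import Data.Nat.Base as ℕ using (ℕ; zero; suc; z≤n; s≤s)
open import Data.Nat.Induction using (<-wellFounded)
import Data.Nat.Properties as ℕ
open import Data.Product hiding (swap)
open import Data.Product.Properties using (,-injective) renaming (≡-dec to ×-≡-dec)
open import Data.Product.Relation.Binary.Lex.Strict using (×-Lex; ×-wellFounded)
open import Data.Rational.Base as ℚ using (ℚ; 0ℚ; 1ℚ)
import Data.Rational.Properties as ℚ
open import Data.Sum.Base as Sum using (_⊎_; inj₁; inj₂; [_,_]′; swap)
open import Data.Unit.Base using (⊤; tt)
open import Data.Vec.Base as Vec using (Vec; []; _∷_; lookup)
import Data.Vec.Properties as Vec
open import Function.Base using (_∘_; id; flip; case_of_)
open import Data.Fin.Induction using (<-weakInduction; >-weakInduction) renaming (<-wellFounded to Fin-<-wellFounded; >-wellFounded to Fin->-wellFounded)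
open import Data.Fin.Relation.Unary.Top using (view; ‵fromℕ; ‵inject₁)
open import Data.List.Relation.Unary.Unique.Propositional using (Unique)
open import Function.Bundles using (_⇔_; mk⇔; Equivalence)
open import Induction.WellFounded using (Acc; acc; WellFounded)
open import Level using (0ℓ)
open import Relation.Binary.Construct.Closure.ReflexiveTransitive as Star using (Star; ε; _◅_; _◅◅_)
open import Relation.Binary.Bundles using (DecSetoid)
import Relation.Binary.Construct.On as On
open import Relation.Binary.Core using (Rel) renaming (_⇒_ to _⊑_)
open import Relation.Binary.Definitions using (Tri; tri<; tri≈; tri>; Symmetric)
open import Relation.Binary.PropositionalEquality hiding (setoid; [_])
import Relation.Binary.Reasoning.Setoid as SetoidReasoning
open import Relation.Binary.Rewriting using (StronglyNormalizing; IsNormalForm)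
open import Relation.Nullary
open import Relation.Nullary.Decidable using (map′; recompute; isYes; toWitness; fromWitness; T?; _×-dec_; _⊎-dec_)
open import Relation.Nullary.Reflects using (_×-reflects_; _⊎-reflects_; _→-reflects_)

-- Confluence is not checked on overlaps of relations. A rewriting step keeps the value in `FK n`, a
-- normal form involves only reduced trees, and linear independence leaves one such combination for
-- each value. So everything unique in the theorem rests on independence, which is needed for every
-- `G` and is obtained from explicit functionals instead of a count of trees. The targets of these
-- functionals are commutative, so the triangle relation is the critical one. When the first vertex
-- 0 is merged into `b` and the letter 0b goes to ε, the triangle 0bk becomes ε c_bk - c_bk c_bk -
-- c_bk ε: the terms with ε cancel, and the square vanishes. Merging a vertex into its least
-- neighbour is what lets reducedness survive the contraction. All other neighbours lie above this
-- one, and an edge between later vertices that passed over it would cross the contracted edge. So a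
-- polygon that violates reducedness after the contraction lifts to one before it.

-- Deciding statements about the order of finitely many vertices

infix  8 _≺_ _≐_
infixr 7 _∧_
infixr 6 _∨_
infixr 5 _⇒_

-- Case distinctions on the cyclic order of up to six vertices recur throughout. Written as formulas
-- they can be decided by computation.
data Formula (k : ℕ) : Set where
  _≺_ _≐_       : Fin k → Fin k → Formula k
  _∧_ _∨_ _⇒_   : Formula k → Formula k → Formula k
  falsum        : Formula k

module _ {k : ℕ} where

  ⟦_⟧ᶠ : ∀ {n} → Formula k → Vec (Fin n) k → Set
  ⟦ i ≺ j  ⟧ᶠ v = lookup v i Fin.< lookup v j
  ⟦ i ≐ j  ⟧ᶠ v = lookup v i ≡ lookup v j
  ⟦ φ ∧ ψ  ⟧ᶠ v = ⟦ φ ⟧ᶠ v × ⟦ ψ ⟧ᶠ v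
  ⟦ φ ∨ ψ  ⟧ᶠ v = ⟦ φ ⟧ᶠ v ⊎ ⟦ ψ ⟧ᶠ v
  ⟦ φ ⇒ ψ  ⟧ᶠ v = ⟦ φ ⟧ᶠ v → ⟦ ψ ⟧ᶠ v
  ⟦ falsum ⟧ᶠ v = ⊥

  eval : Formula k → Vec ℕ k → Bool
  eval (i ≺ j)  r = lookup r i ℕ.<ᵇ lookup r j
  eval (i ≐ j)  r = lookup r i ℕ.≡ᵇ lookup r j
  eval (φ ∧ ψ)  r = eval φ r Bool.∧ eval ψ r
  eval (φ ∨ ψ)  r = eval φ r Bool.∨ eval ψ r
  eval (φ ⇒ ψ)  r = Bool.not (eval φ r) Bool.∨ eval ψ r
  eval falsum   r = false

allBelow : ℕ → (ℕ → Bool) → Bool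
allBelow zero    p = true
allBelow (suc b) p = p b Bool.∧ allBelow b p

allVecs : (b m : ℕ) → (Vec ℕ m → Bool) → Bool
allVecs b zero    p = p []
allVecs b (suc m) p = allBelow b λ x → allVecs b m λ r → p (x ∷ r)

T-∧ : ∀ {a b} → Bool.T (a Bool.∧ b) → Bool.T a × Bool.T b
T-∧ {true} t = _ , t

allBelow-sound : ∀ b p → Bool.T (allBelow b p) → ∀ {x} → x ℕ.< b → Bool.T (p x)
allBelow-sound (suc b) p t {x} (s≤s x≤b) with x ℕ.≟ b
... | yes refl = proj₁ (T-∧ t)
... | no x≢b   = allBelow-sound b p (proj₂ (T-∧ {p b} t)) (ℕ.≤∧≢⇒< x≤b x≢b)

allVecs-sound : ∀ b {m} p → Bool.T (allVecs b m p) →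
                (r : Vec ℕ m) → (∀ i → lookup r i ℕ.< b) → Bool.T (p r)
allVecs-sound b p t []      r< = t
allVecs-sound b p t (x ∷ r) r< =
  allVecs-sound b _ (allBelow-sound b _ t (r< zero)) r (r< ∘ suc)

𝟙 : ∀ {A : Set} → Dec A → ℕ
𝟙 d = if does d then 1 else 0

𝟙-mono : ∀ {A B : Set} (d : Dec A) (e : Dec B) → (A → B) → 𝟙 d ℕ.≤ 𝟙 e
𝟙-mono (no _)  _       _ = z≤n
𝟙-mono (yes _) (yes _) _ = ℕ.≤-refl
𝟙-mono (yes a) (no ¬b) f = contradiction (f a) ¬b

𝟙-strict : ∀ {A B : Set} (d : Dec A) (e : Dec B) → ¬ A → B → 𝟙 d ℕ.< 𝟙 e
𝟙-strict (yes a) _       ¬a _ = contradiction a ¬a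
𝟙-strict (no _)  (yes _) _  _ = ℕ.≤-refl
𝟙-strict (no _)  (no ¬b) _  b = contradiction b ¬b

𝟙≤1 : ∀ {A : Set} (d : Dec A) → 𝟙 d ℕ.≤ 1
𝟙≤1 (yes _) = ℕ.≤-refl
𝟙≤1 (no _)  = z≤n

module _ {n : ℕ} where

  countBelow : ∀ {m} → Vec (Fin n) m → Fin n → ℕ
  countBelow []      x = 0
  countBelow (y ∷ v) x = 𝟙 (y Fin.<? x) ℕ.+ countBelow v x

  countBelow-mono : ∀ {m} (v : Vec (Fin n) m) {x x′} → x Fin.≤ x′ →
                    countBelow v x ℕ.≤ countBelow v x′
  countBelow-mono []      x≤x′ = z≤n
  countBelow-mono (y ∷ v) x≤x′ =
    ℕ.+-mono-≤ (𝟙-mono (y Fin.<? _) (y Fin.<? _) λ y<x → ℕ.<-≤-trans y<x x≤x′)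
               (countBelow-mono v x≤x′)

  countBelow-strict : ∀ {m} (v : Vec (Fin n) m) i {x′} → lookup v i Fin.< x′ →
                      countBelow v (lookup v i) ℕ.< countBelow v x′
  countBelow-strict (y ∷ v) zero    y<x′ =
    ℕ.+-mono-<-≤ (𝟙-strict (y Fin.<? y) (y Fin.<? _) (ℕ.<-irrefl refl) y<x′)
                 (countBelow-mono v (ℕ.<⇒≤ y<x′))
  countBelow-strict (y ∷ v) (suc i) x<x′ =
    ℕ.+-mono-≤-< (𝟙-mono (y Fin.<? _) (y Fin.<? _) λ y<x → ℕ.<-trans y<x x<x′)
                 (countBelow-strict v i x<x′)

  countBelow≤ : ∀ {m} (v : Vec (Fin n) m) x → countBelow v x ℕ.≤ m
  countBelow≤ []      x = z≤n
  countBelow≤ (y ∷ v) x = ℕ.+-mono-≤ (𝟙≤1 (y Fin.<? x)) (countBelow≤ v x)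

  countBelow< : ∀ {m} (v : Vec (Fin n) m) i → countBelow v (lookup v i) ℕ.< m
  countBelow< (y ∷ v) zero    =
    ℕ.+-mono-≤ (𝟙-strict (y Fin.<? y) (yes tt) (ℕ.<-irrefl refl) tt) (countBelow≤ v y)
  countBelow< (y ∷ v) (suc i) = ℕ.+-mono-≤-< (𝟙≤1 (y Fin.<? lookup v i)) (countBelow< v i)

  -- Replacing every entry by the number of smaller entries preserves and
  -- reflects the order, so a formula in k variables need only be checked on
  -- entries below k.
  module _ {k : ℕ} (v : Vec (Fin n) k) where

    ranks : Vec ℕ k
    ranks = Vec.map (countBelow v) v

    ranks-lookup : ∀ i → lookup ranks i ≡ countBelow v (lookup v i)
    ranks-lookup i = Vec.lookup-map i (countBelow v) v

    <-reflects : ∀ i j → Reflects (lookup v i Fin.< lookup v j) (lookup ranks i ℕ.<ᵇ lookup ranks j)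
    <-reflects i j rewrite ranks-lookup i | ranks-lookup j
      with countBelow v (lookup v i) ℕ.<ᵇ countBelow v (lookup v j)
         | ℕ.<ᵇ-reflects-< (countBelow v (lookup v i)) (countBelow v (lookup v j))
    ... | true  | ofʸ lt = ofʸ (ℕ.≰⇒> λ ≥ → ℕ.<⇒≱ lt (countBelow-mono v ≥))
    ... | false | ofⁿ ≮  = ofⁿ (≮ ∘ countBelow-strict v i)

    ≡-reflects : ∀ i j → Reflects (lookup v i ≡ lookup v j) (lookup ranks i ℕ.≡ᵇ lookup ranks j)
    ≡-reflects i j rewrite ranks-lookup i | ranks-lookup j
      with countBelow v (lookup v i) ℕ.≡ᵇ countBelow v (lookup v j)
         | proof (countBelow v (lookup v i) ℕ.≟ countBelow v (lookup v j))
    ... | false | ofⁿ ≢ = ofⁿ (≢ ∘ cong (countBelow v))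
    ... | true  | ofʸ e with Fin.<-cmp (lookup v i) (lookup v j)
    ...   | tri< lt _ _ = contradiction e (ℕ.<⇒≢ (countBelow-strict v i lt))
    ...   | tri≈ _ eq _ = ofʸ eq
    ...   | tri> _ _ gt = contradiction (sym e) (ℕ.<⇒≢ (countBelow-strict v j gt))

    eval-reflects : ∀ φ → Reflects (⟦ φ ⟧ᶠ v) (eval φ ranks)
    eval-reflects (i ≺ j) = <-reflects i j
    eval-reflects (i ≐ j) = ≡-reflects i j
    eval-reflects (φ ∧ ψ) = eval-reflects φ ×-reflects eval-reflects ψ
    eval-reflects (φ ∨ ψ) = eval-reflects φ ⊎-reflects eval-reflects ψ
    eval-reflects (φ ⇒ ψ) = eval-reflects φ →-reflects eval-reflects ψ
    eval-reflects falsum  = ofⁿ λ ()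

    -- For a concrete `φ` the implicit argument computes to the unit type and is filled in by
    -- unification, so every use is a finite check over the `k ^ k` candidates for the vector of
    -- ranks.
    by-order : ∀ φ → {Bool.T (allVecs k k (eval φ))} → ⟦ φ ⟧ᶠ v
    by-order φ {t} with eval φ ranks | eval-reflects φ | allVecs-sound k (eval φ) t ranks ranks<
      where
      ranks< : ∀ i → lookup ranks i ℕ.< k
      ranks< i = subst (ℕ._< k) (sym (ranks-lookup i)) (countBelow< v i)
    ... | true | ofʸ p | _ = p

-- arc u v s: v lies strictly inside the arc that leads upwards cyclically
-- from u to s; for s ≡ u this is everything but u.
arc : ∀ {k} → Fin k → Fin k → Fin k → Formula k
arc u v s = (u ≺ v ∧ v ≺ s) ∨ ((s ≺ u ∨ s ≐ u) ∧ (u ≺ v ∨ v ≺ s))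

Arc : ∀ {n} → Fin n → Fin n → Fin n → Set
Arc u v s = ⟦ arc 0F 1F 2F ⟧ᶠ (u ∷ v ∷ s ∷ [])

-- Connectivity by a list of edges

Ends : ∀ {n} → Generator n → Rel (Fin n) 0ℓ
Ends g = Joins (src g) (tgt g)

src≢tgt : ∀ {n} (g : Generator n) → src g ≢ tgt g
src≢tgt (gen i j i≢j) = recompute (¬? (i Fin.≟ j)) i≢j

ends-≢ : ∀ {n} (g : Generator n) {i j} → Ends g i j → i ≢ j
ends-≢ g (inj₁ (refl , refl)) = src≢tgt g
ends-≢ g (inj₂ (refl , refl)) = src≢tgt g ∘ sym

self-ends : ∀ {n} (g : Generator n) → Ends g (src g) (tgt g)
self-ends g = inj₁ (refl , refl)

same-ends : ∀ {n} (g : Generator n) {i j u v} → Ends g i j → Ends g u v → Joins i j u v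
same-ends g (inj₁ (refl , refl)) e = e
same-ends g (inj₂ (refl , refl)) e = swap e

Link Conn : ∀ {n} → Monomial n → Rel (Fin n) 0ℓ
Link L u v = Any (λ g → Ends g u v) L
Conn L = Star (Link L)

module _ {n : ℕ} where

  -- Acyclicity read from the right end of the word, the direction in which `components` counts:
  -- each letter has to join two different components of the letters after it.
  Forest : Monomial n → Set
  Forest []      = ⊤
  Forest (g ∷ L) = ¬ Conn L (src g) (tgt g) × Forest L

  link-sym : ∀ L → Symmetric (Link {n} L)
  link-sym L = Any.map joins-sym

  conn-sym : ∀ L → Symmetric (Conn {n} L)
  conn-sym L = Star.reverse (link-sym L)

  conn-mono : ∀ {L M : Monomial n} → (∀ {g} → g ∈ L → g ∈ M) → ∀ {u v} → Conn L u v → Conn M u v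
  conn-mono L⊆M = Star.map λ l → let (g , g∈L , e) = find l in lose (L⊆M g∈L) e

  conn-there : ∀ {g : Generator n} {L u v} → Conn L u v → Conn (g ∷ L) u v
  conn-there = conn-mono there

  conn-here : ∀ (g : Generator n) L {i j} → Ends g i j → Conn (g ∷ L) i j
  conn-here g L e = here e ◅ ε

  conn-invariant : ∀ {A : Set} {L : Monomial n} (f : Fin n → A) → (∀ {u v} → Link L u v → f u ≡ f v) →
                   ∀ {u v} → Conn L u v → f u ≡ f v
  conn-invariant f inv ε       = refl
  conn-invariant f inv (l ◅ p) = trans (inv l) (conn-invariant f inv p)

  -- A letter lowers the number of components by one if its ends were not yet connected and leaves
  -- it unchanged otherwise. Hence `bound`, with equality exactly for forests; this turns a
  -- condition on the length of a word into acyclicity.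
  record Components (L : Monomial n) : Set where
    field
      count    : ℕ
      label    : Fin n → Fin count
      onto     : ∀ c → ∃[ u ] label u ≡ c
      sound    : ∀ {u v} → label u ≡ label v → Conn L u v
      complete : ∀ {u v} → Conn L u v → label u ≡ label v
      bound    : n ℕ.≤ count ℕ.+ length L
      exact    : count ℕ.+ length L ≡ n → Forest L
      forest   : Forest L → count ℕ.+ length L ≡ n

  module Merge {m : ℕ} {c d : Fin (suc m)} (c≢d : c ≢ d) where

    merge : Fin (suc m) → Fin m
    merge x with d Fin.≟ x
    ... | yes _   = punchOut (c≢d ∘ sym)
    ... | no d≢x = punchOut d≢x

    merge-d : merge d ≡ merge c
    merge-d with d Fin.≟ d | d Fin.≟ c
    ... | no d≢d | _       = contradiction refl d≢d
    ... | yes _  | yes d≡c = contradiction (sym d≡c) c≢d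
    ... | yes _  | no _    = Fin.punchOut-cong d refl

    merge-punchIn : ∀ x → merge (punchIn d x) ≡ x
    merge-punchIn x with d Fin.≟ punchIn d x
    ... | yes e = contradiction (sym e) (Fin.punchInᵢ≢i d x)
    ... | no  _ = trans (Fin.punchOut-cong d refl) (Fin.punchOut-punchIn d)

    merge-injective : ∀ {x y} → merge x ≡ merge y → x ≡ y ⊎ Joins c d x y
    merge-injective {x} {y} e with d Fin.≟ x | d Fin.≟ y
    ... | yes refl | yes refl = inj₁ refl
    ... | yes refl | no b     = inj₂ (inj₂ (refl , sym (Fin.punchOut-injective (c≢d ∘ sym) b e)))
    ... | no a     | yes refl = inj₂ (inj₁ (Fin.punchOut-injective a (c≢d ∘ sym) e , refl))
    ... | no a     | no b     = inj₁ (Fin.punchOut-injective a b e)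

  components : ∀ L → Components L
  components [] = record
    { count = n ; label = id ; onto = λ c → c , refl
    ; sound = λ { refl → ε } ; complete = λ { ε → refl }
    ; bound = ℕ.m≤m+n n 0 ; exact = λ _ → tt ; forest = λ _ → ℕ.+-identityʳ n }
  components (g ∷ L) with components L
  ... | record { count = zero ; label = f } with () ← f (src g)
  ... | record { count = suc m ; label = f ; onto = onto ; sound = sound ; complete = complete
               ; bound = bound ; exact = exact ; forest = forest } with f (src g) Fin.≟ f (tgt g)
  ...   | yes e = record
    { count = suc m ; label = f ; onto = onto ; sound = conn-there ∘ sound
    ; complete = conn-invariant f λ
        { (here (inj₁ (refl , refl))) → e
        ; (here (inj₂ (refl , refl))) → sym e
        ; (there l)                   → complete (l ◅ ε) }
    ; bound = ℕ.≤-trans bound (ℕ.+-monoʳ-≤ (suc m) (ℕ.n≤1+n _))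
    ; exact = λ e → contradiction (ℕ.≤-trans (ℕ.≤-reflexive e) bound)
        (ℕ.<⇒≱ (ℕ.+-monoʳ-< (suc m) (ℕ.n<1+n _)))
    ; forest = λ (¬c , _) → contradiction (sound e) ¬c }
  ...   | no ne = record
    { count = m ; label = merge ∘ f
    ; onto = λ x → let (u , e) = onto (punchIn (f (tgt g)) x) in
        u , trans (cong merge e) (merge-punchIn x)
    ; sound = λ {u} {v} e → sound′ u v (merge-injective e)
    ; complete = conn-invariant (merge ∘ f) λ
        { (here (inj₁ (refl , refl))) → sym merge-d
        ; (here (inj₂ (refl , refl))) → merge-d
        ; (there l)                   → cong merge (complete (l ◅ ε)) }
    ; bound = ℕ.≤-trans bound (ℕ.≤-reflexive (sym (ℕ.+-suc m _)))
    ; exact = λ e → ne ∘ complete , exact (trans (sym (ℕ.+-suc m _)) e)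
    ; forest = λ (_ , F) → trans (ℕ.+-suc m _) (forest F) }
    where
    open Merge ne
    sound′ : ∀ u v → f u ≡ f v ⊎ Joins (f (src g)) (f (tgt g)) (f u) (f v) → Conn (g ∷ L) u v
    sound′ u v (inj₁ e) = conn-there (sound e)
    sound′ u v (inj₂ (inj₁ (p , q))) =
      conn-there (sound p) ◅◅ conn-here g L (self-ends g) ◅◅ conn-there (sound (sym q))
    sound′ u v (inj₂ (inj₂ (p , q))) =
      conn-there (sound p) ◅◅ conn-here g L (joins-sym (self-ends g)) ◅◅ conn-there (sound (sym q))

  -- A walk can be shortened until it passes `g` at most once, in one of the two directions.
  conn-cons : ∀ (g : Generator n) L {i j} → Ends g i j → ∀ {u v} → Conn (g ∷ L) u v →
              Conn L u v ⊎ (Conn L u i × Conn L j v) ⊎ (Conn L u j × Conn L i v)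
  conn-cons g L e ε = inj₁ ε
  conn-cons g L e (there l ◅ p) with conn-cons g L e p
  ... | inj₁ a              = inj₁ (l ◅ a)
  ... | inj₂ (inj₁ (a , b)) = inj₂ (inj₁ (l ◅ a , b))
  ... | inj₂ (inj₂ (a , b)) = inj₂ (inj₂ (l ◅ a , b))
  conn-cons g L {i} {j} e {u} (here l ◅ p) with conn-cons g L e p | same-ends g e l
  ... | inj₁ a              | inj₁ (refl , refl) = inj₂ (inj₁ (ε , a))
  ... | inj₁ a              | inj₂ (refl , refl) = inj₂ (inj₂ (ε , a))
  ... | inj₂ (inj₁ (a , b)) | inj₁ (refl , refl) = inj₂ (inj₁ (ε , b))
  ... | inj₂ (inj₁ (a , b)) | inj₂ (refl , refl) = inj₁ b
  ... | inj₂ (inj₂ (a , b)) | inj₁ (refl , refl) = inj₁ b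
  ... | inj₂ (inj₂ (a , b)) | inj₂ (refl , refl) = inj₂ (inj₂ (ε , b))

  data Swapped (i j s : Fin n) : Fin n → Set where
    first  : s ≡ i → Swapped i j s j
    second : s ≡ j → Swapped i j s i
    fixed  : s ≢ i → s ≢ j → Swapped i j s s

  swapped : ∀ i j s → Swapped i j s (PC.transpose i j s)
  swapped i j s with s Fin.≟ i
  ... | yes e = first e
  ... | no ¬e with s Fin.≟ j
  ...   | yes e  = second e
  ...   | no ¬e′ = fixed ¬e ¬e′

  conn-σ : ∀ L u → Conn L u (σ⟨ L ⟩ ⟨$⟩ʳ u)
  conn-σ [] u = ε
  conn-σ (g ∷ L) u with σ⟨ L ⟩ ⟨$⟩ʳ u | conn-σ L u
  ... | s | p with PC.transpose (src g) (tgt g) s | swapped (src g) (tgt g) s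
  ...   | _ | first refl  = conn-there p ◅◅ conn-here g L (self-ends g)
  ...   | _ | second refl = conn-there p ◅◅ conn-here g L (joins-sym (self-ends g))
  ...   | _ | fixed _ _   = conn-there p

-- Ordered words and the cyclic order

-- The three cases say that `i`, `k`, `j` follow each other in the cyclic order: of two letters at
-- `i`, the earlier one ends farther upwards from `i`.
before : ∀ {k} → Fin k → Fin k → Fin k → Formula k
before i j k = (k ≺ j ∧ j ≺ i) ∨ (j ≺ i ∧ i ≺ k) ∨ (i ≺ k ∧ k ≺ j)

-- within i v j: v lies in the half-open arc [i , j).
within : ∀ {k} → Fin k → Fin k → Fin k → Formula k
within i v j = v ≐ i ∨ arc i v j

infix 8 _≭_

_≭_ : ∀ {k} → Fin k → Fin k → Formula k
i ≭ j = i ≐ j ⇒ falsum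

Within : ∀ {n} → Fin n → Fin n → Fin n → Set
Within i v j = v ≡ i ⊎ Arc i v j

module _ {n : ℕ} where

  -- For `e` to the left of `f`: the required order at a common vertex, and the absence of a
  -- crossing. Quantifying over all ends makes both conditions independent of the orientation of the
  -- letters.
  Compatible : Rel (Generator n) 0ℓ
  Compatible e f =
    (∀ {i j k} → Ends e i j → Ends f i k → Before i j k) ×
    (∀ {i j k l} → Ends e i j → Ends f k l → Arc i k j → ¬ Arc j l i)

  -- On every component of L the permutation σ⟨ L ⟩ moves each element to the
  -- cyclically next one.
  Successive : Monomial n → Set
  Successive L = ∀ {u v} → Conn L u v → ¬ Arc u v (σ⟨ L ⟩ ⟨$⟩ʳ u)

  -- The components are the blocks of a noncrossing partition. `Successive` looks at one component
  -- at a time and does not see crossings between two of them.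
  NoncrossingParts : Monomial n → Set
  NoncrossingParts L = ∀ {a b x y} → a ≢ b → Conn L a b → Conn L x y → Arc a x b → Arc b y a → Conn L a x

  swapped-cases : ∀ (P : Fin n → Set) (g : Generator n) s →
    (∀ {i j} → Ends g i j → s ≡ i → P j) → (s ≢ src g → s ≢ tgt g → P s) →
    P (PC.transpose (src g) (tgt g) s)
  swapped-cases P g s move stay with PC.transpose (src g) (tgt g) s | swapped (src g) (tgt g) s
  ... | _ | first e   = move (self-ends g) e
  ... | _ | second e  = move (joins-sym (self-ends g)) e
  ... | _ | fixed a b = stay a b

  ¬conn-ends : ∀ (g : Generator n) L → ¬ Conn L (src g) (tgt g) → ∀ {i j} → Ends g i j → ¬ Conn L i j
  ¬conn-ends g L ¬c (inj₁ (refl , refl)) = ¬c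
  ¬conn-ends g L ¬c (inj₂ (refl , refl)) = ¬c ∘ conn-sym L

  module Up (g : Generator n) (L : Monomial n)
            (¬c : ¬ Conn L (src g) (tgt g)) (comp : All (Compatible g) L) where

    -- A walk from `i` cannot leave `[i , j)`: a letter at `i` stays in the arc by the order at `i`,
    -- a letter elsewhere in the arc cannot cross `ij`, and `j` is not connected to `i` by `L`.
    part-within : ∀ {i j} → Ends g i j → ∀ {v} → Conn L i v → Within i v j
    part-within {i} {j} e c = go ε c (inj₁ refl)
      where
      step : ∀ {x y} → Conn L i x → Link L x y → Within i x j → Within i y j
      step {x} {y} ix l x∈ with find l
      ... | f , f∈L , e′ with All.lookup comp f∈L | x∈
      ...   | K , _ | inj₁ refl = by-order (i ∷ j ∷ y ∷ []) (before 0F 1F 2F ⇒ within 0F 2F 1F) (K e e′)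
      ...   | _ , nonx | inj₂ x∈ = by-order (i ∷ j ∷ x ∷ y ∷ [])
              (0F ≭ 1F ⇒ 3F ≭ 1F ⇒ arc 0F 2F 1F ⇒ (arc 1F 3F 0F ⇒ falsum) ⇒ within 0F 3F 1F)
              (ends-≢ g e) (λ { refl → ¬conn-ends g L ¬c e (ix ◅◅ l ◅ ε) }) x∈ (nonx e e′ x∈)
      go : ∀ {x v} → Conn L i x → Conn L x v → Within i x j → Within i v j
      go ix ε       x∈ = x∈
      go ix (l ◅ p) x∈ = go (ix ◅◅ l ◅ ε) p (step ix l x∈)

    -- The components of `i` and `j` in `L` lie in the complementary arcs `[i , j)` and `[j , i)`.
    -- The last vertex of the first is sent to `i` by `L`, hence to `j` by `g ∷ L`, and `j` is where
    -- the second one begins; likewise with `i` and `j` exchanged. All other images are unchanged.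
    successive-cons : Successive L → Successive (g ∷ L)
    successive-cons succ {u} {v} c = swapped-cases (λ s → ¬ Arc u v s) g _ move stay
      where
      us = conn-σ L u
      move : ∀ {i j} → Ends g i j → σ⟨ L ⟩ ⟨$⟩ʳ u ≡ i → ¬ Arc u v j
      move {i} {j} e refl with conn-cons g L e c
      ... | inj₁ uv = by-order (i ∷ j ∷ u ∷ v ∷ [])
              (0F ≭ 1F ⇒ within 0F 2F 1F ⇒ within 0F 3F 1F ⇒ (arc 2F 3F 0F ⇒ falsum) ⇒ arc 2F 3F 1F ⇒ falsum)
              (ends-≢ g e) (part-within e iu) (part-within e (iu ◅◅ uv)) (succ uv)
        where iu = conn-sym L us
      ... | inj₂ (inj₁ (ui , jv)) = by-order (i ∷ j ∷ u ∷ v ∷ [])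
              (0F ≭ 1F ⇒ within 0F 2F 1F ⇒ within 1F 3F 0F ⇒ arc 2F 3F 1F ⇒ falsum)
              (ends-≢ g e) (part-within e (conn-sym L ui)) (part-within (joins-sym e) jv)
      ... | inj₂ (inj₂ (uj , iv)) =
              contradiction (conn-sym L us ◅◅ uj) (¬conn-ends g L ¬c e)
      stay′ : ∀ {i j} → Ends g i j → σ⟨ L ⟩ ⟨$⟩ʳ u ≢ i → Conn L u i → Conn L j v →
              ¬ Arc u v (σ⟨ L ⟩ ⟨$⟩ʳ u)
      stay′ {i} {j} e s≢i ui jv = by-order (i ∷ j ∷ u ∷ v ∷ s ∷ [])
              (0F ≭ 1F ⇒ within 0F 2F 1F ⇒ within 0F 4F 1F ⇒ within 1F 3F 0F ⇒ 4F ≭ 0F ⇒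
               (arc 2F 0F 4F ⇒ falsum) ⇒ arc 2F 3F 4F ⇒ falsum)
              (ends-≢ g e) (part-within e iu) (part-within e (iu ◅◅ us)) (part-within (joins-sym e) jv)
              s≢i (succ ui)
        where
        s = σ⟨ L ⟩ ⟨$⟩ʳ u
        iu = conn-sym L ui
      stay : σ⟨ L ⟩ ⟨$⟩ʳ u ≢ src g → σ⟨ L ⟩ ⟨$⟩ʳ u ≢ tgt g → ¬ Arc u v (σ⟨ L ⟩ ⟨$⟩ʳ u)
      stay s≢i s≢j with conn-cons g L (self-ends g) c
      ... | inj₁ uv               = succ uv
      ... | inj₂ (inj₁ (ui , jv)) = stay′ (self-ends g) s≢i ui jv
      ... | inj₂ (inj₂ (uj , iv)) = stay′ (joins-sym (self-ends g)) s≢j uj iv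

  ordered⇒successive : ∀ {L} → AllPairs Compatible L → Forest L → Successive L
  ordered⇒successive {[]}    _           _        ε = by-order (_ ∷ []) (arc 0F 0F 0F ⇒ falsum)
  ordered⇒successive {g ∷ L} (comp ∷ ps) (¬c , F) =
    Up.successive-cons g L ¬c comp (ordered⇒successive ps F)

  module Down (g : Generator n) (L : Monomial n) (¬c : ¬ Conn L (src g) (tgt g))
              (succ : Successive (g ∷ L)) (nc : NoncrossingParts (g ∷ L)) where

    -- The number of upward steps from i to v, up to a shift depending on i only.
    distance : Fin n → Fin n → ℕ
    distance i v with v Fin.<? i
    ... | yes _ = n ℕ.+ toℕ v
    ... | no _  = toℕ v

    distance-< : ∀ {i u v} → Within i u v → v ≢ i → distance i u ℕ.< distance i v
    distance-< {i} {u} {v} w v≢i with u Fin.<? i | v Fin.<? i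
    ... | yes u<i | yes v<i = ℕ.+-monoʳ-< n (by-order (i ∷ u ∷ v ∷ [])
            (within 0F 1F 2F ⇒ 2F ≭ 0F ⇒ 1F ≺ 0F ⇒ 2F ≺ 0F ⇒ 1F ≺ 2F) w v≢i u<i v<i)
    ... | yes u<i | no v≮i  = ⊥-elim (by-order (i ∷ u ∷ v ∷ [])
            (within 0F 1F 2F ⇒ 2F ≭ 0F ⇒ 1F ≺ 0F ⇒ (2F ≺ 0F ⇒ falsum) ⇒ falsum) w v≢i u<i v≮i)
    ... | no _    | yes _   = ℕ.<-≤-trans (Fin.toℕ<n u) (ℕ.m≤m+n n (toℕ v))
    ... | no u≮i  | no v≮i  = by-order (i ∷ u ∷ v ∷ [])
            (within 0F 1F 2F ⇒ 2F ≭ 0F ⇒ (1F ≺ 0F ⇒ falsum) ⇒ (2F ≺ 0F ⇒ falsum) ⇒ 1F ≺ 2F) w v≢i u≮i v≮i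

    -- The predecessor `u` of `v` under `σ⟨ g ∷ L ⟩` lies in `[i , v)` by succession. As `v` is
    -- neither `i` nor `j`, the transposition of `g`, which acts last, does not move it, so `σ⟨ L ⟩`
    -- already takes `u` to `v`. Going back in this way decreases the distance until `i` is reached.
    reach : ∀ {i j} → Ends g i j → ∀ v → Acc ℕ._<_ (distance i v) →
            Conn (g ∷ L) i v → Within i v j → Conn L i v
    reach {i} {j} e v (acc rec) c (inj₁ refl) = ε
    reach {i} {j} e v (acc rec) c (inj₂ v∈) =
      reach e u (rec (distance-< u∈ v≢i)) (conn-sym (g ∷ L) ui) (by-order (i ∷ j ∷ u ∷ v ∷ [])
        (within 0F 2F 3F ⇒ arc 0F 3F 1F ⇒ 0F ≭ 1F ⇒ within 0F 2F 1F) u∈ v∈ i≢j)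
      ◅◅ subst (Conn L u) σu≡v (conn-σ L u)
      where
      i≢j = ends-≢ g e
      v≢i : v ≢ i
      v≢i = by-order (i ∷ j ∷ v ∷ []) (0F ≭ 1F ⇒ arc 0F 2F 1F ⇒ 2F ≭ 0F) i≢j v∈
      v≢j : v ≢ j
      v≢j = by-order (i ∷ j ∷ v ∷ []) (0F ≭ 1F ⇒ arc 0F 2F 1F ⇒ 2F ≭ 1F) i≢j v∈
      u = σ⟨ g ∷ L ⟩ ⟨$⟩ˡ v
      σgu≡v : σ⟨ g ∷ L ⟩ ⟨$⟩ʳ u ≡ v
      σgu≡v = Perm.inverseʳ σ⟨ g ∷ L ⟩
      ui : Conn (g ∷ L) u i
      ui = subst (Conn (g ∷ L) u) σgu≡v (conn-σ (g ∷ L) u) ◅◅ conn-sym (g ∷ L) c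
      u∈ : Within i u v
      u∈ = by-order (i ∷ u ∷ v ∷ []) ((arc 1F 0F 2F ⇒ falsum) ⇒ 2F ≭ 0F ⇒ within 0F 1F 2F)
             (subst (λ w → ¬ Arc u i w) σgu≡v (succ ui)) v≢i
      other : ∀ {k l} → Ends g k l → v ≢ l
      other e′ refl = [ v≢j ∘ proj₂ , v≢i ∘ proj₂ ]′ (same-ends g e e′)
      σu≡v : σ⟨ L ⟩ ⟨$⟩ʳ u ≡ v
      σu≡v = swapped-cases (λ w → w ≡ v → σ⟨ L ⟩ ⟨$⟩ʳ u ≡ v) g _
               (λ e′ _ l≡v → contradiction (sym l≡v) (other e′)) (λ _ _ → id) σgu≡v

    -- If `v` were in the other arc, `reach` would connect it to `j`, and then `L` would connect `i`
    -- with `j`.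
    part-within : ∀ {i j} → Ends g i j → ∀ {v} → Conn L i v → Within i v j
    part-within {i} {j} e {v} iv
      with by-order (i ∷ j ∷ v ∷ []) (0F ≭ 1F ⇒ within 0F 2F 1F ∨ within 1F 2F 0F) (ends-≢ g e)
    ... | inj₁ v∈ = v∈
    ... | inj₂ v∈ = contradiction
      (iv ◅◅ conn-sym L (reach (joins-sym e) v (<-wellFounded _)
                           (conn-here g L (joins-sym e) ◅◅ conn-there iv) v∈))
      (¬conn-ends g L ¬c e)

    successive-tail : Successive L
    successive-tail {u} {v} uv =
      swapped-cases (λ w → ¬ Arc u v w → ¬ Arc u v (σ⟨ L ⟩ ⟨$⟩ʳ u)) g _ move (λ _ _ → id) (succ (conn-there uv))
      where
      move : ∀ {i j} → Ends g i j → σ⟨ L ⟩ ⟨$⟩ʳ u ≡ i → ¬ Arc u v j → ¬ Arc u v (σ⟨ L ⟩ ⟨$⟩ʳ u)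
      move {i} {j} e refl ¬a = by-order (i ∷ j ∷ u ∷ v ∷ [])
        (0F ≭ 1F ⇒ within 0F 2F 1F ⇒ within 0F 3F 1F ⇒ (arc 2F 3F 1F ⇒ falsum) ⇒ arc 2F 3F 0F ⇒ falsum)
        (ends-≢ g e) (part-within e iu) (part-within e (iu ◅◅ uv)) ¬a
        where iu = conn-sym L (conn-σ L u)

    separated : ∀ {i j a b x y} → Ends g i j → a ≢ b → Conn L a i → Conn L j x →
                Conn L a b → Conn L x y → Arc a x b → ¬ Arc b y a
    separated {i} {j} {a} {b} {x} {y} e a≢b ai jx ab xy = by-order (i ∷ j ∷ a ∷ b ∷ x ∷ y ∷ [])
      (within 0F 2F 1F ⇒ within 0F 3F 1F ⇒ within 1F 4F 0F ⇒ within 1F 5F 0F ⇒ 0F ≭ 1F ⇒ 2F ≭ 3F ⇒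
       arc 2F 4F 3F ⇒ arc 3F 5F 2F ⇒ falsum)
      (part-within e (conn-sym L ai)) (part-within e (conn-sym L ai ◅◅ ab))
      (part-within (joins-sym e) jx) (part-within (joins-sym e) (jx ◅◅ xy)) (ends-≢ g e) a≢b

    noncrossing-tail : NoncrossingParts L
    noncrossing-tail a≢b ab xy axb bya
      with conn-cons g L (self-ends g) (nc a≢b (conn-there ab) (conn-there xy) axb bya)
    ... | inj₁ ax               = ax
    ... | inj₂ (inj₁ (ai , jx)) =
      contradiction bya (separated (self-ends g) a≢b ai jx ab xy axb)
    ... | inj₂ (inj₂ (aj , ix)) =
      contradiction bya (separated (joins-sym (self-ends g)) a≢b aj ix ab xy axb)

    compatible : ∀ {f} → f ∈ L → Compatible g f
    compatible {f} f∈L = order , cross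
      where
      order : ∀ {i j k} → Ends g i j → Ends f i k → Before i j k
      order {i} {j} {k} e e′ = by-order (i ∷ j ∷ k ∷ [])
        (0F ≭ 1F ⇒ 0F ≭ 2F ⇒ within 0F 2F 1F ⇒ before 0F 1F 2F)
        (ends-≢ g e) (ends-≢ f e′) (part-within e (lose f∈L e′ ◅ ε))
      cross : ∀ {i j k l} → Ends g i j → Ends f k l → Arc i k j → ¬ Arc j l i
      cross {i} {j} {k} {l} e e′ ikj jli = by-order (i ∷ j ∷ l ∷ [])
        (0F ≭ 1F ⇒ arc 1F 2F 0F ⇒ within 0F 2F 1F ⇒ falsum) (ends-≢ g e) jli
        (part-within e (ik ◅◅ lose f∈L e′ ◅ ε))
        where
        -- By `nc` the crossing puts `k` into the component of `i`; `reach` makes the connection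
        -- avoid `g`.
        ik : Conn L i k
        ik = reach e k (<-wellFounded _)
          (nc (ends-≢ g e) (conn-here g L e) (conn-there (lose f∈L e′ ◅ ε)) ikj jli) (inj₂ ikj)

  successive⇒ordered : ∀ {L} → Forest L → Successive L → NoncrossingParts L → AllPairs Compatible L
  successive⇒ordered {[]}    _        _ _ = []
  successive⇒ordered {g ∷ L} (¬c , F) s x =
    All.tabulate compatible ∷ successive⇒ordered F successive-tail noncrossing-tail
    where open Down g L ¬c s x

-- Paths and cycles

module _ {n : ℕ} where

  record SimplePath (R : Rel (Fin n) 0ℓ) (u v : Fin n) : Set where
    field
      size      : ℕ
      vertex    : Fin (suc size) → Fin n
      injective : ∀ {p q} → vertex p ≡ vertex q → p ≡ q
      start     : vertex zero ≡ u
      end       : vertex (fromℕ size) ≡ v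
      steps     : ∀ j → R (vertex (inject₁ j)) (vertex (suc j))

  simple-suffix : ∀ {R u v} (P : SimplePath R u v) p → SimplePath R (SimplePath.vertex P p) v
  simple-suffix P zero = record
    { size = size ; vertex = vertex ; injective = injective
    ; start = refl ; end = end ; steps = steps }
    where open SimplePath P
  simple-suffix {R} {u} {v} record { size = suc m ; vertex = f ; injective = inj ; end = end ; steps = steps } (suc p) =
    simple-suffix {R} {f (suc zero)} record
      { size = m ; vertex = f ∘ suc ; injective = Fin.suc-injective ∘ inj
      ; start = refl ; end = end ; steps = steps ∘ suc } p

  simple-path : ∀ {R u v} → Star R u v → SimplePath R u v
  simple-path {u = u} ε = record
    { size = 0 ; vertex = λ _ → u ; injective = λ { {zero} {zero} _ → refl }
    ; start = refl ; end = refl ; steps = λ () }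
  simple-path {R} {u} {v} (r ◅ p) with simple-path p
  ... | P with Fin.any? (λ q → SimplePath.vertex P q Fin.≟ u)
  ...   | yes (q , refl) = simple-suffix P q
  ...   | no u∉P         = record
    { size      = suc size
    ; vertex    = f
    ; injective = λ {p} {q} → f-injective p q
    ; start     = refl
    ; end       = end
    ; steps     = λ { zero → subst (R u) (sym start) r ; (suc j) → steps j } }
    where
    open SimplePath P
    f : Fin (2 ℕ.+ size) → Fin n
    f zero    = u
    f (suc p) = vertex p
    f-injective : ∀ p q → f p ≡ f q → p ≡ q
    f-injective zero    zero    _ = refl
    f-injective zero    (suc q) e = contradiction (q , sym e) u∉P
    f-injective (suc p) zero    e = contradiction (p , e) u∉P
    f-injective (suc p) (suc q) e = cong suc (injective e)

  -- The simple path extracted from the detour and the edge `ab` form a cycle. Lengths 0 and 1 are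
  -- excluded by `a ≢ b` and by the avoidance of `ab`.
  no-detour : ∀ {R : Rel (Fin n) 0ℓ} → Symmetric R → Acyclic R → ∀ {a b} → a ≢ b → R a b →
              ¬ Star (λ u v → R u v × ¬ Joins a b u v) a b
  no-detour {R} R-sym acyclic {a} {b} a≢b ab p with simple-path p
  ... | record { size = 0 ; start = refl ; end = refl } = a≢b refl
  ... | record { size = 1 ; start = refl ; end = refl ; steps = steps } =
    proj₂ (steps zero) (inj₁ (refl , refl))
  ... | record { size = suc (suc k) ; vertex = f ; injective = inj ; start = refl ; end = refl ; steps = steps } =
    acyclic f (inj , λ
      { (inj₁ (inj₁ (refl , refl)))     → ab
      ; (inj₁ (inj₂ (refl , refl)))     → R-sym ab
      ; (inj₂ (j , inj₁ (refl , refl))) → proj₁ (steps j)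
      ; (inj₂ (j , inj₂ (refl , refl))) → R-sym (proj₁ (steps j)) })

  chain : ∀ {S : Rel (Fin n) 0ℓ} {m} (f : Fin (suc m) → Fin n) →
          (∀ j → S (f (inject₁ j)) (f (suc j))) → Star S (f zero) (f (fromℕ m))
  chain {m = zero}  f s = ε
  chain {m = suc m} f s = s zero ◅ chain (f ∘ suc) (s ∘ suc)

  chain-split : ∀ {S : Rel (Fin n) 0ℓ} {m} (f : Fin (suc m) → Fin n) (j : Fin m) →
                (∀ l → l ≢ j → S (f (inject₁ l)) (f (suc l))) →
                Star S (f zero) (f (inject₁ j)) × Star S (f (suc j)) (f (fromℕ m))
  chain-split f zero    s = ε , chain (f ∘ suc) (λ l → s (suc l) (λ ()))
  chain-split f (suc j) s =
    let (p , q) = chain-split (f ∘ suc) j (λ l l≢j → s (suc l) (l≢j ∘ Fin.suc-injective))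
    in s zero (λ ()) ◅ p , q

  module _ {k : ℕ} (i : Fin (3 ℕ.+ k) → Fin n) (inj : ∀ {p q} → i p ≡ i q → p ≡ q) where

    private
      index : ∀ {p q r s} → Joins (i p) (i q) (i r) (i s) → Joins p q r s
      index (inj₁ (e , f)) = inj₁ (inj e , inj f)
      index (inj₂ (e , f)) = inj₂ (inj e , inj f)

    chord≢side : ∀ j → ¬ Chord i (i (inject₁ j)) (i (suc j))
    chord≢side j e with index {zero} {fromℕ _} {inject₁ j} {suc j} e
    chord≢side zero e | inj₁ (_ , ())
    chord≢side j    e | inj₂ (_ , ())

    side≢chord : ∀ j → ¬ Side i j (i zero) (i (fromℕ (2 ℕ.+ k)))
    side≢chord j (inj₁ (p , q)) = chord≢side j (inj₁ (sym p , sym q))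
    side≢chord j (inj₂ (p , q)) = chord≢side j (inj₂ (sym q , sym p))

    side-injective : ∀ j l → Side i j (i (inject₁ l)) (i (suc l)) → l ≡ j
    side-injective j l e with index {inject₁ j} {suc j} {inject₁ l} {suc l} e
    ... | inj₁ (p , _) = Fin.inject₁-injective p
    ... | inj₂ (p , q) = contradiction
      (ℕ.<-trans {toℕ j} {toℕ l} (ℕ.≤-reflexive (trans (cong toℕ (sym p)) (Fin.toℕ-inject₁ l)))
                 (ℕ.≤-reflexive (trans (cong toℕ q) (Fin.toℕ-inject₁ j))))
      (ℕ.<-irrefl refl)

    onCycle-sym : ∀ {u v} → OnCycle i u v → OnCycle i v u
    onCycle-sym (inj₁ e)       = inj₁ (joins-sym e)
    onCycle-sym (inj₂ (j , e)) = inj₂ (j , joins-sym e)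

    Rest : Fin n → Fin n → Rel (Fin n) 0ℓ
    Rest a b u v = OnCycle i u v × ¬ Joins a b u v

    rest-sym : ∀ {a b} → Symmetric (Rest a b)
    rest-sym (o , ¬e) = onCycle-sym o , ¬e ∘ joins-sym

    private
      side : ∀ j → OnCycle i (i (inject₁ j)) (i (suc j))
      side j = inj₂ (j , inj₁ (refl , refl))

    around-chord : Star (Rest (i zero) (i (fromℕ _))) (i zero) (i (fromℕ (2 ℕ.+ k)))
    around-chord = chain i λ j → side j , chord≢side j

    around-side : ∀ j → Star (Rest (i (inject₁ j)) (i (suc j))) (i (inject₁ j)) (i (suc j))
    around-side j =
      let (p , q) = chain-split i j λ l l≢j → side l , l≢j ∘ side-injective j l in
      Star.reverse rest-sym p ◅◅ (inj₁ (inj₁ (refl , refl)) , side≢chord j) ◅ Star.reverse rest-sym q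

    around : ∀ {a b} → OnCycle i a b → Star (Rest a b) a b
    around (inj₁ (inj₁ (refl , refl)))     = around-chord
    around (inj₁ (inj₂ (refl , refl)))     =
      Star.map (λ (o , ¬e) → o , ¬e ∘ swap) (Star.reverse rest-sym around-chord)
    around (inj₂ (j , inj₁ (refl , refl))) = around-side j
    around (inj₂ (j , inj₂ (refl , refl))) =
      Star.map (λ (o , ¬e) → o , ¬e ∘ swap) (Star.reverse rest-sym (around-side j))

-- Factorizations of the long cycle

longCycle-fromℕ : ∀ m → longCycle (suc m) ⟨$⟩ʳ fromℕ m ≡ zero
longCycle-fromℕ m with fromℕ m Fin.≟ fromℕ m
... | yes _ = refl
... | no ¬e = contradiction refl ¬e

punchIn-fromℕ : ∀ {m} (i : Fin m) → punchIn (fromℕ m) i ≡ inject₁ i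
punchIn-fromℕ zero    = refl
punchIn-fromℕ (suc i) = cong suc (punchIn-fromℕ i)

longCycle-inject₁ : ∀ {m} (i : Fin m) → longCycle (suc m) ⟨$⟩ʳ inject₁ i ≡ suc i
longCycle-inject₁ {m} i = trans (cong (longCycle (suc m) ⟨$⟩ʳ_) (sym (punchIn-fromℕ i)))
  (Perm.insert-punchIn (fromℕ m) zero Perm.id i)

longCycle-next : ∀ {n} (u v : Fin n) → ¬ Arc u v (longCycle n ⟨$⟩ʳ u)
longCycle-next {suc m} u v a with view u
... | ‵fromℕ rewrite longCycle-fromℕ m with a
...   | inj₁ (u<v , _)      = ℕ.<⇒≱ u<v (Fin.≤fromℕ v)
...   | inj₂ (_ , inj₁ u<v) = ℕ.<⇒≱ u<v (Fin.≤fromℕ v)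
...   | inj₂ (_ , inj₂ ())
longCycle-next {suc m} u v a | ‵inject₁ i rewrite longCycle-inject₁ i with a
...   | inj₁ (u<v , s≤s v≤i)   = ℕ.<⇒≱ u<v (ℕ.≤-trans v≤i (ℕ.≤-reflexive (sym (Fin.toℕ-inject₁ i))))
...   | inj₂ (inj₁ i<i , _)    = ℕ.<⇒≱ i<i (ℕ.≤-trans (ℕ.≤-reflexive (Fin.toℕ-inject₁ i)) (ℕ.n≤1+n _))
...   | inj₂ (inj₂ si≡i , _)   = ℕ.1+n≢n (trans (cong toℕ si≡i) (Fin.toℕ-inject₁ i))

module _ {n : ℕ} where

  -- If two candidates for the successor of `u` differed, one of them would lie in the arc leading
  -- to the other.
  longCycle-unique : ∀ (u s : Fin n) → (∀ v → ¬ Arc u v s) → s ≡ longCycle n ⟨$⟩ʳ u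
  longCycle-unique u s ¬a = by-order (u ∷ s ∷ c ∷ [])
    ((arc 0F 1F 2F ⇒ falsum) ⇒ (arc 0F 2F 1F ⇒ falsum) ⇒ 1F ≐ 2F) (longCycle-next u s) (¬a c)
    where c = longCycle n ⟨$⟩ʳ u

  orbit-connected : ∀ (π : Permutation′ n) → π Perm.≈ longCycle n → ∀ u v → Star (λ u v → π ⟨$⟩ʳ u ≡ v) u v
  orbit-connected π π≈c u v = Star.map (trans (π≈c _)) (connect u v)
    where
    connect : ∀ {n} (u v : Fin n) → Star (λ u v → longCycle n ⟨$⟩ʳ u ≡ v) u v
    connect {suc m} u v =
      >-weakInduction (λ u → Star _ u zero) (longCycle-fromℕ m ◅ ε) (λ i p → longCycle-inject₁ i ◅ p) u
      ◅◅ <-weakInduction (λ v → Star _ zero v) ε (λ i p → p ◅◅ longCycle-inject₁ i ◅ ε) v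

  constant-surjection : ∀ {m} (f : Fin n → Fin m) → (∀ c → ∃[ u ] f u ≡ c) → (∀ u v → f u ≡ f v) → m ≡ n ℕ.⊓ 1
  constant-surjection = go
    where
    go : ∀ {n m} (f : Fin n → Fin m) → (∀ c → ∃[ u ] f u ≡ c) → (∀ u v → f u ≡ f v) → m ≡ n ℕ.⊓ 1
    go {zero}  {zero}        f onto same = refl
    go {zero}  {suc m}       f onto same with () ← proj₁ (onto zero)
    go {suc n} {zero}        f onto same with () ← f zero
    go {suc n} {suc zero}    f onto same = cong suc (sym (ℕ.⊓-zeroʳ n))
    go {suc n} {suc (suc m)} f onto same
      with onto zero | onto (suc zero)
    ... | u , p | v , q with () ← trans (sym p) (trans (same u v) q)

  -- n ⊓ 1 instead of 1, because the graph without vertices has no components.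
  record TreeWord (W : Monomial n) : Set where
    field
      connected : ∀ u v → Conn W u v
      size      : n ℕ.⊓ 1 ℕ.+ length W ≡ n

  connected-count : ∀ W → (∀ u v → Conn W u v) → Components.count (components W) ≡ n ℕ.⊓ 1
  connected-count W conn = constant-surjection label onto λ u v → complete (conn u v)
    where open Components (components W)

  connected-length : ∀ W → (∀ u v → Conn W u v) → n ℕ.≤ n ℕ.⊓ 1 ℕ.+ length W
  connected-length W conn =
    subst (λ m → n ℕ.≤ m ℕ.+ length W) (connected-count W conn) (Components.bound (components W))

  forest⇒treeWord : ∀ {W} → (∀ u v → Conn W u v) → Forest W → TreeWord W
  forest⇒treeWord {W} conn F = record
    { connected = conn
    ; size = trans (cong (ℕ._+ length W) (sym (connected-count W conn))) (Components.forest (components W) F) }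

  treeWord⇒forest : ∀ {W} → TreeWord W → Forest W
  treeWord⇒forest {W} t = Components.exact (components W)
    (trans (cong (ℕ._+ length W) (connected-count W connected)) size)
    where open TreeWord t

  record Factorization (W : Monomial n) : Set where
    field
      treeWord : TreeWord W
      cycle    : σ⟨ W ⟩ Perm.≈ longCycle n
    open TreeWord treeWord public

  -- With a single component, succession is the defining property of the long cycle, and no two
  -- components can cross.
  factorization⇒ordered : ∀ {W} → Factorization W → AllPairs Compatible W
  factorization⇒ordered {W} f = successive⇒ordered (treeWord⇒forest treeWord)
    (λ {u} {v} _ → subst (λ s → ¬ Arc u v s) (sym (cycle u)) (longCycle-next u v))
    (λ _ _ _ _ _ → connected _ _)
    where open Factorization f

  ordered⇒factorization : ∀ {W} → TreeWord W → AllPairs Compatible W → Factorization W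
  ordered⇒factorization {W} t o = record
    { treeWord = t
    ; cycle = λ u → longCycle-unique u _ λ v →
        ordered⇒successive o (treeWord⇒forest t) (TreeWord.connected t u v) }

  factorization⇒simple : ∀ {W} → Factorization W → IsSimple W
  factorization⇒simple {W} f = count , (label ,
      (λ c → let (u , e) = onto c in u , λ { refl → e }) ,
      λ u v → mk⇔ (λ _ → orbit-connected σ⟨ W ⟩ cycle u v) (λ _ → complete (connected u v))) ,
      trans (cong (ℕ._+ length W) (connected-count W connected)) size
    where
    open Factorization f
    open Components (components W)

  -- The long cycle has a single orbit, so the number of cycles in `IsSimple` is `n ⊓ 1`, which
  -- gives the length. Orbits of `σ⟨ W ⟩` stay within the components of `W`, so `W` is connected.
  simple⇒factorization : ∀ {W} → IsSimple W → σ⟨ W ⟩ Perm.≈ longCycle n → Factorization W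
  simple⇒factorization {W} (m , (f , onto , fibres) , m+len≡n) σ≈c = record
    { treeWord = record
      { connected = λ u v → Star.concat (Star.map (λ { refl → conn-σ W _ }) (orbit u v))
      ; size = trans (cong (ℕ._+ length W) (sym m≡)) m+len≡n }
    ; cycle = σ≈c }
    where
    orbit = orbit-connected σ⟨ W ⟩ σ≈c
    m≡ : m ≡ n ℕ.⊓ 1
    m≡ = constant-surjection f (λ c → let (u , e) = onto c in u , e refl)
           λ u v → Equivalence.from (fibres u v) (orbit u v)

-- Trees and their words

module _ {A : Set} {R : Rel A 0ℓ} where

  allPairs-lookup : ∀ {xs} → AllPairs R xs → ∀ {x y} → x ∈ xs → y ∈ xs → x ≡ y ⊎ R x y ⊎ R y x
  allPairs-lookup (rs ∷ ps) (here refl) (here refl) = inj₁ refl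
  allPairs-lookup (rs ∷ ps) (here refl) (there y∈)  = inj₂ (inj₁ (All.lookup rs y∈))
  allPairs-lookup (rs ∷ ps) (there x∈)  (here refl) = inj₂ (inj₂ (All.lookup rs x∈))
  allPairs-lookup (rs ∷ ps) (there x∈)  (there y∈)  = allPairs-lookup ps x∈ y∈

  allPairs-refine : ∀ {S : Rel A 0ℓ} {xs} → (∀ {x y} → x ∈ xs → y ∈ xs → R x y → S x y) →
                    AllPairs R xs → AllPairs S xs
  allPairs-refine f []        = []
  allPairs-refine f (rs ∷ ps) =
    All.tabulate (λ y∈ → f (here refl) (there y∈) (All.lookup rs y∈)) ∷
    allPairs-refine (λ x∈ y∈ → f (there x∈) (there y∈)) ps

  allPairs-remove : ∀ xs {y ys} → AllPairs R (xs ++ y ∷ ys) →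
                    AllPairs R (xs ++ ys) × All (λ x → R x y) xs × All (R y) ys
  allPairs-remove []       (r ∷ rs) = rs , [] , r
  allPairs-remove (x ∷ xs) (r ∷ rs) with allPairs-remove xs rs
  ... | rs′ , as , bs =
    All.++⁺ (All.++⁻ˡ xs r) (All.tail (All.++⁻ʳ xs r)) ∷ rs′ , All.head (All.++⁻ʳ xs r) ∷ as , bs

module _ {n : ℕ} where

  Positive : Generator n → Set
  Positive g = src g Fin.< tgt g

  positive-≡ : ∀ {g h : Generator n} → Positive g → Positive h → Ends g (src h) (tgt h) → g ≡ h
  positive-≡ p q (inj₁ (refl , refl)) = refl
  positive-≡ p q (inj₂ (refl , refl)) = contradiction p (ℕ.<⇒≯ q)

  Spells : Monomial n → Graph n → Set
  Spells W T = ∀ {u v} → Adj T u v ⇔ Link W u v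

  link? : ∀ W (u v : Fin n) → Dec (Link W u v)
  link? W u v = Any.any? (λ g → joins? (src g) (tgt g) u v) W

  link-irrefl : ∀ W {u : Fin n} → ¬ Link W u u
  link-irrefl W l = let (g , _ , e) = find l in ends-≢ g e refl

  link-graph : Monomial n → Graph n
  link-graph W = record
    { adj    = λ u v → isYes (link? W u v)
    ; symm   = λ {u} {v} a → fromWitness {a? = link? W v u} (link-sym W (toWitness {a? = link? W u v} a))
    ; irrefl = λ {u} a → link-irrefl W (toWitness {a? = link? W u u} a) }

  spells-link-graph : ∀ W → Spells W (link-graph W)
  spells-link-graph W {u} {v} = mk⇔ (toWitness {a? = link? W u v}) (fromWitness {a? = link? W u v})

  link-remove : ∀ P {Q} {g : Generator n} {u v} → Link (P ++ g ∷ Q) u v → ¬ Ends g u v → Link (P ++ Q) u v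
  link-remove P l ¬e with Any.++⁻ P l
  ... | inj₁ l₁         = Any.++⁺ˡ l₁
  ... | inj₂ (here e)   = contradiction e ¬e
  ... | inj₂ (there l₂) = Any.++⁺ʳ P l₂

  -- Deleting a letter on a cycle would leave a connected word that is shorter than
  -- `connected-length` allows.
  treeWord⇒acyclic : ∀ {W} → TreeWord W → Acyclic (Link W)
  treeWord⇒acyclic {W} t i (inj , on) with find (on {i zero} {i (suc zero)} (inj₂ (zero , inj₁ (refl , refl))))
  ... | g , g∈W , e with ∈.∈-∃++ g∈W
  ...   | W₁ , W₂ , refl = ℕ.<⇒≱ shorter (connected-length (W₁ ++ W₂) conn)
    where
    open TreeWord t
    shorter : n ℕ.⊓ 1 ℕ.+ length (W₁ ++ W₂) ℕ.< n
    shorter = begin-strict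
      n ℕ.⊓ 1 ℕ.+ length (W₁ ++ W₂)           <⟨ ℕ.+-monoʳ-< (n ℕ.⊓ 1) (ℕ.n<1+n _) ⟩
      n ℕ.⊓ 1 ℕ.+ length (g ∷ W₁ ++ W₂)       ≡⟨ cong (n ℕ.⊓ 1 ℕ.+_) length-insert ⟩
      n ℕ.⊓ 1 ℕ.+ length (W₁ ++ g ∷ W₂)       ≡⟨ size ⟩
      n                                       ∎
      where
      open ℕ.≤-Reasoning
      length-insert : length (g ∷ W₁ ++ W₂) ≡ length (W₁ ++ g ∷ W₂)
      length-insert = trans (cong suc (length-++ W₁)) (trans (sym (ℕ.+-suc _ _)) (sym (length-++ W₁)))
    detour : Conn (W₁ ++ W₂) (i zero) (i (suc zero))
    detour = Star.map (λ (o , ¬e) → link-remove W₁ (on o) (¬e ∘ same-ends g e)) (around i inj (inj₂ (zero , inj₁ (refl , refl))))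
    step : ∀ {u v} → Link (W₁ ++ g ∷ W₂) u v → Conn (W₁ ++ W₂) u v
    step {u} {v} l with joins? (src g) (tgt g) u v
    ... | no ¬e = link-remove W₁ l ¬e ◅ ε
    ... | yes e′ with same-ends g e e′
    ...   | inj₁ (refl , refl) = detour
    ...   | inj₂ (refl , refl) = conn-sym (W₁ ++ W₂) detour
    conn : ∀ u v → Conn (W₁ ++ W₂) u v
    conn u v = Star.concat (Star.map step (connected u v))

  compatible⇒noncrossing : ∀ {W : Monomial n} → AllPairs Compatible W → Noncrossing (Link W)
  compatible⇒noncrossing {W} o {a} {b} {c} {d} a<b b<c c<d ac bd with find ac | find bd
  ... | g , g∈W , e | h , h∈W , e′ with allPairs-lookup o g∈W h∈W
  ...   | inj₂ (inj₁ K) = proj₂ K e e′ (inj₁ (a<b , b<c)) (by-order (a ∷ b ∷ c ∷ d ∷ [])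
            (0F ≺ 1F ⇒ 1F ≺ 2F ⇒ 2F ≺ 3F ⇒ arc 2F 3F 0F) a<b b<c c<d)
  ...   | inj₂ (inj₂ K) = proj₂ K e′ (joins-sym e) (inj₁ (b<c , c<d)) (by-order (a ∷ b ∷ c ∷ d ∷ [])
            (0F ≺ 1F ⇒ 1F ≺ 2F ⇒ 2F ≺ 3F ⇒ arc 3F 0F 1F) a<b b<c c<d)
  ...   | inj₁ refl with same-ends g e e′
  ...     | inj₁ (refl , _) = ℕ.<-irrefl refl a<b
  ...     | inj₂ (refl , _) = ℕ.<-irrefl refl b<c

  -- The alternating ends `i`, `k`, `j`, `l`, read from the smallest one on, form one of four
  -- increasing sequences, each excluded by the linear condition.
  noncrossing⇒uncrossed : ∀ {R : Rel (Fin n) 0ℓ} → Symmetric R → Noncrossing R →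
    ∀ {i j k l} → i ≢ j → R i j → R k l → Arc i k j → ¬ Arc j l i
  noncrossing⇒uncrossed R-sym nx {i} {j} {k} {l} i≢j ij kl ikj jli
    with by-order (i ∷ j ∷ k ∷ l ∷ [])
      (0F ≭ 1F ⇒ arc 0F 2F 1F ⇒ arc 1F 3F 0F ⇒
       (0F ≺ 2F ∧ 2F ≺ 1F ∧ 1F ≺ 3F) ∨ (2F ≺ 1F ∧ 1F ≺ 3F ∧ 3F ≺ 0F) ∨
       (1F ≺ 3F ∧ 3F ≺ 0F ∧ 0F ≺ 2F) ∨ (3F ≺ 0F ∧ 0F ≺ 2F ∧ 2F ≺ 1F))
      i≢j ikj jli
  ... | inj₁ (p , q , r)               = nx p q r ij kl
  ... | inj₂ (inj₁ (p , q , r))        = nx p q r kl (R-sym ij)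
  ... | inj₂ (inj₂ (inj₁ (p , q , r))) = nx p q r (R-sym ij) (R-sym kl)
  ... | inj₂ (inj₂ (inj₂ (p , q , r))) = nx p q r (R-sym kl) ij

  distinct-pairs : ∀ {W : Monomial n} → AllPairs Compatible W → Unique W
  distinct-pairs = AllPairs.map λ { {g} (K , _) refl → by-order (src g ∷ tgt g ∷ [])
    (before 0F 1F 1F ⇒ falsum) (K (self-ends g) (self-ends g)) }

  link-graph-tree : ∀ {W} → Factorization W → NoncrossingTree n
  link-graph-tree {W} f = record
    { graph       = link-graph W
    ; connected   = λ u v → Star.map (Equivalence.from (spells-link-graph W)) (connected u v)
    ; acyclic     = λ i (inj , on) → treeWord⇒acyclic treeWord i (inj , Equivalence.to (spells-link-graph W) ∘ on)
    ; noncrossing = λ {a} {b} {c} {d} a<b b<c c<d ac bd →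
                      compatible⇒noncrossing (factorization⇒ordered f) {a} {b} {c} {d} a<b b<c c<d
                      (Equivalence.to (spells-link-graph W) ac) (Equivalence.to (spells-link-graph W) bd) }
    where open Factorization f

  module _ (T : NoncrossingTree n) where
    open NoncrossingTree T

    edgeOrder : ∀ {W} → All Positive W → AllPairs Compatible W → Spells W graph → EdgeOrder T
    edgeOrder {W} pos o spells = record
      { word    = W
      ; edges   = λ g → mk⇔ (λ g∈W → All.lookup pos g∈W , Equivalence.from spells (lose g∈W (self-ends g)))
                            (λ (p , a) → member g p (find (Equivalence.to spells a)))
      ; once    = distinct-pairs o
      ; ordered = AllPairs.map proj₁ o }
      where
      member : ∀ g → Positive g → (∃[ h ] h ∈ W × Ends h (src g) (tgt g)) → g ∈ W
      member g p (h , h∈W , e) = subst (_∈ W) (positive-≡ (All.lookup pos h∈W) p e) h∈W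

    module _ (o : EdgeOrder T) where
      open EdgeOrder o using (word; edges; once; ordered)

      word-positive : All Positive word
      word-positive = All.tabulate λ {g} g∈ → proj₁ (Equivalence.to (edges g) g∈)

      word-spells : Spells word graph
      word-spells {u} {v} = mk⇔ to from
        where
        to : Adj graph u v → Link word u v
        to a with Fin.<-cmp u v
        ... | tri< u<v u≢v _ = lose (Equivalence.from (edges (gen u v u≢v)) (u<v , a)) (inj₁ (refl , refl))
        ... | tri≈ _ refl _  = contradiction a (Graph.irrefl graph)
        ... | tri> _ u≢v v<u = lose (Equivalence.from (edges (gen v u (u≢v ∘ sym))) (v<u , Graph.symm graph a)) (inj₂ (refl , refl))
        from : Link word u v → Adj graph u v
        from l with find l
        ... | g , g∈ , inj₁ (refl , refl) = proj₂ (Equivalence.to (edges g) g∈)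
        ... | g , g∈ , inj₂ (refl , refl) = Graph.symm graph (proj₂ (Equivalence.to (edges g) g∈))

      private
        forest : ∀ {L} → Unique L → (∀ {g} → g ∈ L → g ∈ word) → Forest L
        forest []               L⊆ = tt
        forest {g ∷ L} (g∉ ∷ u) L⊆ = bridge , forest u (L⊆ ∘ there)
          where
          g-edge = Equivalence.to (edges g) (L⊆ (here refl))
          bridge : ¬ Conn L (src g) (tgt g)
          bridge c = no-detour (Graph.symm graph) acyclic (src≢tgt g) (proj₂ g-edge)
            (Star.map (λ l → Equivalence.from word-spells (other l) , off l) c)
            where
            other : ∀ {u v} → Link L u v → Link word u v
            other l = let (h , h∈ , e) = find l in lose (L⊆ (there h∈)) e
            off : ∀ {u v} → Link L u v → ¬ Ends g u v
            off l e = let (h , h∈ , e′) = find l in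
              All.lookup g∉ h∈ (sym (positive-≡ (proj₁ (Equivalence.to (edges h) (L⊆ (there h∈)))) (proj₁ g-edge)
                (meet h e′ e)))
              where
              meet : ∀ h {u v} → Ends h u v → Ends g u v → Ends h (src g) (tgt g)
              meet h e′ (inj₁ (refl , refl)) = e′
              meet h e′ (inj₂ (refl , refl)) = joins-sym e′

      word-compatible : AllPairs Compatible word
      word-compatible = allPairs-refine
        {R = λ e f → ∀ {i j k} → Ends e i j → Ends f i k → Before i j k}
        (λ {e} {f} e∈ f∈ before → (λ {i} {j} {k} → before {i} {j} {k}) , λ ij kl → noncrossing⇒uncrossed (Graph.symm graph) noncrossing (ends-≢ e ij)
           (Equivalence.from word-spells (lose e∈ ij)) (Equivalence.from word-spells (lose f∈ kl)))
        ordered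

      word-treeWord : TreeWord word
      word-treeWord = forest⇒treeWord
        (λ u v → Star.map (Equivalence.to word-spells) (connected u v)) (forest once id)

      word-factorization : Factorization word
      word-factorization = ordered⇒factorization word-treeWord word-compatible

-- Trace equivalence and uniqueness of edge orders

module _ {n : ℕ} where

  Disjoint : Rel (Generator n) 0ℓ
  Disjoint g h = src g ≢ src h × src g ≢ tgt h × tgt g ≢ src h × tgt g ≢ tgt h

  disjoint-sym : Symmetric Disjoint
  disjoint-sym (a , b , c , d) = a ∘ sym , c ∘ sym , b ∘ sym , d ∘ sym

  disjoint : ∀ {g h : Generator n} → (∀ {i j k} → Ends g i j → ¬ Ends h i k) → Disjoint g h
  disjoint ¬s =
    (λ e → ¬s (inj₁ (refl , refl)) (inj₁ (e , refl))) ,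
    (λ e → ¬s (inj₁ (refl , refl)) (inj₂ (e , refl))) ,
    (λ e → ¬s (inj₂ (refl , refl)) (inj₁ (e , refl))) ,
    (λ e → ¬s (inj₂ (refl , refl)) (inj₂ (e , refl)))

  infix 4 _∼_

  -- Trace equivalence: only neighbouring letters without a common vertex are exchanged. It
  -- therefore preserves the product in `FK n`, by the relation `commute`, and the permutation,
  -- which `_↭_` does not.
  data _∼_ : Rel (Monomial n) 0ℓ where
    ∼-refl  : ∀ {P} → P ∼ P
    ∼-trans : ∀ {P Q R} → P ∼ Q → Q ∼ R → P ∼ R
    ∼-prep  : ∀ g {P Q} → P ∼ Q → g ∷ P ∼ g ∷ Q
    ∼-swap  : ∀ {g h} → Disjoint g h → ∀ P → g ∷ h ∷ P ∼ h ∷ g ∷ P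

  ∼-sym : Symmetric _∼_
  ∼-sym ∼-refl        = ∼-refl
  ∼-sym (∼-trans p q) = ∼-trans (∼-sym q) (∼-sym p)
  ∼-sym (∼-prep g p)  = ∼-prep g (∼-sym p)
  ∼-sym (∼-swap {g} {h} d P) = ∼-swap (disjoint-sym {g} {h} d) P

  ∼-++ˡ : ∀ P {Q R} → Q ∼ R → P ++ Q ∼ P ++ R
  ∼-++ˡ []      p = p
  ∼-++ˡ (g ∷ P) p = ∼-prep g (∼-++ˡ P p)

  ∼-++ʳ : ∀ R {P Q} → P ∼ Q → P ++ R ∼ Q ++ R
  ∼-++ʳ R ∼-refl        = ∼-refl
  ∼-++ʳ R (∼-trans p q) = ∼-trans (∼-++ʳ R p) (∼-++ʳ R q)
  ∼-++ʳ R (∼-prep g p)  = ∼-prep g (∼-++ʳ R p)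
  ∼-++ʳ R (∼-swap d P)  = ∼-swap d (P ++ R)

  ∼-move : ∀ {g P} Q → All (Disjoint g) P → P ++ g ∷ Q ∼ g ∷ P ++ Q
  ∼-move     Q []                   = ∼-refl
  ∼-move {g} Q (_∷_ {h} {P} d ds) = ∼-trans (∼-prep h (∼-move Q ds)) (∼-swap (disjoint-sym {g} {h} d) (P ++ Q))

  ∼⇒↭ : _∼_ ⊑ _↭_
  ∼⇒↭ ∼-refl               = ↭-refl
  ∼⇒↭ (∼-trans p q)        = ↭-trans (∼⇒↭ p) (∼⇒↭ q)
  ∼⇒↭ (∼-prep g p)         = ↭-prep g (∼⇒↭ p)
  ∼⇒↭ (∼-swap {g} {h} d P) = ↭-swap g h ↭-refl

  ∼⇒≈ : ∀ {P Q : Monomial n} → P ∼ Q → ∏ P ≈ ∏ Q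
  ∼⇒≈ ∼-refl        = ≈-refl
  ∼⇒≈ (∼-trans p q) = ≈-trans (∼⇒≈ p) (∼⇒≈ q)
  ∼⇒≈ (∼-prep g p)  = *-cong ≈-refl (∼⇒≈ p)
  ∼⇒≈ (∼-swap {gen i j i≢j} {gen k l k≢l} (a , b , c , d) P) =
    ≈-trans (≈-sym (*-assoc _ _ _)) (≈-trans (*-cong (commute i≢j k≢l a b c d) ≈-refl) (*-assoc _ _ _))

  transpose-i : ∀ (i j : Fin n) → PC.transpose i j i ≡ j
  transpose-i i j with i Fin.≟ i
  ... | yes _ = refl
  ... | no ¬e = contradiction refl ¬e

  transpose-j : ∀ (i j : Fin n) → PC.transpose i j j ≡ i
  transpose-j i j with j Fin.≟ i
  ... | yes e = e
  ... | no _ with j Fin.≟ j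
  ...   | yes _ = refl
  ...   | no ¬e = contradiction refl ¬e

  transpose-fixed : ∀ {i j s : Fin n} → s ≢ i → s ≢ j → PC.transpose i j s ≡ s
  transpose-fixed {i} {j} {s} s≢i s≢j with s Fin.≟ i
  ... | yes e = contradiction e s≢i
  ... | no _ with s Fin.≟ j
  ...   | yes e = contradiction e s≢j
  ...   | no _  = refl

  transpose-commute : ∀ {g h : Generator n} → Disjoint g h → ∀ s →
    PC.transpose (src g) (tgt g) (PC.transpose (src h) (tgt h) s) ≡
    PC.transpose (src h) (tgt h) (PC.transpose (src g) (tgt g) s)
  transpose-commute {gen i j _} {gen k l _} (a , b , c , d) s
    with PC.transpose i j s | swapped i j s | PC.transpose k l s | swapped k l s
  ... | _ | first refl  | _ | first p     = contradiction p a
  ... | _ | first refl  | _ | second p    = contradiction p b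
  ... | _ | first refl  | _ | fixed _ _   = trans (transpose-i i j) (sym (transpose-fixed c d))
  ... | _ | second refl | _ | first p     = contradiction p c
  ... | _ | second refl | _ | second p    = contradiction p d
  ... | _ | second refl | _ | fixed _ _   = trans (transpose-j i j) (sym (transpose-fixed a b))
  ... | _ | fixed _ _   | _ | first refl  = trans (transpose-fixed (b ∘ sym) (d ∘ sym)) (sym (transpose-i k l))
  ... | _ | fixed _ _   | _ | second refl = trans (transpose-fixed (a ∘ sym) (c ∘ sym)) (sym (transpose-j k l))
  ... | _ | fixed p q   | _ | fixed p′ q′ = trans (transpose-fixed p q) (sym (transpose-fixed p′ q′))

  ∼⇒σ : ∀ {P Q : Monomial n} → P ∼ Q → σ⟨ P ⟩ Perm.≈ σ⟨ Q ⟩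
  ∼⇒σ ∼-refl        u = refl
  ∼⇒σ (∼-trans p q) u = trans (∼⇒σ p u) (∼⇒σ q u)
  ∼⇒σ (∼-prep g p)  u = cong (PC.transpose (src g) (tgt g)) (∼⇒σ p u)
  ∼⇒σ (∼-swap {g} {h} d P) u = transpose-commute {g} {h} d (σ⟨ P ⟩ ⟨$⟩ʳ u)

  treeWord-resp : ∀ {P Q} → P ↭ Q → TreeWord P → TreeWord Q
  treeWord-resp p t = record
    { connected = λ u v → conn-mono (∈-resp-↭ p) (connected u v)
    ; size = trans (cong (n ℕ.⊓ 1 ℕ.+_) (sym (↭-length p))) size }
    where open TreeWord t

  factorization-resp : ∀ {P Q} → P ∼ Q → Factorization P → Factorization Q
  factorization-resp p f = record
    { treeWord = treeWord-resp (∼⇒↭ p) treeWord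
    ; cycle = λ u → trans (sym (∼⇒σ p u)) (cycle u) }
    where open Factorization f

  Ordered : Rel (Generator n) 0ℓ
  Ordered e f = ∀ {i j k} → Ends e i j → Ends f i k → Before i j k

  ordered-irrefl : ∀ {e : Generator n} → ¬ Ordered e e
  ordered-irrefl {e} o = by-order (src e ∷ tgt e ∷ []) (before 0F 1F 1F ⇒ falsum) (o (self-ends e) (self-ends e))

  ordered-asym : ∀ {e f : Generator n} → Ordered e f → Ordered f e → Disjoint e f
  ordered-asym {e} {f} o o′ = disjoint {e} {f} λ {i} {j} {k} p q → by-order (i ∷ j ∷ k ∷ [])
    (before 0F 1F 2F ⇒ before 0F 2F 1F ⇒ falsum) (o p q) (o′ q p)

  -- The first letter `e` of `P` stands somewhere in `Q`. A letter in front of it there comes after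
  -- `e` in `P`, so by `ordered-asym` it shares no vertex with `e`, and `e` can be moved to the
  -- front.
  ordered-unique : ∀ {P Q : Monomial n} → AllPairs Ordered P → AllPairs Ordered Q →
                   (∀ {g} → g ∈ P ⇔ g ∈ Q) → P ∼ Q
  ordered-unique {[]}    {[]}    _ _ _  = ∼-refl
  ordered-unique {[]}    {g ∷ Q} _ _ eq with () ← Equivalence.from eq (here refl)
  ordered-unique {e ∷ P} (o ∷ os) os′ eq with ∈.∈-∃++ (Equivalence.to eq (here refl))
  ... | A , B , refl with allPairs-remove A os′
  ...   | rest , before-e , after-e =
    ∼-trans (∼-prep e (ordered-unique os rest (mk⇔ to from))) (∼-sym (∼-move B (All.tabulate λ {f} f∈A →
      ordered-asym {e} {f} (All.lookup o (from (∈.∈-++⁺ˡ f∈A))) (All.lookup before-e f∈A))))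
    where
    e∉AB : e ∉ A ++ B
    e∉AB e∈ with ∈.∈-++⁻ A e∈
    ... | inj₁ e∈A = ordered-irrefl {e} (All.lookup before-e e∈A)
    ... | inj₂ e∈B = ordered-irrefl {e} (All.lookup after-e e∈B)
    to : ∀ {g} → g ∈ P → g ∈ A ++ B
    to g∈P with ∈.∈-++⁻ A (Equivalence.to eq (there g∈P))
    ... | inj₁ g∈A          = ∈.∈-++⁺ˡ g∈A
    ... | inj₂ (there g∈B)  = ∈.∈-++⁺ʳ A g∈B
    ... | inj₂ (here refl)  = ⊥-elim (ordered-irrefl {e} (All.lookup o g∈P))
    from : ∀ {g} → g ∈ A ++ B → g ∈ P
    from g∈ with Equivalence.from eq (reinsert g∈)
      where
      reinsert : ∀ {g} → g ∈ A ++ B → g ∈ A ++ e ∷ B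
      reinsert g∈ with ∈.∈-++⁻ A g∈
      ... | inj₁ a = ∈.∈-++⁺ˡ a
      ... | inj₂ b = ∈.∈-++⁺ʳ A (there b)
    ... | here refl = contradiction g∈ e∉AB
    ... | there g∈P = g∈P

  edgeOrder-unique : ∀ {T T′ : NoncrossingTree n} → NoncrossingTree.graph T ≐ᴳ NoncrossingTree.graph T′ →
                     (o : EdgeOrder T) (o′ : EdgeOrder T′) → EdgeOrder.word o ∼ EdgeOrder.word o′
  edgeOrder-unique (T⊆T′ , T′⊆T) o o′ = ordered-unique (EdgeOrder.ordered o) (EdgeOrder.ordered o′) λ {g} → mk⇔
    (λ g∈ → let (p , a) = Equivalence.to (EdgeOrder.edges o g) g∈ in Equivalence.from (EdgeOrder.edges o′ g) (p , T⊆T′ _ _ a))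
    (λ g∈ → let (p , a) = Equivalence.to (EdgeOrder.edges o′ g) g∈ in Equivalence.from (EdgeOrder.edges o g) (p , T′⊆T _ _ a))

-- Existence of edge orders

module _ {n : ℕ} where

  -- An edge from `u` to a new vertex `v` only has to find its place among the letters at `u`: in
  -- front of the first one that must follow it, or else at the end.
  module Insertion (e : Generator n) {u v : Fin n} (e-uv : Ends e u v) where

    Precedes : Generator n → Set
    Precedes f = ∃[ k ] Ends f u k × Before u v k

    precedes? : ∀ f → Dec (Precedes f)
    precedes? f = Fin.any? λ k → joins? (src f) (tgt f) u k ×-dec
      ((k Fin.<? v ×-dec v Fin.<? u) ⊎-dec ((v Fin.<? u ×-dec u Fin.<? k) ⊎-dec (u Fin.<? k ×-dec k Fin.<? v)))

    insert : Monomial n → Monomial n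
    insert []      = e ∷ []
    insert (f ∷ W) = if does (precedes? f) then e ∷ f ∷ W else f ∷ insert W

    insert-↭ : ∀ W → insert W ↭ e ∷ W
    insert-↭ []      = ↭-refl
    insert-↭ (f ∷ W) with does (precedes? f)
    ... | true  = ↭-refl
    ... | false = ↭-trans (↭-prep f (insert-↭ W)) (↭-swap f e ↭-refl)

    insert-ordered : ∀ {W} → All (λ f → ∀ {k} → ¬ Ends f v k) W → AllPairs Ordered W → AllPairs Ordered (insert W)
    insert-ordered {[]}    []              []       = [] ∷ []
    insert-ordered {f ∷ W} (fresh ∷ fresh′) (o ∷ os) with precedes? f
    ... | yes (k₀ , f-uk₀ , vk₀) = (first-f ∷ All.tabulate later) ∷ o ∷ os
      where
      first-f : Ordered e f
      first-f p q with same-ends e e-uv p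
      ... | inj₂ (refl , refl) = contradiction q fresh
      ... | inj₁ (refl , refl) with same-ends f f-uk₀ q
      ...   | inj₁ (_ , refl) = vk₀
      ...   | inj₂ (refl , _) = contradiction refl (ends-≢ f f-uk₀)
      later : ∀ {g} → g ∈ W → Ordered e g
      later g∈ p q with same-ends e e-uv p
      ... | inj₂ (refl , refl) = contradiction q (All.lookup fresh′ g∈)
      ... | inj₁ (refl , refl) = by-order (u ∷ v ∷ k₀ ∷ _ ∷ [])
        (before 0F 1F 2F ⇒ before 0F 2F 3F ⇒ before 0F 1F 3F) vk₀ (All.lookup o g∈ f-uk₀ q)
    ... | no ¬p = All-resp-↭ (↭-sym (insert-↭ W)) (last-e ∷ o) ∷ insert-ordered fresh′ os
      where
      last-e : Ordered f e
      last-e {i} {k} {j} p q with same-ends e e-uv q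
      ... | inj₂ (refl , refl) = contradiction p fresh
      ... | inj₁ (refl , refl) = by-order (u ∷ v ∷ k ∷ [])
        (0F ≭ 1F ⇒ 0F ≭ 2F ⇒ 2F ≭ 1F ⇒ (before 0F 1F 2F ⇒ falsum) ⇒ before 0F 2F 1F)
        (ends-≢ e e-uv) (ends-≢ f p) (λ { refl → fresh (joins-sym p) }) (λ b → ¬p (k , p , b))

  module _ (T : NoncrossingTree n) where
    open NoncrossingTree T

    -- An ordered word for a subtree with vertex set `S`. By `inside`, a vertex outside `S` meets no
    -- letter, as `insert-ordered` requires of the new end.
    record Growth (S : Subset n) : Set where
      field
        word     : Monomial n
        positive : All Positive word
        ordered  : AllPairs Ordered word
        member   : ∀ {g} → g ∈ word → Adj graph (src g) (tgt g)
        inside   : ∀ {g u v} → g ∈ word → Ends g u v → u Subset.∈ S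
        linked   : ∀ {u v} → u Subset.∈ S → v Subset.∈ S → Conn word u v

    private
      seed : ∀ r → Growth Subset.⁅ r ⁆
      seed r = record
        { word = [] ; positive = [] ; ordered = [] ; member = λ () ; inside = λ ()
        ; linked = λ p q → subst₂ (Conn []) (sym (Subset.x∈⁅y⁆⇒x≡y r p)) (sym (Subset.x∈⁅y⁆⇒x≡y r q)) ε }

      edge : ∀ {u v} → Adj graph u v → Σ[ g ∈ Generator n ] Positive g × Ends g u v
      edge {u} {v} a with Fin.<-cmp u v
      ... | tri< u<v u≢v _ = gen u v u≢v , u<v , inj₁ (refl , refl)
      ... | tri≈ _ refl _  = contradiction a (Graph.irrefl graph)
      ... | tri> _ u≢v v<u = gen v u (u≢v ∘ sym) , v<u , inj₂ (refl , refl)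

      adj-ends : ∀ {g u v} → Ends g u v → Adj graph u v → Adj graph (src g) (tgt g)
      adj-ends (inj₁ (refl , refl)) a = a
      adj-ends (inj₂ (refl , refl)) a = Graph.symm graph a

      extend : ∀ {S u v} → u Subset.∈ S → v Subset.∉ S → Adj graph u v → Growth S → Growth (S Subset.∪ Subset.⁅ v ⁆)
      extend {S} {u} {v} u∈S v∉S a G with edge a
      ... | e , pos , e-uv = record
        { word     = insert word
        ; positive = All-resp-↭ (↭-sym (insert-↭ word)) (pos ∷ positive)
        ; ordered  = insert-ordered (All.tabulate λ g∈ p → v∉S (inside g∈ p)) ordered
        ; member   = λ g∈ → case ∈-resp-↭ (insert-↭ word) g∈ of λ
            { (here refl) → adj-ends {e} e-uv a ; (there g∈) → member g∈ }
        ; inside   = λ g∈ p → case ∈-resp-↭ (insert-↭ word) g∈ of λ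
            { (here refl) → inside-e (same-ends e e-uv p)
            ; (there g∈) → Subset.p⊆p∪q _ (inside g∈ p) }
        ; linked   = λ p q → conn-sym (insert word) (to-u p) ◅◅ to-u q
        }
        where
        open Growth G
        open Insertion e e-uv
        grow : ∀ {x y} → Conn word x y → Conn (insert word) x y
        grow = conn-mono λ g∈ → ∈-resp-↭ (↭-sym (insert-↭ word)) (there g∈)
        inside-e : ∀ {x y} → Joins u v x y → x Subset.∈ S Subset.∪ Subset.⁅ v ⁆
        inside-e (inj₁ (refl , _)) = Subset.p⊆p∪q _ u∈S
        inside-e (inj₂ (refl , _)) = Subset.q⊆p∪q S _ (Subset.x∈⁅x⁆ v)
        to-u : ∀ {x} → x Subset.∈ S Subset.∪ Subset.⁅ v ⁆ → Conn (insert word) u x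
        to-u x∈ with Subset.x∈p∪q⁻ S Subset.⁅ v ⁆ x∈
        ... | inj₁ x∈S = grow (linked u∈S x∈S)
        ... | inj₂ x∈v rewrite Subset.x∈⁅y⁆⇒x≡y v x∈v =
          lose (∈-resp-↭ (↭-sym (insert-↭ word)) (here refl)) e-uv ◅ ε

      -- `fuel` bounds the number of vertices outside `S`. When no edge leaves `S`, connectedness
      -- makes `S` everything.
      full : ∀ fuel {S r} → r Subset.∈ S → n ℕ.≤ fuel ℕ.+ Subset.∣ S ∣ → Growth S → Growth Subset.⊤
      full zero    {S} r∈S n≤ G =
        subst Growth (Subset.∣p∣≡n⇒p≡⊤ (ℕ.≤-antisym (Subset.∣p∣≤n S) n≤)) G
      full (suc fuel) {S} {r} r∈S n≤ G with Fin.any? (λ u → Fin.any? λ v →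
        u Subset.∈? S ×-dec ¬? (v Subset.∈? S) ×-dec T? (Graph.adj graph u v))
      ... | yes (u , v , u∈S , v∉S , a) =
        full fuel (Subset.p⊆p∪q _ r∈S) (ℕ.≤-trans n≤ (ℕ.≤-trans (ℕ.≤-reflexive (sym (ℕ.+-suc fuel _)))
          (ℕ.+-monoʳ-≤ fuel (Subset.p⊂q⇒∣p∣<∣q∣ (Subset.p⊆p∪q _ , v , Subset.q⊆p∪q S _ (Subset.x∈⁅x⁆ v) , v∉S)))))
          (extend u∈S v∉S a G)
      ... | no ¬exit = subst Growth (Subset.⊆-antisym (Subset.⊆-max S) λ {x} _ → reach r∈S (connected r x)) G
        where
        reach : ∀ {x y} → x Subset.∈ S → Star (Adj graph) x y → y Subset.∈ S
        reach x∈ ε = x∈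
        reach {x} x∈ (_◅_ {j = z} a p) with z Subset.∈? S
        ... | yes z∈ = reach z∈ p
        ... | no z∉  = contradiction (x , z , x∈ , z∉ , a) ¬exit

      grown : ∀ m → n ≡ m → Growth Subset.⊤
      grown zero    refl = record
        { word = [] ; positive = [] ; ordered = [] ; member = λ () ; inside = λ () ; linked = λ { {()} } }
      grown (suc m) refl = full n (Subset.x∈⁅x⁆ zero) (ℕ.m≤m+n n _) (seed zero)

    tree-edgeOrder : EdgeOrder T
    tree-edgeOrder = edgeOrder T positive compatible spells
      where
      open Growth (grown n refl)
      from : ∀ {u v} → Link word u v → Adj graph u v
      from l with find l
      ... | g , g∈ , inj₁ (refl , refl) = member g∈
      ... | g , g∈ , inj₂ (refl , refl) = Graph.symm graph (member g∈)
      to : ∀ {u v} → Adj graph u v → Link word u v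
      to {u} {v} a with link? word u v
      ... | yes l = l
      -- The word connects all vertices, so an edge missing from it would have a detour in the tree.
      ... | no ¬l = contradiction
        (Star.map (λ l → from l , λ { (inj₁ (refl , refl)) → ¬l l ; (inj₂ (refl , refl)) → ¬l (link-sym word l) })
                  (linked Subset.∈⊤ Subset.∈⊤))
        (no-detour (Graph.symm graph) acyclic (λ { refl → Graph.irrefl graph a }) a)
      spells : Spells word graph
      spells = mk⇔ to from
      compatible : AllPairs Compatible word
      compatible = allPairs-refine {R = Ordered}
        (λ {e} {f} e∈ f∈ before → (λ {i} {j} {k} → before {i} {j} {k}) ,
           λ ij kl → noncrossing⇒uncrossed (Graph.symm graph) noncrossing (ends-≢ e ij)
             (from (lose e∈ ij)) (from (lose f∈ kl))) ordered

-- Collecting a path into consecutive letters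

module _ {n : ℕ} where

  ∼-reflexive : ∀ {P Q : Monomial n} → P ≡ Q → P ∼ Q
  ∼-reflexive refl = ∼-refl

  treeWord-bridge : ∀ P {Q} {g : Generator n} → TreeWord (P ++ g ∷ Q) → ¬ Conn (P ++ Q) (src g) (tgt g)
  treeWord-bridge P {Q} {g} t = proj₁ (treeWord⇒forest (treeWord-resp (shift g P Q) t))

  allPairs-++ : ∀ {R : Rel (Generator n) 0ℓ} P {Q} → AllPairs R (P ++ Q) → ∀ {x y} → x ∈ P → y ∈ Q → R x y
  allPairs-++ (_ ∷ P) (r ∷ rs) (here refl) y∈ = All.lookup r (∈.∈-++⁺ʳ P y∈)
  allPairs-++ (_ ∷ P) (r ∷ rs) (there x∈)  y∈ = allPairs-++ P rs x∈ y∈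

  allPairs-++⁻ʳ : ∀ {R : Rel (Generator n) 0ℓ} P {Q} → AllPairs R (P ++ Q) → AllPairs R Q
  allPairs-++⁻ʳ []      rs       = rs
  allPairs-++⁻ʳ (_ ∷ P) (_ ∷ rs) = allPairs-++⁻ʳ P rs

  ∼-exchange : ∀ P {Q} → (∀ {g h} → g ∈ P → h ∈ Q → Disjoint h g) → P ++ Q ∼ Q ++ P
  ∼-exchange P {[]}    d = ∼-reflexive (++-identityʳ P)
  ∼-exchange P {h ∷ Q} d = ∼-trans (∼-move Q (All.tabulate λ g∈ → d g∈ (here refl)))
    (∼-prep h (∼-exchange P λ g∈ h∈ → d g∈ (there h∈)))

  module _ {S : Generator n → Set} (S? : ∀ g → Dec (S g)) where

    ∼-partition : ∀ W → (∀ {g h} → g ∈ W → h ∈ W → S g → ¬ S h → Disjoint g h) →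
                  W ∼ List.filter (¬? ∘ S?) W ++ List.filter S? W
    ∼-partition []      d = ∼-refl
    ∼-partition (g ∷ W) d with ∼-partition W (λ g∈ h∈ → d (there g∈) (there h∈)) | S? g
    ... | p | no _  = ∼-prep g p
    ... | p | yes s = ∼-trans (∼-prep g p) (∼-sym (∼-move _ (All.tabulate λ h∈ →
      let (h∈W , ¬s) = ∈.∈-filter⁻ (¬? ∘ S?) h∈ in d (here refl) (there h∈W) s ¬s)))

  module _ {T : Rel (Fin n) 0ℓ} where

    -- `F` continues upwards a path whose latest letter is `pq`. The second condition says that no
    -- edge of `T` at `q` is placed between `qp` and `qz`, so nothing at `q` has to stay between
    -- these two letters.
    data Path : Fin n → Fin n → Monomial n → Set where
      []  : ∀ {p q} → Path p q []
      _∷_ : ∀ {p q z F} .{q≢z : q ≢ z} →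
            q Fin.< z × (∀ {y} → T q y → Before q p y → ¬ Before q y z) →
            Path q z F → Path p q (gen q z q≢z ∷ F)

    -- The letters v between D and the next letter e of the path fall into those
    -- connected to D by letters of v, which may move to the right of e, and the
    -- others, which may move to the left of D.
    module Append (A D v w : Monomial n) {p q z : Fin n} .{p≢q : p ≢ q} .{q≢z : q ≢ z}
                (f : Factorization (A ++ D ++ v ++ gen q z q≢z ∷ w))
                (T-link : ∀ {x y} → Link (A ++ D ++ v ++ gen q z q≢z ∷ w) x y → T x y)
                (gap : ∀ {y} → T q y → Before q p y → ¬ Before q y z)
                (pq∈D : gen p q p≢q ∈ D) (to-q : ∀ {h x y} → h ∈ D → Ends h x y → Conn D x q) where

      private
        e : Generator n
        e = gen q z q≢z
        ordered = factorization⇒ordered f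
        open Components (components v)

        Hanging : Generator n → Set
        Hanging g = Any (λ h → label (src h) ≡ label (src g) ⊎ label (tgt h) ≡ label (src g)) D

        hanging? : ∀ g → Dec (Hanging g)
        hanging? g = Any.any? (λ h → (label (src h) Fin.≟ label (src g)) ⊎-dec (label (tgt h) Fin.≟ label (src g))) D

        v₁ v₂ : Monomial n
        v₁ = List.filter (¬? ∘ hanging?) v
        v₂ = List.filter hanging? v

        label-ends : ∀ {g i j} → g ∈ v → Ends g i j → label (src g) ≡ label i
        label-ends g∈ (inj₁ (refl , _)) = refl
        label-ends {g} g∈ (inj₂ (refl , _)) = complete (lose g∈ (self-ends g) ◅ ε)

        label-D : ∀ {h g i j} → h ∈ D → Ends h i j → label i ≡ label (src g) → Hanging g
        label-D h∈ (inj₁ (refl , _)) eq = lose h∈ (inj₁ eq)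
        label-D h∈ (inj₂ (refl , _)) eq = lose h∈ (inj₂ eq)

        parts-disjoint : ∀ {g h} → g ∈ v → h ∈ v → Hanging g → ¬ Hanging h → Disjoint g h
        parts-disjoint {g} {h} g∈ h∈ s ¬s = disjoint {g = g} {h} λ gi hi →
          ¬s (subst (λ c → Any (λ h → label (src h) ≡ c ⊎ label (tgt h) ≡ c) D)
                    (trans (label-ends g∈ gi) (sym (label-ends h∈ hi))) s)

        D-disjoint : ∀ {h g} → h ∈ D → g ∈ v₁ → Disjoint g h
        D-disjoint {h} {g} h∈ g∈ = disjoint {g = g} {h} λ gi hi →
          let (g∈v , ¬s) = ∈.∈-filter⁻ (¬? ∘ hanging?) g∈ in ¬s (label-D {h} {g} h∈ hi (sym (label-ends g∈v gi)))

        into-v : ∀ {g} → g ∈ v → g ∈ A ++ D ++ v ++ e ∷ w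
        into-v g∈ = ∈.∈-++⁺ʳ A (∈.∈-++⁺ʳ D (∈.∈-++⁺ˡ g∈))

        -- Such a letter would stand between `pq` and `qz` in the word, hence in the order at `q`,
        -- which `gap` forbids.
        avoids-q : ∀ {g y} → g ∈ v → ¬ Ends g q y
        avoids-q {g} g∈ gq = gap (T-link (lose (into-v g∈) gq))
          (proj₁ (allPairs-++ D after-A pq∈D (∈.∈-++⁺ˡ g∈)) (inj₂ (refl , refl)) gq)
          (proj₁ (allPairs-++ v after-D g∈ (here refl)) gq (self-ends e))
          where
          after-A = allPairs-++⁻ʳ A ordered
          after-D = allPairs-++⁻ʳ D after-A

        -- Otherwise letters of `v` and `D` would connect `z` with `q`, although `e` is a bridge.
        avoids-z : ∀ {g y} → g ∈ v₂ → ¬ Ends g z y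
        avoids-z {g} g∈ gz with ∈.∈-filter⁻ hanging? g∈
        ... | g∈v , s with find s
        ...   | h , h∈ , eq = treeWord-bridge (A ++ D ++ v)
          (subst TreeWord (reassociate (e ∷ w)) (Factorization.treeWord f))
          (conn-sym rest (conn-mono into′ (sound (trans (sym (label-ends g∈v gz)) (sym label≡))) ◅◅ conn-mono into to-q′))
          where
          rest = (A ++ D ++ v) ++ w
          reassociate : ∀ w → A ++ D ++ v ++ w ≡ (A ++ D ++ v) ++ w
          reassociate w = sym (trans (++-assoc A (D ++ v) w) (cong (A ++_) (++-assoc D v w)))
          into′ : ∀ {h} → h ∈ v → h ∈ rest
          into′ h∈ = ∈.∈-++⁺ˡ (∈.∈-++⁺ʳ A (∈.∈-++⁺ʳ D h∈))
          into : ∀ {h} → h ∈ D → h ∈ rest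
          into h∈ = ∈.∈-++⁺ˡ (∈.∈-++⁺ʳ A (∈.∈-++⁺ˡ h∈))
          anchor : ∃[ x ] label x ≡ label (src g) × Conn D x q
          anchor = [ (λ eq → src h , eq , to-q h∈ (self-ends h)) ,
                     (λ eq → tgt h , eq , to-q h∈ (joins-sym (self-ends h))) ]′ eq
          label≡ = proj₁ (proj₂ anchor)
          to-q′ = proj₂ (proj₂ anchor)

      A′ B′ : Monomial n
      A′ = A ++ v₁
      B′ = v₂ ++ w

      moved : A ++ D ++ v ++ e ∷ w ∼ A′ ++ (D ++ e ∷ []) ++ B′
      moved = ∼-trans (∼-++ˡ A (∼-++ˡ D (∼-++ʳ (e ∷ w) (∼-partition hanging? v parts-disjoint))))
             (∼-trans (∼-reflexive (cong (A ++_) (trans (cong (D ++_) (++-assoc v₁ v₂ _)) (sym (++-assoc D v₁ _)))))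
             (∼-trans (∼-++ˡ A (∼-++ʳ (v₂ ++ e ∷ w) (∼-exchange D D-disjoint)))
             (∼-trans (∼-++ˡ A (∼-++ˡ (v₁ ++ D) (∼-move w (All.tabulate λ {g} g∈ → disjoint {g = e} {g} (apart g∈)))))
                      (∼-reflexive (trans (cong (A ++_) (++-assoc v₁ D _)) (trans (sym (++-assoc A v₁ _))
                        (cong ((A ++ v₁) ++_) (sym (++-assoc D (e ∷ []) (v₂ ++ w))))))))))
        where
        apart : ∀ {g} → g ∈ v₂ → ∀ {i j k} → Ends e i j → ¬ Ends g i k
        apart g∈ (inj₁ (refl , _)) = avoids-q (proj₁ (∈.∈-filter⁻ hanging? g∈))
        apart g∈ (inj₂ (refl , _)) = avoids-z g∈

    -- `D` is the block collected so far, containing the latest letter `pq`. The next letter `qz` is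
    -- to the right of `D`: the order at `q` with `p < q < z` puts `pq` first, and the target `z`
    -- exceeds all targets in `D`.
    gather : ∀ {p q F} → Path p q F → ∀ A D B → Factorization (A ++ D ++ B) →
             (∀ {x y} → Link (A ++ D ++ B) x y → T x y) → (∀ {g} → g ∈ F → g ∈ A ++ D ++ B) →
             p Fin.< q → .{p≢q : p ≢ q} → gen p q p≢q ∈ D →
             (∀ {h} → h ∈ D → tgt h Fin.≤ q) → (∀ {h x y} → h ∈ D → Ends h x y → Conn D x q) →
             ∃₂ λ A′ B′ → A ++ D ++ B ∼ A′ ++ (D ++ F) ++ B′
    gather [] A D B f T-link F⊆ p<q pq∈D D≤q to-q =
      A , B , ∼-reflexive (cong (λ D → A ++ D ++ B) (sym (++-identityʳ D)))
    gather {p} {q} {gen .q z _ ∷ F} ((q<z , gap) ∷ path) A D B f T-link F⊆ p<q pq∈D D≤q to-q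
      with ∈.∈-++⁻ A (F⊆ (here refl))
    ... | inj₁ e∈A = ⊥-elim (by-order (p ∷ q ∷ z ∷ []) (0F ≺ 1F ⇒ 1F ≺ 2F ⇒ before 1F 2F 0F ⇒ falsum) p<q q<z
            (proj₁ (allPairs-++ A (factorization⇒ordered f) e∈A (∈.∈-++⁺ˡ pq∈D)) (inj₁ (refl , refl)) (inj₂ (refl , refl))))
    ... | inj₂ e∈DB with ∈.∈-++⁻ D e∈DB
    ...   | inj₁ e∈D = contradiction (D≤q e∈D) (ℕ.<⇒≱ q<z)
    ...   | inj₂ e∈B with ∈.∈-∃++ e∈B
    ...     | v , w , refl =
      let (A″ , B″ , s) = gather path A′ (D ++ gen q z _ ∷ []) B′ (factorization-resp moved f)
            (λ l → T-link (Any-resp-↭ (↭-sym (∼⇒↭ moved)) l))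
            (λ g∈ → ∈-resp-↭ (∼⇒↭ moved) (F⊆ (there g∈))) q<z (∈.∈-++⁺ʳ D (here refl))
            (λ h∈ → case ∈.∈-++⁻ D h∈ of λ
              { (inj₁ h∈D) → ℕ.≤-trans (D≤q h∈D) (ℕ.<⇒≤ q<z) ; (inj₂ (here refl)) → ℕ.≤-refl })
            (λ h∈ hx → case ∈.∈-++⁻ D h∈ of λ
              { (inj₁ h∈D) → conn-mono ∈.∈-++⁺ˡ (to-q h∈D hx) ◅◅ last ◅ ε
              ; (inj₂ (here refl)) → [ (λ { (refl , _) → last ◅ ε }) , (λ { (refl , _) → ε }) ]′ hx })
      in A″ , B″ , ∼-trans moved (∼-trans s (∼-reflexive (cong (λ D → A″ ++ D ++ B″) (++-assoc D _ F))))
      where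
      open Append A D v w f T-link gap pq∈D to-q
      last : Link (D ++ gen q z _ ∷ []) q z
      last = Any.++⁺ʳ D (here (inj₁ (refl , refl)))

-- The cyclic relation

Inj : ∀ {m n} → (Fin m → Fin n) → Set
Inj f = ∀ {p q} → f p ≡ f q → p ≡ q

tail-inj : ∀ {m n} {f : Fin (suc m) → Fin n} → Inj f → Inj (f ∘ suc)
tail-inj inj e = Fin.suc-injective (inj e)

inject₁≢suc : ∀ {m} {j : Fin m} → inject₁ j ≢ suc j
inject₁≢suc {j = j} e = ℕ.1+n≢n (trans (sym (cong toℕ e)) (Fin.toℕ-inject₁ j))

module _ {n : ℕ} where

  side-letter : ∀ {m} (f : Fin (suc m) → Fin n) → .(Inj f) → Fin m → Generator n
  side-letter f inj j = gen (f (inject₁ j)) (f (suc j)) λ e → inject₁≢suc (inj e)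

  path-word : ∀ {m} (f : Fin (suc m) → Fin n) → .(Inj f) → Monomial n
  path-word {zero}  f inj = []
  path-word {suc m} f inj = side-letter f inj 0F ∷ path-word (f ∘ suc) (tail-inj inj)

  closing : ∀ {m} (f : Fin (2 ℕ.+ m) → Fin n) → .(Inj f) → Generator n
  closing {m} f inj = gen (f (fromℕ (suc m))) (f 0F) λ e → case inj {fromℕ (suc m)} {0F} e of λ ()

  -- For the letters e₀ , e₁ , … of path-word f, rotated u f j is e_{j+1} e_{j+2} ⋯ u e₀ ⋯ e_{j-1}.
  rotated : ∀ {m} → Monomial n → (f : Fin (suc m) → Fin n) → .(Inj f) → Fin m → Monomial n
  rotated u f inj zero    = path-word (f ∘ suc) (tail-inj inj) ++ u
  rotated u f inj (suc j) = rotated (u ++ side-letter f inj 0F ∷ []) (f ∘ suc) (tail-inj inj) j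

module _ {n : ℕ} where

  open Ring (FK-ring n) using (setoid; semiring; zeroˡ; zeroʳ; +-identityʳ; *-identityʳ; +-congˡ; +-congʳ; *-congˡ; *-congʳ)
  open RingProperties (FK-ring n) using (-‿distribˡ-*; -‿distribʳ-*; -‿+-comm; -‿involutive; +-inverseˡ-unique; -0#≈0#)
  open SemiringSum semiring using (sum; sum-cong-≋; *-distribˡ-sum; *-distribʳ-sum)
  open SetoidReasoning setoid

  Commutes : FK n → Generator n → Set
  Commutes w g = w * X g ≈ X g * w

  ∏-++ : ∀ P {Q : Monomial n} → ∏ (P ++ Q) ≈ ∏ P * ∏ Q
  ∏-++ []      = ≈-sym (*-identityˡ _)
  ∏-++ (g ∷ P) = ≈-trans (*-congˡ (∏-++ P)) (≈-sym (*-assoc _ _ _))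

  -- The sum of the rotated products with an arbitrary `y` in place of the closing letter.
  -- Additivity in `y` lets the proof of the cyclic relation exchange one middle factor for another.
  rotations : ∀ {m} → FK n → (f : Fin (suc m) → Fin n) → .(Inj f) → FK n
  rotations {zero}  y f inj = ι 0ℚ
  rotations {suc m} y f inj =
    ∏ (path-word (f ∘ suc) (tail-inj inj)) * y + rotations (y * X (side-letter f inj 0F)) (f ∘ suc) (tail-inj inj)

  rotations-cong : ∀ {m y z} (f : Fin (suc m) → Fin n) .(inj : Inj f) → y ≈ z → rotations y f inj ≈ rotations z f inj
  rotations-cong {zero}  f inj y≈z = ≈-refl
  rotations-cong {suc m} f inj y≈z =
    +-cong (*-congˡ y≈z) (rotations-cong (f ∘ suc) (tail-inj inj) (*-congʳ y≈z))

  rotations-+ : ∀ {m y z} (f : Fin (suc m) → Fin n) .(inj : Inj f) →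
                rotations (y + z) f inj ≈ rotations y f inj + rotations z f inj
  rotations-+ {zero}  f inj = ≈-sym (+-identityʳ _)
  rotations-+ {suc m} {y} {z} f inj = begin
    P * (y + z) + rotations ((y + z) * e) f′ (tail-inj inj)                  ≈⟨ +-cong (distribˡ P y z) (rotations-cong f′ (tail-inj inj) (distribʳ e y z)) ⟩
    (P * y + P * z) + rotations (y * e + z * e) f′ (tail-inj inj)            ≈⟨ +-congˡ (rotations-+ f′ (tail-inj inj)) ⟩
    (P * y + P * z) + (rotations (y * e) f′ (tail-inj inj) + rotations (z * e) f′ (tail-inj inj)) ≈⟨ +-assoc _ _ _ ⟩
    P * y + (P * z + (rotations (y * e) f′ (tail-inj inj) + rotations (z * e) f′ (tail-inj inj))) ≈⟨ +-congˡ (+-assoc _ _ _) ⟨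
    P * y + ((P * z + rotations (y * e) f′ (tail-inj inj)) + rotations (z * e) f′ (tail-inj inj)) ≈⟨ +-congˡ (+-congʳ (+-comm _ _)) ⟩
    P * y + ((rotations (y * e) f′ (tail-inj inj) + P * z) + rotations (z * e) f′ (tail-inj inj)) ≈⟨ +-congˡ (+-assoc _ _ _) ⟩
    P * y + (rotations (y * e) f′ (tail-inj inj) + (P * z + rotations (z * e) f′ (tail-inj inj))) ≈⟨ +-assoc _ _ _ ⟨
    (P * y + rotations (y * e) f′ (tail-inj inj)) + (P * z + rotations (z * e) f′ (tail-inj inj)) ∎
    where
    f′ = f ∘ suc
    P = ∏ (path-word f′ (tail-inj inj))
    e = X (side-letter f inj 0F)

  rotations-neg : ∀ {m y} (f : Fin (suc m) → Fin n) .(inj : Inj f) → rotations (- y) f inj ≈ - rotations y f inj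
  rotations-neg {zero}  f inj = ≈-sym -0#≈0#
  rotations-neg {suc m} {y} f inj = begin
    P * (- y) + rotations (- y * e) f′ (tail-inj inj) ≈⟨ +-cong (≈-sym (-‿distribʳ-* P y)) (rotations-cong f′ (tail-inj inj) (≈-sym (-‿distribˡ-* y e))) ⟩
    - (P * y) + rotations (- (y * e)) f′ (tail-inj inj) ≈⟨ +-congˡ (rotations-neg f′ (tail-inj inj)) ⟩
    - (P * y) + - rotations (y * e) f′ (tail-inj inj)   ≈⟨ -‿+-comm _ _ ⟩
    - (P * y + rotations (y * e) f′ (tail-inj inj))     ∎
    where
    f′ = f ∘ suc
    P = ∏ (path-word f′ (tail-inj inj))
    e = X (side-letter f inj 0F)

  commutes-path : ∀ {m w} (f : Fin (suc m) → Fin n) .(inj : Inj f) →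
                  (∀ j → Commutes w (side-letter f inj j)) → w * ∏ (path-word f inj) ≈ ∏ (path-word f inj) * w
  commutes-path {zero}  {w} f inj c = ≈-trans (*-identityʳ w) (≈-sym (*-identityˡ w))
  commutes-path {suc m} {w} f inj c = begin
    w * (e * P)   ≈⟨ *-assoc _ _ _ ⟨
    (w * e) * P   ≈⟨ *-congʳ (c zero) ⟩
    (e * w) * P   ≈⟨ *-assoc _ _ _ ⟩
    e * (w * P)   ≈⟨ *-congˡ (commutes-path (f ∘ suc) (tail-inj inj) (c ∘ suc)) ⟩
    e * (P * w)   ≈⟨ *-assoc _ _ _ ⟨
    (e * P) * w   ∎
    where
    P = ∏ (path-word (f ∘ suc) (tail-inj inj))
    e = X (side-letter f inj 0F)

  -- The factors to the left of `y` never include the first letter of the path, so `w` only has to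
  -- commute with the later ones to reach `y`. On the right side it is the last letter that never
  -- occurs.
  rotations-*ˡ : ∀ {m w} y (f : Fin (2 ℕ.+ m) → Fin n) .(inj : Inj f) →
                 (∀ j → Commutes w (side-letter f inj (suc j))) → w * rotations y f inj ≈ rotations (w * y) f inj
  rotations-*ˡ {m} {w} y f inj c = begin
    w * (P * y + R)             ≈⟨ distribˡ _ _ _ ⟩
    w * (P * y) + w * R         ≈⟨ +-cong move (rest m f inj c) ⟩
    P * (w * y) + rotations ((w * y) * e) (f ∘ suc) (tail-inj inj) ∎
    where
    P = ∏ (path-word (f ∘ suc) (tail-inj inj))
    e = X (side-letter f inj 0F)
    R = rotations (y * e) (f ∘ suc) (tail-inj inj)
    move : w * (P * y) ≈ P * (w * y)
    move = begin
      w * (P * y)   ≈⟨ *-assoc _ _ _ ⟨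
      (w * P) * y   ≈⟨ *-congʳ (commutes-path (f ∘ suc) (tail-inj inj) c) ⟩
      (P * w) * y   ≈⟨ *-assoc _ _ _ ⟩
      P * (w * y)   ∎
    rest : ∀ m (f : Fin (2 ℕ.+ m) → Fin n) .(inj : Inj f) → (∀ j → Commutes w (side-letter f inj (suc j))) →
           let e = X (side-letter f inj 0F) in
           w * rotations (y * e) (f ∘ suc) (tail-inj inj) ≈ rotations ((w * y) * e) (f ∘ suc) (tail-inj inj)
    rest zero    f inj c = zeroʳ w
    rest (suc m) f inj c = ≈-trans (rotations-*ˡ _ (f ∘ suc) (tail-inj inj) (c ∘ suc))
                                   (rotations-cong (f ∘ suc) (tail-inj inj) (≈-sym (*-assoc _ _ _)))

  rotations-*ʳ : ∀ {m w} y (f : Fin (2 ℕ.+ m) → Fin n) .(inj : Inj f) →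
                 (∀ j → Commutes w (side-letter f inj (inject₁ j))) → rotations y f inj * w ≈ rotations (y * w) f inj
  rotations-*ʳ {m} {w} y f inj c = begin
    (P * y + R) * w             ≈⟨ distribʳ _ _ _ ⟩
    (P * y) * w + R * w         ≈⟨ +-cong (*-assoc _ _ _) (rest m f inj c) ⟩
    P * (y * w) + rotations ((y * w) * e) (f ∘ suc) (tail-inj inj) ∎
    where
    P = ∏ (path-word (f ∘ suc) (tail-inj inj))
    e = X (side-letter f inj 0F)
    R = rotations (y * e) (f ∘ suc) (tail-inj inj)
    rest : ∀ m (f : Fin (2 ℕ.+ m) → Fin n) .(inj : Inj f) → (∀ j → Commutes w (side-letter f inj (inject₁ j))) →
           let e = X (side-letter f inj 0F) in
           rotations (y * e) (f ∘ suc) (tail-inj inj) * w ≈ rotations ((y * w) * e) (f ∘ suc) (tail-inj inj)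
    rest zero    f inj c = zeroˡ w
    rest (suc m) f inj c = ≈-trans (rotations-*ʳ _ (f ∘ suc) (tail-inj inj) (c ∘ suc))
      (rotations-cong (f ∘ suc) (tail-inj inj)
        (≈-trans (*-assoc _ _ _) (≈-trans (*-congˡ (≈-sym (c zero))) (≈-sym (*-assoc _ _ _)))))

  -- Let `z`, `o`, `l` be the first, second and last vertex. The relation for the path without `z`
  -- turns `E * lz` into rotations of `ol * lz`. By the triangle relation this middle factor and the
  -- `lz * zo` of the other summands add up to `zo * lo`. Pulling `zo` out to the left leaves `zo`
  -- times the relation for the shorter path. For two vertices the relation is antisymmetry.
  cyclic-relation : ∀ {m} (f : Fin (2 ℕ.+ m) → Fin n) (inj : Inj f) →
                    ∏ (path-word f inj) + rotations (X (closing f inj)) f inj ≈ ι 0ℚ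
  cyclic-relation {zero} f inj = begin
    ab * ι 1ℚ + (ι 1ℚ * ba + ι 0ℚ) ≈⟨ +-cong (*-identityʳ _) (≈-trans (+-identityʳ _) (*-identityˡ _)) ⟩
    ab + ba                        ≈⟨ +-congʳ (antisymmetric _ _) ⟩
    - ba + ba                      ≈⟨ -‿inverseˡ _ ⟩
    ι 0ℚ                           ∎
    where
    ab = X (side-letter f inj 0F)
    ba = X (closing f inj)
  cyclic-relation {suc m} f inj = begin
    zo * E + (E * lz + rotations (lz * zo) f′ inj′)      ≈⟨ +-congˡ (+-congʳ E*lz) ⟩
    zo * E + (rotations (ol * lz) f′ inj′ + rotations (lz * zo) f′ inj′)   ≈⟨ +-congˡ (rotations-+ f′ inj′) ⟨
    zo * E + rotations (ol * lz + lz * zo) f′ inj′       ≈⟨ +-congˡ (rotations-cong f′ inj′ turn) ⟩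
    zo * E + rotations (zo * lo) f′ inj′                 ≈⟨ +-congˡ (rotations-*ˡ lo f′ inj′ zo-commutes) ⟨
    zo * E + zo * rotations lo f′ inj′                   ≈⟨ distribˡ _ _ _ ⟨
    zo * (E + rotations lo f′ inj′)                      ≈⟨ *-congˡ (cyclic-relation f′ inj′) ⟩
    zo * ι 0ℚ                                            ≈⟨ zeroʳ zo ⟩
    ι 0ℚ                                                 ∎
    where
    f′ : Fin (2 ℕ.+ m) → Fin n
    f′ = f ∘ suc
    inj′ : Inj f′
    inj′ = tail-inj inj
    E = ∏ (path-word f′ inj′)
    zo = X (side-letter f inj 0F)
    lz = X (closing f inj)
    lo = X (closing f′ inj′)
    apart : ∀ {p q} → p ≢ q → f p ≢ f q
    apart p≢q e = p≢q (inj e)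
    ol : FK n
    ol = X (gen (f 1F) (f (fromℕ (2 ℕ.+ m))) λ e → case inj {1F} {fromℕ (2 ℕ.+ m)} e of λ ())
    lo≈-ol : lo ≈ - ol
    lo≈-ol = antisymmetric _ _
    turn : ol * lz + lz * zo ≈ zo * lo
    turn = begin
      ol * lz + lz * zo   ≈⟨ -‿involutive _ ⟨
      - - (ol * lz + lz * zo) ≈⟨ -‿cong (+-inverseˡ-unique _ _ (≈-trans (≈-sym (+-assoc _ _ _)) (triangle _ _ _))) ⟨
      - (zo * ol)         ≈⟨ -‿distribʳ-* _ _ ⟩
      zo * - ol           ≈⟨ *-congˡ lo≈-ol ⟨
      zo * lo             ∎
    zo-commutes : ∀ j → Commutes zo (side-letter f′ inj′ (suc j))
    zo-commutes j = commute _ _ (apart λ ()) (apart λ ()) (apart λ ()) (apart λ ())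
    lz-commutes : ∀ j → Commutes lz (side-letter f′ inj′ (inject₁ j))
    lz-commutes j = commute _ _ (apart (Fin.fromℕ≢inject₁ ∘ Fin.suc-injective)) (apart (Fin.fromℕ≢inject₁ ∘ Fin.suc-injective))
      (apart λ ()) (apart λ ())
    E*lz : E * lz ≈ rotations (ol * lz) f′ inj′
    E*lz = begin
      E * lz                           ≈⟨ *-congʳ (+-inverseˡ-unique _ _ (cyclic-relation f′ inj′)) ⟩
      - rotations lo f′ inj′ * lz      ≈⟨ *-congʳ (rotations-neg f′ inj′) ⟨
      rotations (- lo) f′ inj′ * lz    ≈⟨ *-congʳ (rotations-cong f′ inj′ (≈-trans (-‿cong lo≈-ol) (-‿involutive _))) ⟩
      rotations ol f′ inj′ * lz        ≈⟨ rotations-*ʳ ol f′ inj′ lz-commutes ⟩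
      rotations (ol * lz) f′ inj′      ∎

  rotations-sum : ∀ {m} u (f : Fin (suc m) → Fin n) .(inj : Inj f) →
                  rotations (∏ u) f inj ≈ sum (λ j → ∏ (rotated u f inj j))
  rotations-sum {zero}  u f inj = ≈-refl
  rotations-sum {suc m} u f inj = +-cong (≈-sym (∏-++ (path-word (f ∘ suc) (tail-inj inj))))
    (≈-trans (rotations-cong (f ∘ suc) (tail-inj inj)
               (≈-sym (≈-trans (∏-++ u) (*-congˡ (*-identityʳ _)))))
             (rotations-sum (u ++ side-letter f inj 0F ∷ []) (f ∘ suc) (tail-inj inj)))

  cyclic-words : ∀ {m} A B (f : Fin (2 ℕ.+ m) → Fin n) (inj : Inj f) →
    ∏ (A ++ path-word f inj ++ B) + sum (λ j → ∏ (A ++ rotated (closing f inj ∷ []) f inj j ++ B)) ≈ ι 0ℚ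
  cyclic-words A B f inj = begin
    ∏ (A ++ E ++ B) + sum (λ j → ∏ (A ++ R j ++ B))                   ≈⟨ +-cong (sandwich E) (sum-cong-≋ λ j → sandwich (R j)) ⟩
    ∏ A * (∏ E * ∏ B) + sum (λ j → ∏ A * (∏ (R j) * ∏ B))             ≈⟨ +-congˡ (*-distribˡ-sum (∏ A) λ j → ∏ (R j) * ∏ B) ⟨
    ∏ A * (∏ E * ∏ B) + ∏ A * sum (λ j → ∏ (R j) * ∏ B)               ≈⟨ distribˡ _ _ _ ⟨
    ∏ A * (∏ E * ∏ B + sum (λ j → ∏ (R j) * ∏ B))                     ≈⟨ *-congˡ (+-congˡ (*-distribʳ-sum (∏ B) λ j → ∏ (R j))) ⟨
    ∏ A * (∏ E * ∏ B + sum (λ j → ∏ (R j)) * ∏ B)                     ≈⟨ *-congˡ (distribʳ _ _ _) ⟨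
    ∏ A * ((∏ E + sum (λ j → ∏ (R j))) * ∏ B)                         ≈⟨ *-congˡ (*-congʳ (+-congˡ (≈-trans (rotations-cong f inj (≈-sym (*-identityʳ _))) (rotations-sum (closing f inj ∷ []) f inj)))) ⟨
    ∏ A * ((∏ E + rotations (X (closing f inj)) f inj) * ∏ B)         ≈⟨ *-congˡ (*-congʳ (cyclic-relation f inj)) ⟩
    ∏ A * (ι 0ℚ * ∏ B)                                                ≈⟨ *-congˡ (zeroˡ _) ⟩
    ∏ A * ι 0ℚ                                                        ≈⟨ zeroʳ _ ⟩
    ι 0ℚ                                                              ∎
    where
    E = path-word f inj
    R = rotated (closing f inj ∷ []) f inj
    sandwich : ∀ P → ∏ (A ++ P ++ B) ≈ ∏ A * (∏ P * ∏ B)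
    sandwich P = ≈-trans (∏-++ A) (*-congˡ (∏-++ P))

-- Orienting letters

module _ {n : ℕ} where

  transpose-sym : ∀ (i j s : Fin n) → PC.transpose i j s ≡ PC.transpose j i s
  transpose-sym i j s with PC.transpose i j s | swapped i j s
  ... | _ | first refl  = sym (transpose-j j s)
  ... | _ | second refl = sym (transpose-i s i)
  ... | _ | fixed p q   = sym (transpose-fixed q p)

  orient : Generator n → Generator n
  orient (gen i j i≢j) with i Fin.<? j
  ... | yes _ = gen i j i≢j
  ... | no _  = gen j i λ e → i≢j (sym e)

  sign : Generator n → ℚ
  sign (gen i j _) with i Fin.<? j
  ... | yes _ = 1ℚ
  ... | no _  = ℚ.- 1ℚ

  orient-positive : ∀ g → Positive (orient g)
  orient-positive g@(gen i j _) with i Fin.<? j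
  ... | yes i<j = i<j
  ... | no i≮j  = ℕ.≤∧≢⇒< (ℕ.≮⇒≥ i≮j) λ e → src≢tgt g (sym (Fin.toℕ-injective e))

  orient-ends : ∀ g {u v} → Ends g u v → Ends (orient g) u v
  orient-ends (gen i j _) e with i Fin.<? j
  ... | yes _ = e
  ... | no _  = swap e

  orient-ends⁻ : ∀ g {u v} → Ends (orient g) u v → Ends g u v
  orient-ends⁻ (gen i j _) e with i Fin.<? j
  ... | yes _ = e
  ... | no _  = swap e

  orient-transpose : ∀ g s → PC.transpose (src (orient g)) (tgt (orient g)) s ≡ PC.transpose (src g) (tgt g) s
  orient-transpose (gen i j _) s with i Fin.<? j
  ... | yes _ = refl
  ... | no _  = transpose-sym j i s

  positive-sign : ∀ {g} → Positive g → sign g ≡ 1ℚ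
  positive-sign {gen i j _} i<j with i Fin.<? j
  ... | yes _  = refl
  ... | no i≮j = contradiction i<j i≮j

  negative-sign : ∀ {g} → ¬ Positive g → sign g ≡ ℚ.- 1ℚ
  negative-sign {gen i j _} i≮j with i Fin.<? j
  ... | yes i<j = contradiction i<j i≮j
  ... | no _    = refl

  signs : Monomial n → ℚ
  signs = List.foldr (λ g s → sign g ℚ.* s) 1ℚ

  positive-signs : ∀ {P} → All Positive P → signs P ≡ 1ℚ
  positive-signs []       = refl
  positive-signs (_∷_ {g} p ps) = trans (cong₂ ℚ._*_ (positive-sign {g} p) (positive-signs ps)) (ℚ.*-identityˡ 1ℚ)

  signs-resp : ∀ {P Q} → P ↭ Q → signs P ≡ signs Q
  signs-resp _↭_.refl          = refl
  signs-resp (_↭_.prep g p)    = cong (sign g ℚ.*_) (signs-resp p)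
  signs-resp (_↭_.swap {P} {Q} g h p) = trans (sym (ℚ.*-assoc (sign g) (sign h) (signs P)))
    (trans (cong₂ ℚ._*_ (ℚ.*-comm (sign g) (sign h)) (signs-resp p)) (ℚ.*-assoc (sign h) (sign g) (signs Q)))
  signs-resp (_↭_.trans p q)   = trans (signs-resp p) (signs-resp q)

  open Ring (FK-ring n) using (*-congˡ; *-congʳ; setoid)
  open RingProperties (FK-ring n) using (-1*x≈-x; +-inverseˡ-unique)
  open SetoidReasoning setoid

  ι-neg : ∀ q → ι (ℚ.- q) ≈ - ι {n} q
  ι-neg q = +-inverseˡ-unique _ _ (≈-trans (≈-sym (ι-+ (ℚ.- q) q)) (Ring.reflexive (FK-ring n) (cong ι (ℚ.+-inverseˡ q))))

  ι-minus : ∀ y → ι (ℚ.- 1ℚ) * y ≈ - y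
  ι-minus y = ≈-trans (*-congʳ (ι-neg 1ℚ)) (-1*x≈-x y)

  orient-≈ : ∀ g → X g ≈ ι (sign g) * X (orient g)
  orient-≈ (gen i j i≢j) with i Fin.<? j
  ... | yes _ = ≈-sym (*-identityˡ _)
  ... | no _  = ≈-trans (antisymmetric i≢j (λ e → i≢j (sym e))) (≈-sym (ι-minus _))

  orient-∏ : ∀ P → ∏ P ≈ ι (signs P) * ∏ (List.map orient P)
  orient-∏ []      = ≈-sym (*-identityˡ _)
  orient-∏ (g ∷ P) = begin
    X g * ∏ P                             ≈⟨ *-cong (orient-≈ g) (orient-∏ P) ⟩
    (ι s * X g⁺) * (ι t * Q)              ≈⟨ *-assoc _ _ _ ⟩
    ι s * (X g⁺ * (ι t * Q))              ≈⟨ *-congˡ (*-assoc _ _ _) ⟨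
    ι s * ((X g⁺ * ι t) * Q)              ≈⟨ *-congˡ (*-congʳ (ι-central t (X g⁺))) ⟨
    ι s * ((ι t * X g⁺) * Q)              ≈⟨ *-congˡ (*-assoc _ _ _) ⟩
    ι s * (ι t * (X g⁺ * Q))              ≈⟨ *-assoc _ _ _ ⟨
    (ι s * ι t) * (X g⁺ * Q)              ≈⟨ *-congʳ (ι-* s t) ⟨
    ι (s ℚ.* t) * (X g⁺ * Q)              ∎
    where
    s = sign g
    t = signs P
    g⁺ = orient g
    Q = ∏ (List.map orient P)

  oriented-link : ∀ {P u v} → Link P u v ⇔ Link (List.map orient P) u v
  oriented-link {P} = mk⇔ (λ l → Any.map⁺ (Any.map (λ {g} → orient-ends g) l))
                          (λ l → Any.map (λ {g} → orient-ends⁻ g) (Any.map⁻ l))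

  oriented-factorization : ∀ {P} → Factorization P → Factorization (List.map orient P)
  oriented-factorization {P} f = record
    { treeWord = record
      { connected = λ u v → Star.map (Equivalence.to oriented-link) (connected u v)
      ; size = trans (cong (n ℕ.⊓ 1 ℕ.+_) (length-map orient P)) size }
    ; cycle = λ u → trans (oriented-σ P u) (cycle u) }
    where
    open Factorization f
    oriented-σ : ∀ P u → σ⟨ List.map orient P ⟩ ⟨$⟩ʳ u ≡ σ⟨ P ⟩ ⟨$⟩ʳ u
    oriented-σ []      u = refl
    oriented-σ (g ∷ P) u = trans (orient-transpose g (σ⟨ List.map orient P ⟩ ⟨$⟩ʳ u)) (cong (PC.transpose (src g) (tgt g)) (oriented-σ P u))

  oriented-positive : ∀ P → All Positive (List.map orient P)
  oriented-positive P = All.map⁺ (All.universal orient-positive P)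

  -- Orienting all letters upwards costs the sign and produces an edge order of `T`, which is unique
  -- up to commutations.
  spelled : ∀ {W} (T : NoncrossingTree n) → Factorization W → Spells W (NoncrossingTree.graph T) →
            (o : EdgeOrder T) → ∏ W ≈ ι (signs W) * ∏ (EdgeOrder.word o)
  spelled {W} T f spells o = ≈-trans (orient-∏ W) (*-congˡ (∼⇒≈ (edgeOrder-unique {T = T} {T′ = T} ((λ _ _ → id) , (λ _ _ → id))
    (edgeOrder T (oriented-positive W) (factorization⇒ordered (oriented-factorization f))
      (mk⇔ (Equivalence.to oriented-link ∘ Equivalence.to spells)
           (Equivalence.from spells ∘ Equivalence.from oriented-link)))
    o)))

-- Rotating the letters of a path

module _ {n : ℕ} where

  act : Monomial n → Fin n → Fin n
  act W s = σ⟨ W ⟩ ⟨$⟩ʳ s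

  act-++ : ∀ P {Q} s → act (P ++ Q) s ≡ act P (act Q s)
  act-++ []      s = refl
  act-++ (g ∷ P) s = cong (PC.transpose (src g) (tgt g)) (act-++ P s)

  act-injective : ∀ W {s t} → act W s ≡ act W t → s ≡ t
  act-injective W e = trans (sym (Perm.inverseˡ σ⟨ W ⟩)) (trans (cong (σ⟨ W ⟩ ⟨$⟩ˡ_) e) (Perm.inverseˡ σ⟨ W ⟩))

  act-conjugate : ∀ W p q s → act W (PC.transpose p q s) ≡ PC.transpose (act W p) (act W q) (act W s)
  act-conjugate W p q s with PC.transpose p q s | swapped p q s
  ... | _ | first refl  = sym (transpose-i (act W p) (act W q))
  ... | _ | second refl = sym (transpose-j (act W p) (act W q))
  ... | _ | fixed a b   = sym (transpose-fixed (a ∘ act-injective W) (b ∘ act-injective W))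

  path-last : ∀ {m} (f : Fin (suc m) → Fin n) .(inj : Inj f) → act (path-word f inj) (f (fromℕ m)) ≡ f 0F
  path-last {zero}  f inj = refl
  path-last {suc m} f inj =
    trans (cong (PC.transpose (f 0F) (f 1F)) (path-last (f ∘ suc) (tail-inj inj))) (transpose-j (f 0F) (f 1F))

  path-fixes : ∀ {m} (f : Fin (suc m) → Fin n) .(inj : Inj f) {s} → (∀ p → s ≢ f p) → act (path-word f inj) s ≡ s
  path-fixes {zero}  f inj s∉ = refl
  path-fixes {suc m} f inj s∉ =
    trans (cong (PC.transpose (f 0F) (f 1F)) (path-fixes (f ∘ suc) (tail-inj inj) (s∉ ∘ suc)))
          (transpose-fixed (s∉ 0F) (s∉ 1F))

  private
    -- Moving the letter `(f 0F f 1F)` from the right end of `C ++ e ∷ []` to the left conjugates it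
    -- by `C`, which sends its ends to `f 2F` and `f 1F`; so it becomes the next letter of the path.
    -- `u` collects the closing letter and the letters already passed, and the two conditions
    -- describe its action on the vertices ahead.
    rotated-act′ : ∀ {m} u (f : Fin (2 ℕ.+ m) → Fin n) (inj : Inj f) (G : Fin n → Fin n) →
      act u (f 0F) ≡ f (fromℕ (suc m)) →
      (∀ j → suc j ≢ fromℕ (suc m) → act u (f (suc j)) ≡ f (suc j)) →
      (∀ s → act (path-word (f ∘ suc) (tail-inj inj) ++ u) s ≡ G s) →
      ∀ j s → act (rotated u f inj j) s ≡ G s
    rotated-act′ u f inj G start fix eq zero s = eq s
    rotated-act′ {suc m} u f inj G start fix eq (suc j) s =
      rotated-act′ (u ++ e ∷ []) f′ (tail-inj inj) G
        (trans (act-++ u (f 1F)) (trans (cong (act u) (transpose-j (f 0F) (f 1F))) start))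
        (λ j sj≢ → trans (act-++ u (f (suc (suc j))))
          (trans (cong (act u) (transpose-fixed (λ e → case inj e of λ ()) (λ e → case inj e of λ ())))
                 (fix (suc j) (sj≢ ∘ Fin.suc-injective))))
        turn j s
      where
      e = side-letter f inj 0F
      f′ = f ∘ suc
      f″ = f′ ∘ suc
      C = path-word f″ (tail-inj (tail-inj inj)) ++ u
      C0 : act C (f 0F) ≡ f 2F
      C0 = trans (act-++ (path-word f″ _) (f 0F)) (trans (cong (act (path-word f″ _)) start) (path-last f″ _))
      C1 : act C (f 1F) ≡ f 1F
      C1 = trans (act-++ (path-word f″ _) (f 1F)) (trans (cong (act (path-word f″ _)) (fix 0F λ ()))
             (path-fixes f″ _ λ p e → case inj e of λ ()))
      turn : ∀ s → act (path-word f″ _ ++ u ++ e ∷ []) s ≡ G s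
      turn s = begin
        act (path-word f″ _ ++ u ++ e ∷ []) s                        ≡⟨ cong (λ W → act W s) (++-assoc (path-word f″ _) u _) ⟨
        act (C ++ e ∷ []) s                                          ≡⟨ act-++ C s ⟩
        act C (PC.transpose (f 0F) (f 1F) s)                         ≡⟨ act-conjugate C (f 0F) (f 1F) s ⟩
        PC.transpose (act C (f 0F)) (act C (f 1F)) (act C s)         ≡⟨ cong₂ (λ a b → PC.transpose a b (act C s)) C0 C1 ⟩
        PC.transpose (f 2F) (f 1F) (act C s)                         ≡⟨ transpose-sym (f 2F) (f 1F) (act C s) ⟩
        PC.transpose (f 1F) (f 2F) (act C s)                         ≡⟨ eq s ⟩
        G s                                                          ∎
        where open ≡-Reasoning

  rotated-act : ∀ {m} (f : Fin (2 ℕ.+ m) → Fin n) (inj : Inj f) j s →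
                act (rotated (closing f inj ∷ []) f inj j) s ≡ act (path-word f inj) s
  rotated-act {m} f inj = rotated-act′ (closing f inj ∷ []) f inj (act (path-word f inj))
    (transpose-j (f (fromℕ (suc m))) (f 0F))
    (λ j sj≢ → transpose-fixed (λ e → sj≢ (inj e)) (λ e → case inj e of λ ()))
    λ s → begin
      act (C ++ closing f inj ∷ []) s                       ≡⟨ act-++ C s ⟩
      act C (PC.transpose (f (fromℕ (suc m))) (f 0F) s)     ≡⟨ act-conjugate C _ _ s ⟩
      PC.transpose (act C (f (fromℕ (suc m)))) (act C (f 0F)) (act C s)
        ≡⟨ cong₂ (λ a b → PC.transpose a b (act C s)) (path-last (f ∘ suc) _)
                 (path-fixes (f ∘ suc) _ λ p e → case inj e of λ ()) ⟩
      PC.transpose (f 1F) (f 0F) (act C s)                  ≡⟨ transpose-sym (f 1F) (f 0F) (act C s) ⟩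
      act (path-word f inj) s                               ∎
    where
    open ≡-Reasoning
    C = path-word (f ∘ suc) (tail-inj inj)

  rotated-↭ : ∀ {m} u (f : Fin (suc m) → Fin n) .(inj : Inj f) j →
              side-letter f inj j ∷ rotated u f inj j ↭ path-word f inj ++ u
  rotated-↭ u f inj zero    = ↭-refl
  rotated-↭ u f inj (suc j) = ↭-trans (rotated-↭ (u ++ e ∷ []) (f ∘ suc) (tail-inj inj) j)
    (subst (_↭ e ∷ P ++ u) (++-assoc P u (e ∷ [])) (↭-sym (∷↭∷ʳ e (P ++ u))))
    where
    e = side-letter f inj 0F
    P = path-word (f ∘ suc) (tail-inj inj)

-- The relation attached to a cycle

module _ {n : ℕ} where

  adj-∖ : ∀ (H : Graph n) {a b u v} → Adj (H ∖[ a , b ]) u v ⇔ (Adj H u v × ¬ Joins a b u v)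
  adj-∖ H {a} {b} {u} {v} = mk⇔ (toWitness {a? = remove? H a b u v}) (fromWitness {a? = remove? H a b u v})

  Increasing⇒Inj : ∀ {m} {f : Fin m → Fin n} → Increasing f → Inj f
  Increasing⇒Inj inc {p} {q} e with Fin.<-cmp p q
  ... | tri< p<q _ _ = contradiction (cong toℕ e) (ℕ.<⇒≢ (inc p<q))
  ... | tri≈ _ p≡q _ = p≡q
  ... | tri> _ _ q<p = contradiction (cong toℕ (sym e)) (ℕ.<⇒≢ (inc q<p))

  increasing-reflects : ∀ {m} {f : Fin m → Fin n} → Increasing f → ∀ {p q} → f p Fin.< f q → p Fin.< q
  increasing-reflects inc {p} {q} fp<fq with Fin.<-cmp p q
  ... | tri< p<q _ _  = p<q
  ... | tri≈ _ refl _ = contradiction fp<fq (ℕ.<-irrefl refl)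
  ... | tri> _ _ q<p  = contradiction fp<fq (ℕ.<-asym (inc q<p))

  increasing-≤ : ∀ {m} {f : Fin m → Fin n} → Increasing f → ∀ {p q} → p Fin.≤ q → f p Fin.≤ f q
  increasing-≤ inc {p} {q} p≤q with Fin.<-cmp p q
  ... | tri< p<q _ _  = ℕ.<⇒≤ (inc p<q)
  ... | tri≈ _ refl _ = ℕ.≤-refl
  ... | tri> _ _ q<p  = contradiction q<p (ℕ.≤⇒≯ p≤q)

  locate : ∀ {m} (f : Fin (suc m) → Fin n) y → f 0F Fin.≤ y → y Fin.≤ f (fromℕ m) →
           (∃[ t ] y ≡ f t) ⊎ (∃[ s ] f (inject₁ s) Fin.< y × y Fin.< f (suc s))
  locate {zero}  f y lo hi = inj₁ (0F , Fin.toℕ-injective (ℕ.≤-antisym hi lo))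
  locate {suc m} f y lo hi with Fin.<-cmp y (f 1F)
  ... | tri≈ _ e _ = inj₁ (1F , e)
  ... | tri> _ _ f1<y with locate (f ∘ suc) y (ℕ.<⇒≤ f1<y) hi
  ...   | inj₁ (t , e) = inj₁ (suc t , e)
  ...   | inj₂ (s , p) = inj₂ (suc s , p)
  locate {suc m} f y lo hi | tri< y<f1 _ _ with Fin.<-cmp (f 0F) y
  ...   | tri< f0<y _ _ = inj₂ (0F , f0<y , y<f1)
  ...   | tri≈ _ e _    = inj₁ (0F , sym e)
  ...   | tri> _ _ y<f0 = contradiction lo (ℕ.<⇒≱ y<f0)

  path-letter : ∀ {m} (f : Fin (suc m) → Fin n) .(inj : Inj f) {g} → g ∈ path-word f inj →
                ∃[ j ] g ≡ side-letter f inj j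
  path-letter {suc m} f inj (here e)   = 0F , e
  path-letter {suc m} f inj (there g∈) =
    let (j , e) = path-letter (f ∘ suc) (tail-inj inj) g∈ in suc j , e

  build-path : ∀ {T : Rel (Fin n) 0ℓ} {m} (f : Fin (2 ℕ.+ m) → Fin n) .(inj : Inj f) →
    (∀ j → f (inject₁ j) Fin.< f (suc j)) →
    (∀ j {y} → T (f (suc (inject₁ j))) y → Before (f (suc (inject₁ j))) (f (inject₁ (inject₁ j))) y →
               ¬ Before (f (suc (inject₁ j))) y (f (suc (suc j)))) →
    Path {T = T} (f 0F) (f 1F) (path-word (f ∘ suc) (tail-inj inj))
  build-path {m = zero}  f inj up gaps = []
  build-path {m = suc m} f inj up gaps =
    (up 1F , gaps 0F) ∷ build-path (f ∘ suc) (tail-inj inj) (up ∘ suc) (gaps ∘ suc)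

  module _ {G : Graph n} (R : TreeRelation G) where
    open TreeRelation R

    private
      inj : Inj i
      inj = Increasing⇒Inj increasing
      last : Fin (3 ℕ.+ k)
      last = fromℕ (2 ℕ.+ k)
      Adj₁ : Rel (Fin n) 0ℓ
      Adj₁ = Adj (TreeIn.graph T₁)
      adj₁ : ∀ {u v} → Adj₁ u v ⇔ (Adj H u v × ¬ Chord i u v)
      adj₁ = adj-∖ H {i 0F} {i last}
      out₁ : ∀ {u v} → Adj₁ u v → Adj H u v
      out₁ a = proj₁ (Equivalence.to adj₁ a)

    step-< : ∀ j → i (inject₁ j) Fin.< i (suc j)
    step-< j = increasing (ℕ.≤-reflexive (cong suc (Fin.toℕ-inject₁ j)))

    chord-edge : Adj H (i 0F) (i last)
    chord-edge = proj₂ (proj₁ H-cycle) (inj₁ (inj₁ (refl , refl)))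

    side-edge : ∀ j → Adj H (i (inject₁ j)) (i (suc j))
    side-edge j = proj₂ (proj₁ H-cycle) (inj₂ (j , inj₁ (refl , refl)))

    side-edge₁ : ∀ j → Adj₁ (i (inject₁ j)) (i (suc j))
    side-edge₁ j = Equivalence.from adj₁ (side-edge j , chord≢side i inj j)

    module _ (l : Fin (1 ℕ.+ k)) where

      private
        r : Fin (3 ℕ.+ k)
        r = suc (inject₁ l)
        p q z : Fin n
        p = i (inject₁ (inject₁ l))
        q = i r
        z = i (suc (suc l))

      -- All sides of the cycle lie in `T₁`, so they would form a detour around a diagonal.
      no-diagonal : ∀ t → Adj₁ q (i t) → i t ≢ p → i t ≢ z → ⊥
      no-diagonal t a ≢p ≢z = no-detour (Graph.symm (TreeIn.graph T₁)) (TreeIn.acyclic T₁)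
        (λ e → Graph.irrefl (TreeIn.graph T₁) (subst (Adj₁ q) (sym e) a)) a
        (Star.reverse S-sym (to r) ◅◅ to t)
        where
        S : Rel (Fin n) 0ℓ
        S u v = Adj₁ u v × ¬ Joins q (i t) u v
        S-sym : Symmetric S
        S-sym (a , ¬e) = Graph.symm (TreeIn.graph T₁) a , ¬e ∘ joins-sym
        not-side : ∀ j → ¬ Joins q (i t) (i (inject₁ j)) (i (suc j))
        not-side j (inj₁ (e , e′)) with Fin.toℕ-injective {j = suc l} (trans (sym (Fin.toℕ-inject₁ j)) (trans (cong toℕ (inj e)) (cong suc (Fin.toℕ-inject₁ l))))
        ... | refl = ≢z (sym e′)
        not-side j (inj₂ (e , e′)) with Fin.suc-injective (inj e′)
        ... | refl = ≢p (sym e)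
        to : ∀ t → Star S (i 0F) (i t)
        to = <-weakInduction (λ t → Star S (i 0F) (i t)) ε λ j s → s ◅◅ (side-edge₁ j , not-side j) ◅ ε

      -- A neighbour `y` placed between `qp` and `qz` is below `p` or above `z`. As `qy` does not
      -- cross the chord, `y` stays within the range of the cycle. There it is a vertex of the
      -- cycle, which gives a diagonal, or strictly between two consecutive ones, and then `qy`
      -- crosses that side.
      gap : ∀ {y} → Adj₁ q y → Before q p y → ¬ Before q y z
      gap {y} a qpy qyz = [ (λ { (t , refl) → no-diagonal t a ≢p ≢z }) , between ]′ (locate i y lo hi)
        where
        p<q = step-< (inject₁ l)
        q<z = step-< (suc l)
        c≤p : i 0F Fin.≤ p
        c≤p = increasing-≤ increasing z≤n
        z≤c : z Fin.≤ i last
        z≤c = increasing-≤ increasing (Fin.≤fromℕ _)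
        outer : y Fin.< p ⊎ z Fin.< y
        outer = by-order (p ∷ q ∷ z ∷ y ∷ [])
          (0F ≺ 1F ⇒ 1F ≺ 2F ⇒ before 1F 0F 3F ⇒ before 1F 3F 2F ⇒ 3F ≺ 0F ∨ 2F ≺ 3F) p<q q<z qpy qyz
        ≢p : y ≢ p
        ≢p refl = by-order (p ∷ q ∷ z ∷ []) (0F ≺ 1F ⇒ before 1F 0F 0F ⇒ falsum) p<q qpy
        ≢z : y ≢ z
        ≢z refl = by-order (p ∷ q ∷ z ∷ []) (1F ≺ 2F ⇒ before 1F 2F 2F ⇒ falsum) q<z qyz
        lo : i 0F Fin.≤ y
        lo = ℕ.≮⇒≥ λ y<c → H-noncrossing y<c (ℕ.≤-<-trans c≤p p<q) (ℕ.<-≤-trans q<z z≤c)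
               (Graph.symm H (out₁ a)) chord-edge
        hi : y Fin.≤ i last
        hi = ℕ.≮⇒≥ λ c<y → H-noncrossing (ℕ.≤-<-trans c≤p p<q) (ℕ.<-≤-trans q<z z≤c) c<y
               chord-edge (out₁ a)
        between : ¬ (∃[ s ] i (inject₁ s) Fin.< y × y Fin.< i (suc s))
        between (s , s<y , y<s) with outer
        ... | inj₁ y<p = H-noncrossing s<y y<s (ℕ.≤-<-trans next≤p p<q) (side-edge s) (Graph.symm H (out₁ a))
          where
          next≤p : i (suc s) Fin.≤ p
          next≤p = increasing-≤ increasing (subst (ℕ._≤ toℕ (inject₁ (inject₁ l))) (cong suc (Fin.toℕ-inject₁ s))
                     (increasing-reflects increasing (ℕ.<-trans s<y y<p)))
        ... | inj₂ z<y = H-noncrossing (ℕ.<-≤-trans q<z z≤s) s<y y<s (out₁ a) (side-edge s)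
          where
          z≤s : z Fin.≤ i (inject₁ s)
          z≤s = increasing-≤ increasing (subst (suc (suc (toℕ l)) ℕ.≤_) (sym (Fin.toℕ-inject₁ s))
                  (ℕ.≤-pred (increasing-reflects increasing (ℕ.<-trans z<y y<s))))

    module _ (o₁ : EdgeOrder (TreeIn.tree T₁)) where

      private
        W = EdgeOrder.word o₁
        spells₁ = word-spells (TreeIn.tree T₁) o₁
        F₁ = word-factorization (TreeIn.tree T₁) o₁

        letter∈W : ∀ j → side-letter i inj j ∈ W
        letter∈W j = Equivalence.from (EdgeOrder.edges o₁ _) (step-< j , side-edge₁ j)

      gathered : ∃₂ λ A B → W ∼ A ++ path-word i inj ++ B
      gathered with ∈.∈-∃++ (letter∈W 0F)
      ... | A , B , W≡ =
        let (A′ , B′ , s) = gather (build-path i inj step-< (λ l → gap l)) A (side-letter i inj 0F ∷ []) B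
              (subst Factorization W≡ F₁)
              (λ l → Equivalence.from spells₁ (subst (λ W → Link W _ _) (sym W≡) l))
              (λ g∈ → let (j , e) = path-letter i inj (there g∈) in
                 subst₂ _∈_ (sym e) W≡ (letter∈W j))
              (step-< 0F) (here refl) (λ { (here refl) → ℕ.≤-refl })
              (λ { (here refl) (inj₁ (refl , _)) → here (inj₁ (refl , refl)) ◅ ε
                 ; (here refl) (inj₂ (refl , _)) → ε })
        in A′ , B′ , ∼-trans (∼-reflexive W≡) s

      module Rotated (A B : Monomial n) (W∼W₁ : W ∼ A ++ path-word i inj ++ B) where

        private
          W₁ = A ++ path-word i inj ++ B
          F₁′ = factorization-resp W∼W₁ F₁

        module Side-omitted (j : Fin (2 ℕ.+ k)) where

          private
            e c : Generator n
            e = side-letter i inj j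
            c = closing i inj
            T = T₂₊ j
            adj-j : ∀ {u v} → Adj (TreeIn.graph T) u v ⇔ (Adj H u v × ¬ Ends e u v)
            adj-j = adj-∖ H {i (inject₁ j)} {i (suc j)}

          word-j : Monomial n
          word-j = A ++ rotated (c ∷ []) i inj j ++ B

          -- Either side spells `H`: `W₁` lacks only the chord and `word-j` only the side `e`.
          -- Edges, length and sign of `word-j` are all read off from this.
          exchange : e ∷ word-j ↭ c ∷ W₁
          exchange = ↭-trans (↭-sym (shift e A _))
            (↭-trans (++⁺ˡ A (++⁺ʳ B (↭-trans (rotated-↭ (c ∷ []) i inj j) (++-comm (path-word i inj) (c ∷ [])))))
                     (shift c A _))

          private
            H-link : ∀ {u v} → Adj H u v → Link (e ∷ word-j) u v
            H-link {u} {v} a = Any-resp-↭ (↭-sym exchange) (case joins? (i 0F) (i last) u v of λ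
              { (yes ch) → here (swap ch)
              ; (no ¬ch) → there (Any-resp-↭ (∼⇒↭ W∼W₁) (Equivalence.to spells₁ (Equivalence.from adj₁ (a , ¬ch)))) })

            link-H : ∀ {u v} → Link word-j u v → Adj H u v
            link-H l with Any-resp-↭ exchange (there l)
            ... | here (inj₁ (refl , refl)) = Graph.symm H chord-edge
            ... | here (inj₂ (refl , refl)) = chord-edge
            ... | there l₁ = out₁ (Equivalence.from spells₁ (Any-resp-↭ (↭-sym (∼⇒↭ W∼W₁)) l₁))

            T-link : ∀ {u v} → Adj (TreeIn.graph T) u v → Link word-j u v
            T-link a with Equivalence.to adj-j a
            ... | h , ¬e with H-link h
            ...   | here e  = contradiction e ¬e
            ...   | there l = l

          factorization-j : Factorization word-j
          factorization-j = record
            { treeWord = record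
              { connected = λ u v → Star.map T-link (TreeIn.connected T u v)
              ; size = trans (cong (n ℕ.⊓ 1 ℕ.+_) (trans (ℕ.suc-injective (↭-length exchange)) refl))
                             (Factorization.size F₁′) }
            ; cycle = λ u → trans (same-act u) (Factorization.cycle F₁′ u) }
            where
            same-act : ∀ u → act word-j u ≡ act W₁ u
            same-act u = begin
              act word-j u                                          ≡⟨ act-++ A u ⟩
              act A (act (rotated (c ∷ []) i inj j ++ B) u)         ≡⟨ cong (act A) (act-++ (rotated (c ∷ []) i inj j) u) ⟩
              act A (act (rotated (c ∷ []) i inj j) (act B u))      ≡⟨ cong (act A) (rotated-act i inj j (act B u)) ⟩
              act A (act (path-word i inj) (act B u))               ≡⟨ cong (act A) (act-++ (path-word i inj) u) ⟨
              act A (act (path-word i inj ++ B) u)                  ≡⟨ act-++ A u ⟨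
              act W₁ u                                              ∎
              where open ≡-Reasoning

          private
            -- A letter of `word-j` with the ends of `e` could be deleted without disconnecting the
            -- word, since the edges of `T₂₊ j` connect all vertices; but every letter of a tree
            -- word is a bridge.
            not-e : ∀ {u v} → Link word-j u v → ¬ Ends e u v
            not-e l e-uv with find l
            ... | g , g∈ , g-uv with ∈.∈-∃++ g∈
            ...   | P , Q , eq = treeWord-bridge P {Q} {g} (subst TreeWord eq (Factorization.treeWord factorization-j))
              (Star.map avoid (TreeIn.connected T _ _))
              where
              avoid : ∀ {u v} → Adj (TreeIn.graph T) u v → Link (P ++ Q) u v
              avoid a = link-remove P (subst (λ W → Link W _ _) eq (T-link a)) λ g-uv′ →
                proj₂ (Equivalence.to adj-j a) (e-same (same-ends g g-uv g-uv′))
                where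
                e-same : ∀ {u′ v′} → Joins _ _ u′ v′ → Ends e u′ v′
                e-same (inj₁ (refl , refl)) = e-uv
                e-same (inj₂ (refl , refl)) = joins-sym e-uv

          spells-j : Spells word-j (TreeIn.graph T)
          spells-j = mk⇔ T-link λ l → Equivalence.from adj-j (link-H l , not-e l)

          -- All letters point upwards except the closing one.
          signs-j : signs word-j ≡ ℚ.- 1ℚ
          signs-j = begin
            signs word-j                     ≡⟨ ℚ.*-identityˡ _ ⟨
            1ℚ ℚ.* signs word-j              ≡⟨ cong (ℚ._* signs word-j) (positive-sign {g = e} (step-< j)) ⟨
            signs (e ∷ word-j)               ≡⟨ signs-resp exchange ⟩
            sign c ℚ.* signs W₁              ≡⟨ cong₂ ℚ._*_ (negative-sign {g = c} (ℕ.<-asym (increasing {0F} {last} (s≤s z≤n)))) (signs-resp (↭-sym (∼⇒↭ W∼W₁))) ⟩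
            ℚ.- 1ℚ ℚ.* signs W               ≡⟨ cong (ℚ.- 1ℚ ℚ.*_) (positive-signs (word-positive (TreeIn.tree T₁) o₁)) ⟩
            ℚ.- 1ℚ                           ∎
            where open ≡-Reasoning

        open Ring (FK-ring n) using (*-congʳ; setoid; semiring)
        open RingProperties (FK-ring n) using (+-inverseˡ-unique; -‿involutive)
        open SemiringSum semiring using (sum; sum-cong-≋; *-distribˡ-sum)
        open SetoidReasoning setoid

        -- The sign of the closing letter cancels the sign from taking the rotated words to the
        -- other side.
        rotated-relation : (o : ∀ j → EdgeOrder (TreeIn.tree (T₂₊ j))) → ∏ W ≈ sum (λ j → ∏ (EdgeOrder.word (o j)))
        rotated-relation o = begin
          ∏ W                                              ≈⟨ ∼⇒≈ W∼W₁ ⟩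
          ∏ W₁                                             ≈⟨ +-inverseˡ-unique _ _ (cyclic-words A B i inj) ⟩
          - sum (λ j → ∏ (word-j j))                       ≈⟨ -‿cong (sum-cong-≋ λ j → ≈-trans
                                                                (spelled (TreeIn.tree (T₂₊ j)) (factorization-j j) (spells-j j) (o j))
                                                                (*-congʳ (Ring.reflexive (FK-ring n) (cong ι (signs-j j))))) ⟩
          - sum (λ j → ι (ℚ.- 1ℚ) * ∏ (EdgeOrder.word (o j))) ≈⟨ -‿cong (*-distribˡ-sum (ι (ℚ.- 1ℚ)) (λ j → ∏ (EdgeOrder.word (o j)))) ⟨
          - (ι (ℚ.- 1ℚ) * sum (λ j → ∏ (EdgeOrder.word (o j)))) ≈⟨ -‿cong (ι-minus _) ⟩
          - - sum (λ j → ∏ (EdgeOrder.word (o j)))         ≈⟨ -‿involutive _ ⟩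
          sum (λ j → ∏ (EdgeOrder.word (o j)))             ∎
          where open Side-omitted

      cycle-relation : (o : ∀ j → EdgeOrder (TreeIn.tree (T₂₊ j))) →
                       ∏ W ≈ SemiringSum.sum (Ring.semiring (FK-ring n)) (λ j → ∏ (EdgeOrder.word (o j)))
      cycle-relation o = let (A , B , W∼W₁) = gathered in Rotated.rotated-relation A B W∼W₁ o

-- Formal linear combinations

ℚ-minus : ∀ p → ℚ.- 1ℚ ℚ.* p ≡ ℚ.- p
ℚ-minus p = trans (sym (ℚ.neg-distribˡ-* 1ℚ p)) (cong ℚ.-_ (ℚ.*-identityˡ p))

ℚ-restore : ∀ p q → (p ℚ.+ ℚ.- 1ℚ ℚ.* q) ℚ.+ q ≡ p
ℚ-restore p q = trans (ℚ.+-assoc p (ℚ.- 1ℚ ℚ.* q) q) (trans (cong (λ r → p ℚ.+ (r ℚ.+ q)) (ℚ-minus q))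
  (trans (cong (p ℚ.+_) (ℚ.+-inverseˡ q)) (ℚ.+-identityʳ p)))

module FormalProperties (I : DecSetoid 0ℓ 0ℓ) where
  open DecSetoid I using (Carrier; _≟_) renaming (_≈_ to _≃_; refl to ≃-refl; sym to ≃-sym; trans to ≃-trans)
  open Formal I

  coeff-++ : ∀ c d i → coeff (c ++ d) i ≡ coeff c i ℚ.+ coeff d i
  coeff-++ []            d i = sym (ℚ.+-identityˡ _)
  coeff-++ ((q , j) ∷ c) d i with j ≟ i
  ... | yes _ = trans (cong (q ℚ.+_) (coeff-++ c d i)) (sym (ℚ.+-assoc q _ _))
  ... | no _  = coeff-++ c d i

  coeff-⊛ : ∀ r c i → coeff (r ⊛ c) i ≡ r ℚ.* coeff c i
  coeff-⊛ r []            i = sym (ℚ.*-zeroʳ r)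
  coeff-⊛ r ((q , j) ∷ c) i with j ≟ i
  ... | yes _ = trans (cong (r ℚ.* q ℚ.+_) (coeff-⊛ r c i)) (sym (ℚ.*-distribˡ-+ r q _))
  ... | no _  = coeff-⊛ r c i

  coeff-cong : ∀ c {i j} → i ≃ j → coeff c i ≡ coeff c j
  coeff-cong []            i≃j = refl
  coeff-cong ((q , k) ∷ c) {i} {j} i≃j with k ≟ i | k ≟ j
  ... | yes _   | yes _   = cong (q ℚ.+_) (coeff-cong c i≃j)
  ... | no _    | no _    = coeff-cong c i≃j
  ... | yes k≃i | no k≄j  = contradiction (≃-trans k≃i i≃j) k≄j
  ... | no k≄i  | yes k≃j = contradiction (≃-trans k≃j (≃-sym i≃j)) k≄i

  coeff-here : ∀ q c {j i} → j ≃ i → coeff ((q , j) ∷ c) i ≡ q ℚ.+ coeff c i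
  coeff-here q c {j} {i} j≃i with j ≟ i
  ... | yes _  = refl
  ... | no j≄i = contradiction j≃i j≄i

  coeff-there : ∀ q c {j i} → ¬ j ≃ i → coeff ((q , j) ∷ c) i ≡ coeff c i
  coeff-there q c {j} {i} j≄i with j ≟ i
  ... | yes j≃i = contradiction j≃i j≄i
  ... | no _    = refl

  coeff-cons : ∀ q j c i → coeff ((q , j) ∷ c) i ≡ q ℚ.* coeff ((1ℚ , j) ∷ []) i ℚ.+ coeff c i
  coeff-cons q j c i with j ≟ i
  ... | yes _ = cong (ℚ._+ coeff c i) (sym (ℚ.*-identityʳ q))
  ... | no _  = sym (trans (cong (ℚ._+ coeff c i) (ℚ.*-zeroʳ q)) (ℚ.+-identityˡ _))

  coeff-head-cong : ∀ q c {j k} → j ≃ k → ∀ i → coeff ((q , j) ∷ c) i ≡ coeff ((q , k) ∷ c) i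
  coeff-head-cong q c {j} {k} j≃k i with j ≟ i | k ≟ i
  ... | yes _   | yes _   = refl
  ... | no _    | no _    = refl
  ... | yes j≃i | no k≄i  = contradiction (≃-trans (≃-sym j≃k) j≃i) k≄i
  ... | no j≄i  | yes k≃i = contradiction (≃-trans j≃k k≃i) j≄i

  coeff-map : ∀ (f : Carrier → ℚ) → (∀ {i j} → i ≃ j → f i ≡ f j) → ∀ c i →
              coeff (List.map (λ (q , j) → q ℚ.* f j , j) c) i ≡ coeff c i ℚ.* f i
  coeff-map f f-cong []            i = sym (ℚ.*-zeroˡ (f i))
  coeff-map f f-cong ((q , j) ∷ c) i with j ≟ i
  ... | no _    = coeff-map f f-cong c i
  ... | yes j≃i = trans (cong₂ (λ a b → q ℚ.* a ℚ.+ b) (f-cong j≃i) (coeff-map f f-cong c i))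
                        (sym (ℚ.*-distribʳ-+ (f i) q _))

  coeff-absent : ∀ c i → (∀ {q j} → (q , j) ∈ c → ¬ j ≃ i) → coeff c i ≡ 0ℚ
  coeff-absent []            i absent = refl
  coeff-absent ((q , j) ∷ c) i absent =
    trans (coeff-there q c (absent (here refl))) (coeff-absent c i (absent ∘ there))

  discard : Carrier → Comb Carrier → Comb Carrier
  discard i = List.filter λ (q , j) → ¬? (j ≟ i)

  coeff-discard : ∀ i c {j} → ¬ i ≃ j → coeff (discard i c) j ≡ coeff c j
  coeff-discard i []            i≄j = refl
  coeff-discard i ((q , k) ∷ c) {j} i≄j with k ≟ i
  ... | yes k≃i = trans (coeff-discard i c i≄j) (sym (coeff-there q c λ k≃j → i≄j (≃-trans (≃-sym k≃i) k≃j)))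
  ... | no _ with k ≟ j
  ...   | yes _ = cong (q ℚ.+_) (coeff-discard i c i≄j)
  ...   | no _  = coeff-discard i c i≄j

  coeff-discarded : ∀ i c {j} → i ≃ j → coeff (discard i c) j ≡ 0ℚ
  coeff-discarded i c {j} i≃j = coeff-absent (discard i c) j λ {q} {k} k∈ k≃j →
    proj₂ (∈.∈-filter⁻ (λ (q , j) → ¬? (j ≟ i)) {xs = c} k∈) (≃-trans k≃j (≃-sym i≃j))

  module Evaluation (V : LeftModule ℚ.+-*-ring 0ℓ 0ℓ) (v : Carrier → LeftModule.Carrierᴹ V)
                    (v-cong : ∀ {i j} → i ≃ j → LeftModule._≈ᴹ_ V (v i) (v j)) where
    open LeftModule V
    open Linear V
    open SetoidReasoning ≈ᴹ-setoid

    ⟦⟧-++ : ∀ c {d} → ⟦ c ++ d ⟧ v ≈ᴹ ⟦ c ⟧ v +ᴹ ⟦ d ⟧ v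
    ⟦⟧-++ []            = ≈ᴹ-sym (+ᴹ-identityˡ _)
    ⟦⟧-++ ((q , i) ∷ c) = ≈ᴹ-trans (+ᴹ-congˡ (⟦⟧-++ c)) (≈ᴹ-sym (+ᴹ-assoc _ _ _))

    ⟦⟧-⊛ : ∀ r c → ⟦ r ⊛ c ⟧ v ≈ᴹ r *ₗ ⟦ c ⟧ v
    ⟦⟧-⊛ r []            = ≈ᴹ-sym (*ₗ-zeroʳ r)
    ⟦⟧-⊛ r ((q , i) ∷ c) = ≈ᴹ-trans (+ᴹ-cong (*ₗ-assoc r q (v i)) (⟦⟧-⊛ r c)) (≈ᴹ-sym (*ₗ-distribˡ r _ _))

    ⟦⟧-discard : ∀ i c → ⟦ c ⟧ v ≈ᴹ coeff c i *ₗ v i +ᴹ ⟦ discard i c ⟧ v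
    ⟦⟧-discard i []            = ≈ᴹ-sym (≈ᴹ-trans (+ᴹ-congʳ (*ₗ-zeroˡ _)) (+ᴹ-identityˡ _))
    ⟦⟧-discard i ((q , j) ∷ c) with j ≟ i
    ... | yes j≃i = begin
      q *ₗ v j +ᴹ ⟦ c ⟧ v                                       ≈⟨ +ᴹ-cong (*ₗ-congˡ (v-cong j≃i)) (⟦⟧-discard i c) ⟩
      q *ₗ v i +ᴹ (coeff c i *ₗ v i +ᴹ ⟦ discard i c ⟧ v)       ≈⟨ +ᴹ-assoc _ _ _ ⟨
      (q *ₗ v i +ᴹ coeff c i *ₗ v i) +ᴹ ⟦ discard i c ⟧ v       ≈⟨ +ᴹ-congʳ (*ₗ-distribʳ (v i) q _) ⟨
      (q ℚ.+ coeff c i) *ₗ v i +ᴹ ⟦ discard i c ⟧ v             ∎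
    ... | no _    = begin
      q *ₗ v j +ᴹ ⟦ c ⟧ v                                       ≈⟨ +ᴹ-congˡ (⟦⟧-discard i c) ⟩
      q *ₗ v j +ᴹ (coeff c i *ₗ v i +ᴹ ⟦ discard i c ⟧ v)       ≈⟨ +ᴹ-assoc _ _ _ ⟨
      (q *ₗ v j +ᴹ coeff c i *ₗ v i) +ᴹ ⟦ discard i c ⟧ v       ≈⟨ +ᴹ-congʳ (+ᴹ-comm _ _) ⟩
      (coeff c i *ₗ v i +ᴹ q *ₗ v j) +ᴹ ⟦ discard i c ⟧ v       ≈⟨ +ᴹ-assoc _ _ _ ⟩
      coeff c i *ₗ v i +ᴹ (q *ₗ v j +ᴹ ⟦ discard i c ⟧ v)       ∎

    -- All entries with the index of the first one are collected; their total coefficient is zero.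
    -- What remains is shorter but no tail of the list, hence the recursion on the length.
    ⟦⟧-zero : ∀ c → c ≋ [] → ⟦ c ⟧ v ≈ᴹ 0ᴹ
    ⟦⟧-zero c = go c (<-wellFounded (length c))
      where
      go : ∀ c → Acc ℕ._<_ (length c) → c ≋ [] → ⟦ c ⟧ v ≈ᴹ 0ᴹ
      go []                       _         _  = ≈ᴹ-refl
      go c₀@((q , i) ∷ c) (acc rec) z = begin
        ⟦ c₀ ⟧ v                                     ≈⟨ ⟦⟧-discard i c₀ ⟩
        coeff c₀ i *ₗ v i +ᴹ ⟦ discard i c₀ ⟧ v      ≈⟨ +ᴹ-congʳ (≈ᴹ-trans (*ₗ-congʳ (z i)) (*ₗ-zeroˡ _)) ⟩
        0ᴹ +ᴹ ⟦ discard i c₀ ⟧ v                     ≈⟨ +ᴹ-identityˡ _ ⟩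
        ⟦ discard i c₀ ⟧ v                           ≈⟨ go (discard i c₀) (rec shorter) rest ⟩
        0ᴹ                                           ∎
        where
        shorter : length (discard i c₀) ℕ.< length c₀
        shorter = filter-notAll (λ (q , j) → ¬? (j ≟ i)) c₀ (here λ ¬e → ¬e ≃-refl)
        rest : discard i c₀ ≋ []
        rest j with i ≟ j
        ... | yes i≃j = coeff-discarded i c₀ i≃j
        ... | no i≄j  = trans (coeff-discard i c₀ i≄j) (z j)

    ⟦⟧-cong : ∀ {c d} → c ≋ d → ⟦ c ⟧ v ≈ᴹ ⟦ d ⟧ v
    ⟦⟧-cong {c} {d} c≋d = begin
      ⟦ c ⟧ v                                              ≈⟨ +ᴹ-identityʳ _ ⟨
      ⟦ c ⟧ v +ᴹ 0ᴹ                                        ≈⟨ +ᴹ-congˡ (*ₗ-zeroˡ _) ⟨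
      ⟦ c ⟧ v +ᴹ (ℚ.- 1ℚ ℚ.+ 1ℚ) *ₗ ⟦ d ⟧ v                 ≈⟨ +ᴹ-congˡ (*ₗ-distribʳ _ _ _) ⟩
      ⟦ c ⟧ v +ᴹ (ℚ.- 1ℚ *ₗ ⟦ d ⟧ v +ᴹ 1ℚ *ₗ ⟦ d ⟧ v)       ≈⟨ +ᴹ-assoc _ _ _ ⟨
      (⟦ c ⟧ v +ᴹ ℚ.- 1ℚ *ₗ ⟦ d ⟧ v) +ᴹ 1ℚ *ₗ ⟦ d ⟧ v       ≈⟨ +ᴹ-cong (+ᴹ-congˡ (≈ᴹ-sym (⟦⟧-⊛ (ℚ.- 1ℚ) d))) (*ₗ-identityˡ _) ⟩
      (⟦ c ⟧ v +ᴹ ⟦ ℚ.- 1ℚ ⊛ d ⟧ v) +ᴹ ⟦ d ⟧ v              ≈⟨ +ᴹ-congʳ (⟦⟧-++ c) ⟨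
      ⟦ c ++ ℚ.- 1ℚ ⊛ d ⟧ v +ᴹ ⟦ d ⟧ v                      ≈⟨ +ᴹ-congʳ (⟦⟧-zero (c ++ ℚ.- 1ℚ ⊛ d) difference) ⟩
      0ᴹ +ᴹ ⟦ d ⟧ v                                        ≈⟨ +ᴹ-identityˡ _ ⟩
      ⟦ d ⟧ v                                              ∎
      where
      difference : (c ++ ℚ.- 1ℚ ⊛ d) ≋ []
      difference i = trans (coeff-++ c _ i) (trans (cong₂ ℚ._+_ (c≋d i) (trans (coeff-⊛ (ℚ.- 1ℚ) d i) (ℚ-minus (coeff d i)))) (ℚ.+-inverseʳ (coeff d i)))

    ⟦⟧-injective : (∀ c → ⟦ c ⟧ v ≈ᴹ 0ᴹ → c ≋ []) → ∀ {c d} → ⟦ c ⟧ v ≈ᴹ ⟦ d ⟧ v → c ≋ d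
    ⟦⟧-injective independent {c} {d} e i = trans (sym (ℚ-restore (coeff c i) (coeff d i)))
      (trans (cong (ℚ._+ coeff d i) difference) (ℚ.+-identityˡ (coeff d i)))
      where
      minus : ∀ y → ℚ.- 1ℚ *ₗ y ≈ᴹ -ᴹ y
      minus y = uniqueˡ‿-ᴹ _ _ (≈ᴹ-trans (+ᴹ-congˡ (≈ᴹ-sym (*ₗ-identityˡ y)))
        (≈ᴹ-trans (≈ᴹ-sym (*ₗ-distribʳ y (ℚ.- 1ℚ) 1ℚ)) (*ₗ-zeroˡ y)))
      vanishes : ⟦ c ++ ℚ.- 1ℚ ⊛ d ⟧ v ≈ᴹ 0ᴹ
      vanishes = begin
        ⟦ c ++ ℚ.- 1ℚ ⊛ d ⟧ v              ≈⟨ ⟦⟧-++ c ⟩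
        ⟦ c ⟧ v +ᴹ ⟦ ℚ.- 1ℚ ⊛ d ⟧ v        ≈⟨ +ᴹ-cong e (≈ᴹ-trans (⟦⟧-⊛ (ℚ.- 1ℚ) d) (minus _)) ⟩
        ⟦ d ⟧ v +ᴹ -ᴹ ⟦ d ⟧ v              ≈⟨ -ᴹ‿inverseʳ _ ⟩
        0ᴹ                                 ∎
      difference : coeff c i ℚ.+ ℚ.- 1ℚ ℚ.* coeff d i ≡ 0ℚ
      difference = trans (sym (trans (coeff-++ c (ℚ.- 1ℚ ⊛ d) i) (cong (coeff c i ℚ.+_) (coeff-⊛ (ℚ.- 1ℚ) d i))))
                         (independent (c ++ ℚ.- 1ℚ ⊛ d) vanishes i)

coeff-pullback : ∀ (I : DecSetoid 0ℓ 0ℓ) {A : Set} (f : A → DecSetoid.Carrier I) b a →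
                 Formal.coeff I (mapComb f b) (f a) ≡ Formal.coeff (On.decSetoid I f) b a
coeff-pullback I f []            a = refl
coeff-pullback I f ((q , a′) ∷ b) a with DecSetoid._≟_ I (f a′) (f a)
... | yes _ = cong (q ℚ.+_) (coeff-pullback I f b a)
... | no _  = coeff-pullback I f b a

-- Evaluation in iterated dual numbers

module _ (R : CommutativeRing 0ℓ 0ℓ) where
  private
    module R = CommutativeRing R
    open NaturalCoefficients R.commutativeSemiring using (solve; _:=_; _:+_; _:*_)

  -- The pair `(a , b)` stands for `a + b ε`, where the square of ε is 0.
  dual : CommutativeRing 0ℓ 0ℓ
  dual = record
    { Carrier = R.Carrier × R.Carrier
    ; _*_ = λ (a , b) (c , d) → a R.* c , a R.* d R.+ b R.* c
    ; 1# = R.1# , R.0#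
    ; isCommutativeRing = record
      { isRing = record
        { +-isAbelianGroup = AbelianGroup.isAbelianGroup (DirectProduct.abelianGroup R.+-abelianGroup R.+-abelianGroup)
        ; *-cong = λ (p , p′) (q , q′) → R.*-cong p q , R.+-cong (R.*-cong p q′) (R.*-cong p′ q)
        ; *-assoc = λ (a , b) (c , d) (e , f) → R.*-assoc a c e ,
            solve 6 (λ a b c d e f → (a :* c) :* f :+ (a :* d :+ b :* c) :* e :=
                                     a :* (c :* f :+ d :* e) :+ b :* (c :* e)) R.refl a b c d e f
        ; *-identity =
            (λ (a , b) → R.*-identityˡ a , R.trans (R.+-cong (R.*-identityˡ b) (R.zeroˡ a)) (R.+-identityʳ b)) ,
            (λ (a , b) → R.*-identityʳ a , R.trans (R.+-cong (R.zeroʳ a) (R.*-identityʳ b)) (R.+-identityˡ b))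
        ; distrib =
            (λ (a , b) (c , d) (e , f) → R.distribˡ a c e ,
              solve 6 (λ a b c d e f → a :* (d :+ f) :+ b :* (c :+ e) :=
                                       (a :* d :+ b :* c) :+ (a :* f :+ b :* e)) R.refl a b c d e f) ,
            (λ (a , b) (c , d) (e , f) → R.distribʳ a c e ,
              solve 6 (λ a b c d e f → (c :+ e) :* b :+ (d :+ f) :* a :=
                                       (c :* b :+ d :* a) :+ (e :* b :+ f :* a)) R.refl a b c d e f)
        }
      ; *-comm = λ (a , b) (c , d) → R.*-comm a c ,
          solve 4 (λ a b c d → a :* d :+ b :* c := c :* b :+ d :* a) R.refl a b c d
      }
    }

-- A homomorphism from `FK n` to a commutative ring, given on letters by `c`, with a linear
-- functional `top` on the target. The relations are imposed on `c` for coinciding vertices as well,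
-- because merging makes vertices coincide.
record Model (n : ℕ) : Set₁ where
  field
    target : CommutativeRing 0ℓ 0ℓ
  module R = CommutativeRing target
  field
    scalar   : ℚ → R.Carrier
    scalar-+ : ∀ p q → scalar (p ℚ.+ q) R.≈ scalar p R.+ scalar q
    scalar-* : ∀ p q → scalar (p ℚ.* q) R.≈ scalar p R.* scalar q
    scalar-0 : scalar 0ℚ R.≈ R.0#
    scalar-1 : scalar 1ℚ R.≈ R.1#
    c        : Fin n → Fin n → R.Carrier
    c-diag   : ∀ i → c i i R.≈ R.0#
    c-anti   : ∀ i j → c i j R.≈ R.- c j i
    c-square : ∀ i j → c i j R.* c i j R.≈ R.0#
    c-cyclic : ∀ i j k → c i j R.* c j k R.+ c j k R.* c k i R.+ c k i R.* c i j R.≈ R.0#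
    top      : R.Carrier → ℚ
    top-cong : ∀ {y z} → y R.≈ z → top y ≡ top z
    top-+    : ∀ y z → top (y R.+ z) ≡ top y ℚ.+ top z
    top-*    : ∀ q y → top (scalar q R.* y) ≡ q ℚ.* top y

  evaluate : FK n → R.Carrier
  evaluate (X g)   = c (src g) (tgt g)
  evaluate (ι q)   = scalar q
  evaluate (y + z) = evaluate y R.+ evaluate z
  evaluate (y * z) = evaluate y R.* evaluate z
  evaluate (- y)   = R.- evaluate y

  evaluate-cong : ∀ {y z} → y ≈ z → evaluate y R.≈ evaluate z
  evaluate-cong ≈-refl                = R.refl
  evaluate-cong (≈-sym e)             = R.sym (evaluate-cong e)
  evaluate-cong (≈-trans e f)         = R.trans (evaluate-cong e) (evaluate-cong f)
  evaluate-cong (+-cong e f)          = R.+-cong (evaluate-cong e) (evaluate-cong f)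
  evaluate-cong (*-cong e f)          = R.*-cong (evaluate-cong e) (evaluate-cong f)
  evaluate-cong (-‿cong e)            = R.-‿cong (evaluate-cong e)
  evaluate-cong (+-assoc y z w)       = R.+-assoc _ _ _
  evaluate-cong (+-comm y z)          = R.+-comm _ _
  evaluate-cong (+-identityˡ y)       = R.trans (R.+-congʳ scalar-0) (R.+-identityˡ _)
  evaluate-cong (-‿inverseˡ y)        = R.trans (R.-‿inverseˡ _) (R.sym scalar-0)
  evaluate-cong (*-assoc y z w)       = R.*-assoc _ _ _
  evaluate-cong (*-identityˡ y)       = R.trans (R.*-congʳ scalar-1) (R.*-identityˡ _)
  evaluate-cong (distribˡ y z w)      = R.distribˡ _ _ _
  evaluate-cong (distribʳ y z w)      = R.distribʳ _ _ _
  evaluate-cong (ι-+ p q)             = scalar-+ p q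
  evaluate-cong (ι-* p q)             = scalar-* p q
  evaluate-cong (ι-central q y)       = R.*-comm _ _
  evaluate-cong (antisymmetric _ _)   = c-anti _ _
  evaluate-cong (square _)            = R.trans (c-square _ _) (R.sym scalar-0)
  evaluate-cong (commute _ _ _ _ _ _) = R.*-comm _ _
  evaluate-cong (triangle _ _ _)      = R.trans (c-cyclic _ _ _) (R.sym scalar-0)

  weight : List (Fin n × Fin n) → R.Carrier
  weight = List.foldr (λ (u , v) y → c u v R.* y) R.1#

  value : List (Fin n × Fin n) → ℚ
  value L = top (weight L)

  weight-resp : ∀ {L M} → L ↭ M → weight L R.≈ weight M
  weight-resp _↭_.refl         = R.refl
  weight-resp (_↭_.prep e p)   = R.*-congˡ (weight-resp p)
  weight-resp (_↭_.swap e f p) =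
    R.trans (R.sym (R.*-assoc _ _ _)) (R.trans (R.*-cong (R.*-comm _ _) (weight-resp p)) (R.*-assoc _ _ _))
  weight-resp (_↭_.trans p q)  = R.trans (weight-resp p) (weight-resp q)

  evaluate-∏ : ∀ W → evaluate (∏ W) R.≈ weight (List.map (λ g → src g , tgt g) W)
  evaluate-∏ []      = scalar-1
  evaluate-∏ (g ∷ W) = R.*-congˡ (evaluate-∏ W)

trivial-model : ∀ n → Model n
trivial-model n = record
  { target   = ℚ.+-*-commutativeRing
  ; scalar   = id
  ; scalar-+ = λ _ _ → refl
  ; scalar-* = λ _ _ → refl
  ; scalar-0 = refl
  ; scalar-1 = refl
  ; c        = λ _ _ → 0ℚ
  ; c-diag   = λ _ → refl
  ; c-anti   = λ _ _ → refl
  ; c-square = λ _ _ → refl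
  ; c-cyclic = λ _ _ _ → refl
  ; top      = id
  ; top-cong = id
  ; top-+    = λ _ _ → refl
  ; top-*    = λ _ _ → refl
  }

collapse : ∀ {n} → Fin n → Fin (suc n) → Fin n
collapse b zero    = b
collapse b (suc i) = i

collapse² : ∀ {n} → Fin n → Fin (suc n) × Fin (suc n) → Fin n × Fin n
collapse² b (u , v) = collapse b u , collapse b v

-- Identifying the vertex 0 with the vertex b, the letter x₀ᵢ becomes x_bᵢ,
-- except that x₀ᵦ becomes the dual unit ε; top then reads off the
-- coefficient of ε.
module Merged {n : ℕ} (M : Model (suc n)) (b : Fin (suc n)) where
  open Model M
  private
    module D = CommutativeRing (dual target)
    open NaturalCoefficients R.commutativeSemiring using (solve; _:=_; _:+_; _:*_)
    open RingProperties R.ring using (-‿distribʳ-*; -‿involutive; -0#≈0#)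
    open SetoidReasoning R.setoid

    δ : Fin (suc n) → R.Carrier
    δ i with b Fin.≟ i
    ... | yes _ = R.1#
    ... | no _  = R.0#

    δ-* : ∀ i {y} → (b ≡ i → y R.≈ R.0#) → δ i R.* y R.≈ R.0#
    δ-* i z with b Fin.≟ i
    ... | yes e = R.trans (R.*-identityˡ _) (z e)
    ... | no _  = R.zeroˡ _

    cᵈ : Fin (2 ℕ.+ n) → Fin (2 ℕ.+ n) → D.Carrier
    cᵈ zero    zero    = D.0#
    cᵈ zero    (suc i) = c b i , δ i
    cᵈ (suc i) zero    = D.- (c b i , δ i)
    cᵈ (suc i) (suc j) = c i j , R.0#

    diagᵈ : ∀ i → cᵈ i i D.≈ D.0#
    diagᵈ zero    = D.refl
    diagᵈ (suc i) = c-diag i , R.refl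

    antiᵈ : ∀ i j → cᵈ i j D.≈ D.- cᵈ j i
    antiᵈ zero    zero    = R.sym -0#≈0# , R.sym -0#≈0#
    antiᵈ zero    (suc j) = R.sym (-‿involutive _) , R.sym (-‿involutive _)
    antiᵈ (suc i) zero    = D.refl
    antiᵈ (suc i) (suc j) = c-anti i j , R.sym -0#≈0#

    -- The ε-part is twice `δ i * c b i`: the first factor vanishes unless `i` is `b`, where the
    -- second one does.
    squareˢ : ∀ i → cᵈ zero (suc i) D.* cᵈ zero (suc i) D.≈ D.0#
    squareˢ i = c-square b i , R.trans (R.+-cong (R.trans (R.*-comm _ _) δc) δc) (R.+-identityˡ _)
      where
      δc : δ i R.* c b i R.≈ R.0#
      δc = δ-* i λ { refl → c-diag b }

    squareᵈ : ∀ i j → cᵈ i j D.* cᵈ i j D.≈ D.0#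
    squareᵈ zero    zero    = D.zeroˡ D.0#
    squareᵈ zero    (suc j) = squareˢ j
    squareᵈ (suc i) zero    = D.trans (D.sym (DP.-‿distribˡ-* _ _)) (D.trans (D.-‿cong (D.sym (DP.-‿distribʳ-* _ _)))
      (D.trans (DP.-‿involutive _) (squareˢ i)))
      where module DP = RingProperties D.ring
    squareᵈ (suc i) (suc j) = c-square i j , R.trans (R.+-cong (R.zeroʳ _) (R.zeroˡ _)) (R.+-identityˡ _)

    Cyclicᵈ : (i j k : Fin (2 ℕ.+ n)) → Set
    Cyclicᵈ i j k = cᵈ i j D.* cᵈ j k D.+ cᵈ j k D.* cᵈ k i D.+ cᵈ k i D.* cᵈ i j D.≈ D.0#

    rotate : ∀ i j k → Cyclicᵈ i j k → Cyclicᵈ j k i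
    rotate i j k e = D.trans (D.trans (D.+-assoc _ _ _) (D.trans (D.sym (D.+-assoc _ _ _)) (D.trans (D.+-comm _ _) (D.sym (D.+-assoc _ _ _))))) e

    degenerate : ∀ i k → Cyclicᵈ i i k
    degenerate i k =
      D.trans (D.+-cong (D.+-cong (vanish _)
          (D.trans (D.*-congˡ (antiᵈ k i)) (D.trans (D.sym (DP.-‿distribʳ-* _ _)) (D.-‿cong (squareᵈ i k)))))
          (D.trans (D.*-comm _ _) (vanish _)))
        (D.trans (D.+-identityʳ _) (D.trans (D.+-identityˡ _) DP.-0#≈0#))
      where
      module DP = RingProperties D.ring
      vanish : ∀ y → cᵈ i i D.* y D.≈ D.0#
      vanish y = D.trans (D.*-congʳ (diagᵈ i)) (D.zeroˡ y)

    -- The constant part is the cyclic relation at `b`, `j`, `k`. In the ε-part the cofactor of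
    -- `δ j` vanishes at `j ≡ b`, and that of `δ k` at `k ≡ b`.
    cyclic₀ : ∀ j k → Cyclicᵈ zero (suc j) (suc k)
    cyclic₀ j k =
      (begin
        c b j R.* c j k R.+ c j k R.* R.- c b k R.+ R.- c b k R.* c b j
          ≈⟨ R.+-cong (R.+-congˡ (R.*-congˡ (c-anti k b))) (R.*-congʳ (c-anti k b)) ⟨
        c b j R.* c j k R.+ c j k R.* c k b R.+ c k b R.* c b j
          ≈⟨ c-cyclic b j k ⟩
        R.0# ∎) ,
      (begin
        (c b j R.* R.0# R.+ δ j R.* c j k) R.+ (c j k R.* R.- δ k R.+ R.0# R.* R.- c b k)
          R.+ (R.- c b k R.* δ j R.+ R.- δ k R.* c b j)
          ≈⟨ R.+-cong (R.+-cong (R.+-congʳ (R.zeroʳ _)) (R.+-congˡ (R.zeroˡ _))) R.refl ⟩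
        (R.0# R.+ δ j R.* c j k) R.+ (c j k R.* R.- δ k R.+ R.0#) R.+ (R.- c b k R.* δ j R.+ R.- δ k R.* c b j)
          ≈⟨ R.+-congʳ (R.+-cong (R.+-identityˡ _) (R.+-identityʳ _)) ⟩
        δ j R.* c j k R.+ c j k R.* R.- δ k R.+ (R.- c b k R.* δ j R.+ R.- δ k R.* c b j)
          ≈⟨ R.+-congʳ (R.+-congˡ (negate (c j k))) ⟩
        δ j R.* c j k R.+ δ k R.* R.- c j k R.+ (R.- c b k R.* δ j R.+ R.- δ k R.* c b j)
          ≈⟨ R.+-congˡ (R.+-cong (R.*-comm _ _) (R.trans (R.*-comm _ _) (negate (c b j)))) ⟩
        δ j R.* c j k R.+ δ k R.* R.- c j k R.+ (δ j R.* R.- c b k R.+ δ k R.* R.- c b j)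
          ≈⟨ solve 6 (λ x y z w u v → x :* z :+ y :* w :+ (x :* u :+ y :* v) := x :* (z :+ u) :+ y :* (w :+ v)) R.refl
               (δ j) (δ k) (c j k) (R.- c j k) (R.- c b k) (R.- c b j) ⟩
        δ j R.* (c j k R.+ R.- c b k) R.+ δ k R.* (R.- c j k R.+ R.- c b j)
          ≈⟨ R.+-cong (δ-* j λ { refl → R.-‿inverseʳ _ }) (δ-* k λ { refl → R.trans (R.+-congˡ (R.sym (c-anti j b))) (R.-‿inverseˡ _) }) ⟩
        R.0# R.+ R.0#
          ≈⟨ R.+-identityˡ _ ⟩
        R.0# ∎)
      where
      negate : ∀ y → y R.* R.- δ k R.≈ δ k R.* R.- y
      negate y = R.trans (R.sym (-‿distribʳ-* _ _)) (R.trans (R.-‿cong (R.*-comm _ _)) (-‿distribʳ-* _ _))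

    cyclicᵈ : ∀ i j k → Cyclicᵈ i j k
    cyclicᵈ zero    zero    k       = degenerate zero k
    cyclicᵈ zero    (suc j) zero    = rotate zero zero (suc j) (degenerate zero (suc j))
    cyclicᵈ (suc i) zero    zero    = rotate zero (suc i) zero (rotate zero zero (suc i) (degenerate zero (suc i)))
    cyclicᵈ zero    (suc j) (suc k) = cyclic₀ j k
    cyclicᵈ (suc i) zero    (suc k) = rotate (suc k) (suc i) zero (rotate zero (suc k) (suc i) (cyclic₀ k i))
    cyclicᵈ (suc i) (suc j) zero    = rotate zero (suc i) (suc j) (cyclic₀ i j)
    cyclicᵈ (suc i) (suc j) (suc k) = c-cyclic i j k ,
      R.trans (R.+-cong (R.trans (R.+-cong (zz _ _) (zz _ _)) (R.+-identityˡ _)) (zz _ _)) (R.+-identityˡ _)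
      where
      zz : ∀ y z → y R.* R.0# R.+ R.0# R.* z R.≈ R.0#
      zz y z = R.trans (R.+-cong (R.zeroʳ y) (R.zeroˡ z)) (R.+-identityˡ _)

  merged : Model (2 ℕ.+ n)
  merged = record
    { target   = dual target
    ; scalar   = λ q → scalar q , R.0#
    ; scalar-+ = λ p q → scalar-+ p q , R.sym (R.+-identityˡ _)
    ; scalar-* = λ p q → scalar-* p q , R.sym (R.trans (R.+-cong (R.zeroʳ _) (R.zeroˡ _)) (R.+-identityˡ _))
    ; scalar-0 = scalar-0 , R.refl
    ; scalar-1 = scalar-1 , R.refl
    ; c        = cᵈ
    ; c-diag   = diagᵈ
    ; c-anti   = antiᵈ
    ; c-square = squareᵈ
    ; c-cyclic = cyclicᵈ
    ; top      = top ∘ proj₂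
    ; top-cong = top-cong ∘ proj₂
    ; top-+    = λ y z → top-+ (proj₂ y) (proj₂ z)
    ; top-*    = λ q (y , z) → trans (top-cong (R.trans (R.+-congˡ (R.zeroˡ y)) (R.+-identityʳ _))) (top-* q z)
    }

  private
    module M′ = Model merged

    0ᴿ : top R.0# ≡ 0ℚ
    0ᴿ = trans (top-cong (R.sym (R.zeroʳ (scalar 0ℚ)))) (trans (top-* 0ℚ R.0#) (ℚ.*-zeroˡ (top R.0#)))

    letter : ∀ {u v} → u Fin.< v → (u , v) ≢ (zero , suc b) → cᵈ u v D.≈ (c (collapse b u) (collapse b v) , R.0#)
    letter {zero}  {suc i} _ ≢ with b Fin.≟ i
    ... | yes refl = contradiction refl ≢
    ... | no _     = D.refl
    letter {suc i} {suc j} _ _ = D.refl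

    weight-plain : ∀ L → All (λ (u , v) → u Fin.< v) L → (zero , suc b) ∉ L →
                   M′.weight L D.≈ (weight (List.map (collapse² b) L) , R.0#)
    weight-plain []            _        _  = D.refl
    weight-plain ((u , v) ∷ L) (p ∷ ps) b∉ =
      D.trans (D.*-cong (letter p (λ e → b∉ (here (sym e)))) (weight-plain L ps (b∉ ∘ there)))
              (R.refl , R.trans (R.+-cong (R.zeroʳ _) (R.zeroˡ _)) (R.+-identityˡ _))

  -- Among letters pointing upwards only the one from 0 to `b` has an ε-part. If it is absent, the
  -- product has none; if it occurs once, the coefficient of ε is the weight of the other letters
  -- after the identification.
  value-without : ∀ {L} → All (λ (u , v) → u Fin.< v) L → (zero , suc b) ∉ L → M′.value L ≡ 0ℚ
  value-without {L} ps b∉ = trans (M′.top-cong (weight-plain L ps b∉)) 0ᴿ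

  value-with : ∀ {L L′} → L ↭ (zero , suc b) ∷ L′ → All (λ (u , v) → u Fin.< v) L′ → (zero , suc b) ∉ L′ →
               M′.value L ≡ value (List.map (collapse² b) L′)
  value-with {L} {L′} p ps b∉ = trans
    (M′.top-cong (D.trans (M′.weight-resp p) (D.*-congˡ {x = cᵈ zero (suc b)} (weight-plain L′ ps b∉))))
    (top-cong (R.trans (R.+-cong (R.zeroʳ _) (R.trans (R.*-congʳ δ1) (R.*-identityˡ _))) (R.+-identityˡ _)))
    where
    δ1 : δ b R.≈ R.1#
    δ1 with b Fin.≟ b
    ... | yes _ = R.refl
    ... | no ¬e = contradiction refl ¬e

-- Codes of reduced trees

-- A target above each vertex but the last. The vertex 0 is merged into the vertex `suc b`, which is
-- `b` in the numbering of the remaining vertices, where the next choice is made.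
Choices : ℕ → Set
Choices zero          = ⊤
Choices (suc zero)    = ⊤
Choices (suc (suc n)) = Fin (suc n) × Choices (suc n)

infix 4 _<ᶜ_

_<ᶜ_ : ∀ {n} → Rel (Choices n) 0ℓ
_<ᶜ_ {zero}        _       _        = ⊥
_<ᶜ_ {suc zero}    _       _        = ⊥
_<ᶜ_ {suc (suc n)} = ×-Lex _≡_ Fin._<_ _<ᶜ_

<ᶜ-wellFounded : ∀ {n} → WellFounded (_<ᶜ_ {n})
<ᶜ-wellFounded {zero}        _ = acc λ ()
<ᶜ-wellFounded {suc zero}    _ = acc λ ()
<ᶜ-wellFounded {suc (suc n)} = ×-wellFounded Fin-<-wellFounded <ᶜ-wellFounded

model : ∀ {n} → Choices n → Model n
model {zero}        _       = trivial-model 0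
model {suc zero}    _       = trivial-model 1
model {suc (suc n)} (b , p) = Merged.merged (model p) b

value : ∀ {n} → Choices n → List (Fin n × Fin n) → ℚ
value p = Model.value (model p)

least : ∀ {n} {P : Fin n → Set} → (∀ i → Dec (P i)) → ∃ P → ∃[ b ] P b × (∀ {j} → P j → b Fin.≤ j)
least {suc n} P? (i , p) with P? zero
... | yes p₀ = zero , p₀ , λ _ → z≤n
least {suc n} P? (zero  , p) | no ¬p₀ = contradiction p ¬p₀
least {suc n} P? (suc i , p) | no ¬p₀ =
  let (b , pb , lb) = least (P? ∘ suc) (i , p) in
  suc b , pb , λ { {zero} p₀ → contradiction p₀ ¬p₀ ; {suc j} pj → s≤s (lb pj) }

module _ {n : ℕ} where

  Pairs : Set
  Pairs = List (Fin n × Fin n)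

  Climb : Pairs → Rel (Fin n) 0ℓ
  Climb L = Star λ u v → (u , v) ∈ L

  Free : Pairs → Fin n → Fin n → Set
  Free L c d = ∀ {u v} → (u , v) ∈ L →
    ¬ (u Fin.< c × c Fin.< v × v Fin.< d) × ¬ (c Fin.< u × u Fin.< d × d Fin.< v)

  -- In `saturated`, `a`, `x` and `c`, `d` are the first two and the last two vertices of the
  -- sequence in `IsReduced`, with an increasing walk from `x` to `c`; for three vertices `x` is
  -- `c`. `G` is a relation instead of a graph since contraction leads to `Quotient`, which need not
  -- be symmetric.
  record Reduced (G : Rel (Fin n) 0ℓ) (L : Pairs) : Set where
    field
      up        : ∀ {u v} → (u , v) ∈ L → u Fin.< v
      inside    : ∀ {u v} → (u , v) ∈ L → G u v
      uncrossed : ∀ {a b c d} → (a , c) ∈ L → (b , d) ∈ L → a Fin.< b → b Fin.< c → ¬ c Fin.< d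
      linked    : ∀ u v → Star (λ u v → (u , v) ∈ L ⊎ (v , u) ∈ L) u v
      saturated : ∀ {a x c d} → (a , d) ∈ L → (a , x) ∈ L → Climb L x c → c Fin.< d → G c d → ¬ Free L c d
      unique    : Unique L

    up-all : All (λ (u , v) → u Fin.< v) L
    up-all = All.tabulate up

-- Edges at 0 are transferred to `b` only if they lead above `b`: that is where the further
-- neighbours of 0 are, `b` being the least.
Quotient : ∀ {n} → Rel (Fin (suc n)) 0ℓ → Fin n → Rel (Fin n) 0ℓ
Quotient G b u v = G (suc u) (suc v) ⊎ (u ≡ b × b Fin.< v × G zero (suc v))

_≟²_ : ∀ {n} (e f : Fin n × Fin n) → Dec (e ≡ f)
_≟²_ = ×-≡-dec Fin._≟_ Fin._≟_

_∈?_ : ∀ {n} (e : Fin n × Fin n) L → Dec (e ∈ L)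
e ∈? L = Any.any? (e ≟²_) L

module Contract {n : ℕ} (b : Fin (suc n)) where

  record Step (L : List (Fin (2 ℕ.+ n) × Fin (2 ℕ.+ n))) : Set where
    field
      rest   : List (Fin (2 ℕ.+ n) × Fin (2 ℕ.+ n))
      split  : L ↭ (zero , suc b) ∷ rest
      absent : (zero , suc b) ∉ rest
      unique-rest : Unique rest
      minimal : ∀ {j} → (zero , suc j) ∈ L → b Fin.≤ j

    base : (zero , suc b) ∈ L
    base = ∈-resp-↭ (↭-sym split) (here refl)

    rest⊆ : ∀ {e} → e ∈ rest → e ∈ L
    rest⊆ e∈ = ∈-resp-↭ (↭-sym split) (there e∈)

    rest⊇ : ∀ {e} → e ∈ L → e ≢ (zero , suc b) → e ∈ rest
    rest⊇ e∈ e≢ with ∈-resp-↭ split e∈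
    ... | here e   = contradiction e e≢
    ... | there e∈ = e∈

    contracted : List (Fin (suc n) × Fin (suc n))
    contracted = List.map (collapse² b) rest

    lift-plain : ∀ {u v} → (suc u , suc v) ∈ L → (u , v) ∈ contracted
    lift-plain e∈ = ∈.∈-map⁺ (collapse² b) (rest⊇ e∈ λ ())

    lift-zero : ∀ {v} → (zero , suc v) ∈ L → v ≢ b → (b , v) ∈ contracted
    lift-zero e∈ v≢b = ∈.∈-map⁺ (collapse² b) (rest⊇ e∈ λ { refl → v≢b refl })

  module _ {G : Rel (Fin (2 ℕ.+ n)) 0ℓ} {L} (r : Reduced G L) (s : Step L) where
    open Reduced r
    open Step s

    lower : ∀ {u v} → (u , v) ∈ contracted →
            (suc u , suc v) ∈ L ⊎ (u ≡ b × b Fin.< v × (zero , suc v) ∈ L)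
    lower uv∈ with ∈.∈-map⁻ (collapse² b) uv∈
    ... | (zero , zero)   , e∈ , refl with () ← up (rest⊆ e∈)
    ... | (suc x , zero)  , e∈ , refl with () ← up (rest⊆ e∈)
    ... | (suc x , suc y) , e∈ , refl = inj₁ (rest⊆ e∈)
    ... | (zero , suc y)  , e∈ , refl = inj₂ (refl ,
      ℕ.≤∧≢⇒< (minimal (rest⊆ e∈)) (λ e → absent (subst (λ y → (zero , suc y) ∈ rest) (sym (Fin.toℕ-injective e)) e∈)) ,
      rest⊆ e∈)

    lower-plain : ∀ {u v} → (u , v) ∈ contracted → u ≢ b → (suc u , suc v) ∈ L
    lower-plain uv∈ u≢b with lower uv∈
    ... | inj₁ e∈        = e∈
    ... | inj₂ (u≡b , _) = contradiction u≡b u≢b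

    up′ : ∀ {u v} → (u , v) ∈ contracted → u Fin.< v
    up′ uv∈ with lower uv∈
    ... | inj₁ e∈              = ℕ.≤-pred (up e∈)
    ... | inj₂ (refl , b<v , _) = b<v

    -- A pair passing over `b` would come from an edge crossing the one from 0 to `b`.
    over-base : ∀ {a d} → (a , d) ∈ contracted → a Fin.< b → ¬ b Fin.< d
    over-base ad∈ a<b b<d = uncrossed base (lower-plain ad∈ (ℕ.<⇒≢ a<b ∘ cong toℕ)) (s≤s z≤n) (s≤s a<b) (s≤s b<d)

    climb′-≤ : ∀ {x c} → Climb contracted x c → x Fin.≤ c
    climb′-≤ ε       = ℕ.≤-refl
    climb′-≤ (l ◅ p) = ℕ.≤-trans (ℕ.<⇒≤ (up′ l)) (climb′-≤ p)

    lower-climb : ∀ {x c} → b Fin.< x ⊎ c Fin.< b → Climb contracted x c → Climb L (suc x) (suc c)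
    lower-climb side ε = ε
    lower-climb (inj₁ b<x) (l ◅ p) =
      lower-plain l (λ e → ℕ.<⇒≢ b<x (cong toℕ (sym e))) ◅ lower-climb (inj₁ (ℕ.<-trans b<x (up′ l))) p
    lower-climb {c = c} (inj₂ c<b) (l ◅ p) =
      lower-plain l (λ e → ℕ.<⇒≢ (ℕ.<-trans (ℕ.<-≤-trans (up′ l) (climb′-≤ p)) c<b) (cong toℕ e)) ◅ lower-climb (inj₂ c<b) p

    -- Only edges at 0 need care. For `b < c` those that end between `c` and `d` reappear at `b`;
    -- for `d ≤ b` they all end at `d` or above, as `b` is the least neighbour.
    lower-free : ∀ {c d} → b Fin.< c ⊎ d Fin.≤ b → Free contracted c d → Free L (suc c) (suc d)
    lower-free side free {suc u} {suc v} e∈ =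
      let (p , q) = free (lift-plain e∈) in
      (λ (x , y , z) → p (ℕ.≤-pred x , ℕ.≤-pred y , ℕ.≤-pred z)) ,
      (λ (x , y , z) → q (ℕ.≤-pred x , ℕ.≤-pred y , ℕ.≤-pred z))
    lower-free {c} {d} side free {zero} {suc v} e∈ =
      (λ (_ , c<v , v<d) → crossing side (ℕ.≤-pred c<v) (ℕ.≤-pred v<d)) , λ ()
      where
      crossing : b Fin.< c ⊎ d Fin.≤ b → c Fin.< v → ¬ v Fin.< d
      crossing (inj₁ b<c) c<v v<d = proj₁ (free (lift-zero e∈ λ { refl → ℕ.<-asym b<c c<v })) (b<c , c<v , v<d)
      crossing (inj₂ d≤b) c<v v<d = ℕ.<⇒≱ v<d (ℕ.≤-trans d≤b (minimal e∈))
    lower-free side free {zero}  {zero} e∈ with () ← up e∈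
    lower-free side free {suc u} {zero} e∈ with () ← up e∈

    private
      -- As a member of `L` the pair `bv` is uncrossed, so 0, `b`, `v` would violate reducedness.
      -- Consequently the contraction identifies no two pairs.
      split-base : ∀ {v} → (zero , suc v) ∈ L → (suc b , suc v) ∈ L → b Fin.< v → ⊥
      split-base 0v bv b<v = saturated 0v base ε (s≤s b<v) (inside bv) λ e∈ →
        (λ (x , y , z) → uncrossed e∈ bv x y z) , (λ (x , y , z) → uncrossed bv e∈ x y z)

      uncrossed′ : ∀ {a b′ c d} → (a , c) ∈ contracted → (b′ , d) ∈ contracted →
                   a Fin.< b′ → b′ Fin.< c → ¬ c Fin.< d
      uncrossed′ ac bd a<b b<c c<d with lower ac | lower bd
      ... | inj₁ ac′             | inj₁ bd′            = uncrossed ac′ bd′ (s≤s a<b) (s≤s b<c) (s≤s c<d)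
      ... | inj₁ ac′             | inj₂ (refl , _ , _) = uncrossed base ac′ (s≤s z≤n) (s≤s a<b) (s≤s b<c)
      ... | inj₂ (refl , _ , 0c) | inj₁ bd′            = uncrossed 0c bd′ (s≤s z≤n) (s≤s b<c) (s≤s c<d)
      ... | inj₂ (refl , _ , _)  | inj₂ (refl , _ , _) = ℕ.<-irrefl refl a<b

      linked′ : ∀ u v → Star (λ u v → (u , v) ∈ contracted ⊎ (v , u) ∈ contracted) u v
      linked′ u v = Star.kleisliStar (collapse b)
        (λ { (inj₁ e∈) → edge e∈ ; (inj₂ e∈) → Star.reverse Sum.swap (edge e∈) }) (linked (suc u) (suc v))
        where
        edge : ∀ {x y} → (x , y) ∈ L → Star (λ u v → (u , v) ∈ contracted ⊎ (v , u) ∈ contracted) (collapse b x) (collapse b y)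
        edge {zero}  {zero}  e∈ with () ← up e∈
        edge {suc x} {zero}  e∈ with () ← up e∈
        edge {suc x} {suc y} e∈ = inj₁ (lift-plain e∈) ◅ ε
        edge {zero}  {suc y} e∈ with y Fin.≟ b
        ... | yes refl = ε
        ... | no y≢b   = inj₁ (lift-zero e∈ y≢b) ◅ ε

      unique′ : Unique contracted
      unique′ = AllPairs.map⁺ (allPairs-refine apart unique-rest)
        where
        apart : ∀ {e f} → e ∈ rest → f ∈ rest → e ≢ f → collapse² b e ≢ collapse² b f
        apart {suc x , suc y} {suc x′ , suc y′} e∈ f∈ e≢f refl = e≢f refl
        apart {zero , suc y}  {zero , suc y′}   e∈ f∈ e≢f refl = e≢f refl
        apart {zero , suc y}  {suc x′ , suc y′} e∈ f∈ e≢f refl = split-base (rest⊆ e∈) (rest⊆ f∈) (ℕ.≤-pred (up (rest⊆ f∈)))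
        apart {suc x , suc y} {zero , suc y′}   e∈ f∈ e≢f refl = split-base (rest⊆ f∈) (rest⊆ e∈) (ℕ.≤-pred (up (rest⊆ e∈)))
        apart {zero , zero}   e∈ with () ← up (rest⊆ e∈)
        apart {suc x , zero}  e∈ with () ← up (rest⊆ e∈)
        apart {zero , suc y}  {zero , zero}   e∈ f∈ with () ← up (rest⊆ f∈)
        apart {zero , suc y}  {suc x , zero}  e∈ f∈ with () ← up (rest⊆ f∈)
        apart {suc x , suc y} {zero , zero}   e∈ f∈ with () ← up (rest⊆ f∈)
        apart {suc x , suc y} {suc x′ , zero} e∈ f∈ with () ← up (rest⊆ f∈)

      -- A violation lifts to `L`. The vertex `c` is not `b`, and `b` is not between `a` and `c`,
      -- since `ad` would pass over `b`. If `c < b` or `b < a`, the pairs lift as they are. If `a`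
      -- is `b`, each of `ad` and `ax` comes from `b` or from 0: when only `ad` comes from 0, the
      -- walk is prolonged by the edge from 0 to `b`; when only `ax` does, the two edges cross.
      saturated′ : ∀ {a x c d} → (a , d) ∈ contracted → (a , x) ∈ contracted → Climb contracted x c → c Fin.< d →
                   Quotient G b c d → ¬ Free contracted c d
      saturated′ {a} {x} {c} {d} ad ax p c<d g free = proceed g (Fin.<-cmp c b)
        where
        a<c : a Fin.< c
        a<c = ℕ.<-≤-trans (up′ ax) (climb′-≤ p)
        above : b Fin.< c → G (suc c) (suc d) → ⊥
        above b<c g with Fin.<-cmp a b
        ... | tri< a<b _ _ = over-base ad a<b (ℕ.<-trans b<c c<d)
        ... | tri> _ _ b<a = saturated (lower-plain ad a≢b) (lower-plain ax a≢b)
                (lower-climb (inj₁ (ℕ.<-trans b<a (up′ ax))) p) (s≤s c<d) g (lower-free (inj₁ b<c) free)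
          where
          a≢b : a ≢ b
          a≢b e = ℕ.<⇒≢ b<a (cong toℕ (sym e))
        ... | tri≈ _ refl _ with lower ad | lower ax
        ...   | inj₁ bd           | inj₁ bx           = saturated bd bx
                  (lower-climb (inj₁ (up′ ax)) p) (s≤s c<d) g (lower-free (inj₁ b<c) free)
        ...   | inj₂ (_ , _ , 0d) | inj₂ (_ , _ , 0x) = saturated 0d 0x
                  (lower-climb (inj₁ (up′ ax)) p) (s≤s c<d) g (lower-free (inj₁ b<c) free)
        ...   | inj₂ (_ , _ , 0d) | inj₁ bx           = saturated 0d base
                  (bx ◅ lower-climb (inj₁ (up′ ax)) p) (s≤s c<d) g (lower-free (inj₁ b<c) free)
        ...   | inj₁ bd           | inj₂ (_ , b<x , 0x) = uncrossed 0x bd (s≤s z≤n) (s≤s b<x)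
                  (s≤s (ℕ.≤-<-trans (climb′-≤ p) c<d))
        at-base : c ≡ b → ⊥
        at-base refl = over-base ad a<c c<d
        proceed : Quotient G b c d → Tri (c Fin.< b) (c ≡ b) (b Fin.< c) → ⊥
        proceed (inj₂ (c≡b , _)) _ = at-base c≡b
        proceed (inj₁ g) (tri≈ _ c≡b _) = at-base c≡b
        proceed (inj₁ g) (tri> _ _ b<c) = above b<c g
        proceed (inj₁ g) (tri< c<b _ _) = saturated (lower-plain ad a≢b) (lower-plain ax a≢b)
          (lower-climb (inj₂ c<b) p) (s≤s c<d) g (lower-free (inj₂ (ℕ.≮⇒≥ (over-base ad a<b))) free)
          where
          a<b = ℕ.<-trans a<c c<b
          a≢b : a ≢ b
          a≢b e = ℕ.<⇒≢ a<b (cong toℕ e)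

    reduced-contracted : Reduced (Quotient G b) contracted
    reduced-contracted = record
      { up        = up′
      ; inside    = λ e∈ → case lower e∈ of λ
          { (inj₁ e) → inj₁ (inside e) ; (inj₂ (u≡b , b<v , e)) → inj₂ (u≡b , b<v , inside e) }
      ; uncrossed = uncrossed′
      ; linked    = linked′
      ; saturated = saturated′
      ; unique    = unique′ }

  module _ {G : Rel (Fin (2 ℕ.+ n)) 0ℓ} {L M} (r : Reduced G L) (s : Step L) (r′ : Reduced G M) (s′ : Step M)
           (same : ∀ {e} → e ∈ Step.contracted s → e ∈ Step.contracted s′)
           (same⁻ : ∀ {e} → e ∈ Step.contracted s′ → e ∈ Step.contracted s) where

    private
      module S = Step s
      module S′ = Step s′
      module L = Reduced r
      module M = Reduced r′

    -- If bv is in L and 0v is in M, then 0v and 0b saturate M at bv unless some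
    -- 0j with b < j < v crosses bv, and then j is a smaller instance.
    no-exchange : ∀ v → Acc ℕ._<_ (toℕ v) → (suc b , suc v) ∈ L → ¬ (zero , suc v) ∈ M
    no-exchange v (acc rec) bv 0v = M.saturated 0v S′.base ε b<v (L.inside bv) free
      where
      b<v = L.up bv
      free : Free M (suc b) (suc v)
      free {u} {w} e∈ = crossˡ u w e∈ , λ (b<u , u<v , v<w) → M.uncrossed 0v e∈ (ℕ.<-trans (s≤s z≤n) b<u) u<v v<w
        where
        crossˡ : ∀ u w → (u , w) ∈ M → ¬ (u Fin.< suc b × suc b Fin.< w × w Fin.< suc v)
        crossˡ (suc u) w       e∈ (u<b , b<w , _) = M.uncrossed S′.base e∈ (s≤s z≤n) u<b b<w
        crossˡ zero    (suc j) e∈ (_ , b<j , j<v)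
          with lower r s (same⁻ (S′.lift-zero e∈ λ { refl → ℕ.<-irrefl refl b<j }))
        ... | inj₁ bj           = no-exchange j (rec (ℕ.≤-pred j<v)) bj e∈
        ... | inj₂ (_ , _ , 0j) = L.uncrossed 0j bv (s≤s z≤n) b<j j<v

  module _ {G : Rel (Fin (2 ℕ.+ n)) 0ℓ} {L M} (r : Reduced G L) (s : Step L) (r′ : Reduced G M) (s′ : Step M)
           (same : ∀ {e} → e ∈ Step.contracted s → e ∈ Step.contracted s′)
           (same⁻ : ∀ {e} → e ∈ Step.contracted s′ → e ∈ Step.contracted s) where

    -- A contracted pair is ambiguous only when it starts at `b`: it may come from `b` or from 0.
    -- `no-exchange` excludes that `L` and `M` differ in this.
    contracted-injective : ∀ {e} → e ∈ L → e ∈ M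
    contracted-injective {u , zero} e∈ with () ← Reduced.up r e∈
    contracted-injective {suc u , suc v} e∈ with lower r′ s′ (same (Step.lift-plain s e∈))
    ... | inj₁ uv             = uv
    ... | inj₂ (refl , _ , 0v) = contradiction 0v (no-exchange r s r′ s′ same same⁻ v (<-wellFounded _) e∈)
    contracted-injective {zero , suc v} e∈ with v Fin.≟ b
    ... | yes refl = Step.base s′
    ... | no v≢b with lower r′ s′ (same (Step.lift-zero s e∈ v≢b))
    ...   | inj₂ (_ , _ , 0v) = 0v
    ...   | inj₁ bv = contradiction e∈ (no-exchange r′ s′ r s same⁻ same v (<-wellFounded _) bv)

open Contract using (Step; reduced-contracted; contracted-injective)

module _ {n : ℕ} where

  abstract

    step : ∀ {G : Rel (Fin (2 ℕ.+ n)) 0ℓ} {L} → Reduced G L → ∃[ b ] Step b L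
    step {G} {L} r = let (b , b∈ , minimal) = least (λ i → (zero , suc i) ∈? L) neighbour in b , make b b∈ minimal
      where
      open Reduced r
      neighbour : ∃[ i ] (zero , suc i) ∈ L
      neighbour with linked zero (suc zero)
      ... | inj₁ e∈ ◅ _ = from-zero _ e∈
        where
        from-zero : ∀ v → (zero , v) ∈ L → ∃[ i ] (zero , suc i) ∈ L
        from-zero zero    e∈ with () ← up e∈
        from-zero (suc i) e∈ = i , e∈
      ... | inj₂ e∈ ◅ _ with () ← up e∈
      make : ∀ b → (zero , suc b) ∈ L → (∀ {j} → (zero , suc j) ∈ L → b Fin.≤ j) → Step b L
      make b b∈ minimal with ∈.∈-∃++ b∈
      ... | P , Q , eq with allPairs-remove P (subst Unique eq unique)
      ...   | unique-rest , before , after = record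
        { rest        = P ++ Q
        ; split       = subst (_↭ (zero , suc b) ∷ P ++ Q) (sym eq) (shift (zero , suc b) P Q)
        ; absent      = λ e∈ → [ (λ e∈P → All.lookup before e∈P refl) , (λ e∈Q → All.lookup after e∈Q refl) ]′ (∈.∈-++⁻ P e∈)
        ; unique-rest = unique-rest
        ; minimal     = minimal }

code : ∀ {n} {G : Rel (Fin n) 0ℓ} {L} → Reduced G L → Choices n
code {zero}        r = tt
code {suc zero}    r = tt
code {suc (suc n)} r = let (b , s) = step r in b , code (reduced-contracted b r s)

singleton-pairs : ∀ {n} {G : Rel (Fin n) 0ℓ} {L} → n ℕ.≤ 1 → Reduced G L → L ≡ []
singleton-pairs {L = []} _ _ = refl
singleton-pairs {zero} {L = (() , _) ∷ _} _ _
singleton-pairs {suc zero} {L = (zero , zero) ∷ _} _ r with () ← Reduced.up r (here refl)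
singleton-pairs {suc (suc n)} (s≤s ()) _

code-value : ∀ {n} {G : Rel (Fin n) 0ℓ} {L} (r : Reduced G L) → value (code r) L ≡ 1ℚ
code-value {zero}        r rewrite singleton-pairs z≤n r = refl
code-value {suc zero}    r rewrite singleton-pairs (s≤s z≤n) r = refl
code-value {suc (suc n)} r =
  trans (Merged.value-with (model (code r′)) b split (All.tabulate (Reduced.up r ∘ rest⊆)) absent) (code-value r′)
  where
  b  = proj₁ (step r)
  r′ = reduced-contracted b r (proj₂ (step r))
  open Step (proj₂ (step r))

Triangular : ℕ → Set₁
Triangular n = ∀ {G : Rel (Fin n) 0ℓ} {L M} (r : Reduced G L) (r′ : Reduced G M) →
               value (code r) M ≢ 0ℚ → code r′ <ᶜ code r ⊎ code r′ ≡ code r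

-- A nonzero value requires the letter from 0 to `b` in `M`, so the least neighbour of 0 in `M` is
-- at most `b`. If it equals `b`, both trees are contracted along the same edge and the induction
-- applies.
triangular-step : ∀ {n} → Triangular (suc n) → Triangular (2 ℕ.+ n)
triangular-step ih {M = M} r r′ ≢0 with step r | step r′
... | b , s | b′ , s′ with (zero , suc b) ∈? M
...   | no b∉ = contradiction (Merged.value-without (model (code (reduced-contracted b r s))) b (Reduced.up-all r′) b∉) ≢0
...   | yes b∈ with Fin.<-cmp b′ b
...     | tri< b′<b _ _ = inj₁ (inj₁ b′<b)
...     | tri> _ _ b<b′ = contradiction (Step.minimal s′ b∈) (ℕ.<⇒≱ b<b′)
...     | tri≈ _ refl _ with ih (reduced-contracted b r s) (reduced-contracted b r′ s′)
            (≢0 ∘ trans (Merged.value-with (model (code (reduced-contracted b r s))) b (Step.split s′)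
                          (All.tabulate (Reduced.up r′ ∘ Step.rest⊆ s′)) (Step.absent s′)))
...       | inj₁ lt = inj₁ (inj₂ (refl , lt))
...       | inj₂ eq = inj₂ (cong (b ,_) eq)

code-triangular : ∀ {n} → Triangular n
code-triangular {zero}        r r′ _ = inj₂ refl
code-triangular {suc zero}    r r′ _ = inj₂ refl
code-triangular {suc (suc n)}        = triangular-step (code-triangular {suc n})

Injective-codes : ℕ → Set₁
Injective-codes n = ∀ {G : Rel (Fin n) 0ℓ} {L M} (r : Reduced G L) (r′ : Reduced G M) →
                    code r ≡ code r′ → ∀ {e} → e ∈ L → e ∈ M

injective-step : ∀ {n} → Injective-codes (suc n) → Injective-codes (2 ℕ.+ n)
injective-step ih r r′ eq with step r | step r′
... | b , s | b′ , s′ with ,-injective eq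
...   | refl , eq′ = contracted-injective b r s r′ s′
          (ih (reduced-contracted b r s) (reduced-contracted b r′ s′) eq′)
          (ih (reduced-contracted b r′ s′) (reduced-contracted b r s) (sym eq′))

code-injective : ∀ {n} → Injective-codes n
code-injective {zero}        r r′ _ {() , _}
code-injective {suc zero}    r r′ _ {zero , zero} e∈ with () ← Reduced.up r e∈
code-injective {suc (suc n)}        = injective-step (code-injective {suc n})

-- Linear independence

snoc : ∀ {A : Set} {m} → (Fin m → A) → A → Fin (suc m) → A
snoc {m = zero}  f d _       = d
snoc {m = suc m} f d zero    = f zero
snoc {m = suc m} f d (suc p) = snoc (f ∘ suc) d p

snoc-inject₁ : ∀ {A : Set} {m} (f : Fin m → A) d p → snoc f d (inject₁ p) ≡ f p
snoc-inject₁ f d zero    = refl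
snoc-inject₁ f d (suc p) = snoc-inject₁ (f ∘ suc) d p

snoc-last : ∀ {A : Set} {m} (f : Fin m → A) d → snoc f d (fromℕ m) ≡ d
snoc-last {m = zero}  f d = refl
snoc-last {m = suc m} f d = snoc-last (f ∘ suc) d

snoc-steps : ∀ {A : Set} {S : Rel A 0ℓ} {m} (f : Fin (suc m) → A) d → (∀ j → S (f (inject₁ j)) (f (suc j))) →
             S (f (fromℕ m)) d → ∀ j → S (snoc f d (inject₁ j)) (snoc f d (suc j))
snoc-steps {m = zero} f d steps last zero = last
snoc-steps {m = suc m} f d steps last zero = steps zero
snoc-steps {S = S} {suc m} f d steps last (suc j) = snoc-steps {S = S} (f ∘ suc) d (steps ∘ suc) last j

module _ {n : ℕ} where

  steps-≤ : ∀ {m} (f : Fin (suc m) → Fin n) → (∀ j → f (inject₁ j) Fin.< f (suc j)) → ∀ q → f zero Fin.≤ f q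
  steps-≤ f up zero                = ℕ.≤-refl
  steps-≤ {suc m} f up (suc q) = ℕ.≤-trans (ℕ.<⇒≤ (up zero)) (steps-≤ (f ∘ suc) (up ∘ suc) q)

  steps⇒increasing : ∀ {m} (f : Fin (suc m) → Fin n) → (∀ j → f (inject₁ j) Fin.< f (suc j)) → Increasing f
  steps⇒increasing {suc m} f up {zero}  {suc q} _         = ℕ.<-≤-trans (up zero) (steps-≤ (f ∘ suc) (up ∘ suc) q)
  steps⇒increasing {suc m} f up {suc p} {suc q} (s≤s p<q) = steps⇒increasing (f ∘ suc) (up ∘ suc) p<q

  -- The sequence of the reducedness condition: an increasing walk from `a` to `c` followed by `d`.
  -- The chord `ad` and the last side `cd` are left free.
  record Polygon (R : Rel (Fin n) 0ℓ) (a c d : Fin n) : Set where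
    field
      {k}        : ℕ
      i          : Fin (3 ℕ.+ k) → Fin n
      increasing : Increasing i
      first≡     : i zero ≡ a
      corner≡    : i (inject₁ (lastSide {k})) ≡ c
      last≡      : i (fromℕ (2 ℕ.+ k)) ≡ d
      sides      : ∀ j → R (i (inject₁ (inject₁ j))) (i (suc (inject₁ j)))

  polygon : ∀ {R : Rel (Fin n) 0ℓ} → (∀ {u v} → R u v → u Fin.< v) →
            ∀ {a x c d} → R a x → Star R x c → c Fin.< d → Polygon R a c d
  polygon {R} up {a} {x} {c} {d} ax p c<d with simple-path (ax ◅ p)
  ... | record { size = zero ; start = refl ; end = refl } = ⊥-elim (ℕ.<⇒≱ (up ax) (climb p))
    where
    climb : ∀ {x c} → Star R x c → x Fin.≤ c
    climb ε       = ℕ.≤-refl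
    climb (l ◅ p) = ℕ.≤-trans (ℕ.<⇒≤ (up l)) (climb p)
  ... | record { size = suc k ; vertex = f ; start = start ; end = end ; steps = steps } = record
    { i          = snoc f d
    ; increasing = steps⇒increasing (snoc f d) (snoc-steps {S = Fin._<_} f d (up ∘ steps) (subst (Fin._< d) (sym end) c<d))
    ; first≡     = start
    ; corner≡    = trans (snoc-inject₁ f d (fromℕ (suc k))) end
    ; last≡      = snoc-last f d
    ; sides      = λ j → subst₂ R (sym (snoc-inject₁ f d (inject₁ j))) (sym (snoc-inject₁ f d (suc j))) (steps j) }

  pairs : Monomial n → List (Fin n × Fin n)
  pairs = List.map λ g → src g , tgt g

  pairs-∈ : ∀ {W u v} → (u , v) ∈ pairs W → ∃[ g ] g ∈ W × u ≡ src g × v ≡ tgt g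
  pairs-∈ e∈ with ∈.∈-map⁻ (λ g → src g , tgt g) e∈
  ... | g , g∈ , refl = g , g∈ , refl , refl

  module _ (T : NoncrossingTree n) (o : EdgeOrder T) where
    open NoncrossingTree T
    private
      W = EdgeOrder.word o

    edge⇒pair : ∀ {u v} → Adj graph u v → u Fin.< v → (u , v) ∈ pairs W
    edge⇒pair {u} {v} a u<v = ∈.∈-map⁺ (λ g → src g , tgt g)
      (Equivalence.from (EdgeOrder.edges o (gen u v λ { refl → ℕ.<-irrefl refl u<v })) (u<v , a))

    pair⇒edge : ∀ {u v} → (u , v) ∈ pairs W → u Fin.< v × Adj graph u v
    pair⇒edge e∈ with pairs-∈ {W} e∈
    ... | g , g∈ , refl , refl = Equivalence.to (EdgeOrder.edges o g) g∈

    pairs-up : ∀ {u v} → (u , v) ∈ pairs W → u Fin.< v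
    pairs-up = proj₁ ∘ pair⇒edge

    free⇒noncrossing : ∀ {c d} → c Fin.< d → Free (pairs W) c d → Noncrossing λ u v → Adj graph u v ⊎ Joins c d u v
    free⇒noncrossing c<d free p q r (inj₁ e) (inj₁ f) = noncrossing p q r e f
    free⇒noncrossing c<d free p q r (inj₁ e) (inj₂ (inj₁ (refl , refl))) = proj₁ (free (edge⇒pair e (ℕ.<-trans p q))) (p , q , r)
    free⇒noncrossing c<d free p q r (inj₁ e) (inj₂ (inj₂ (refl , refl))) = ℕ.<-asym c<d (ℕ.<-trans q r)
    free⇒noncrossing c<d free p q r (inj₂ (inj₁ (refl , refl))) (inj₁ f) = proj₂ (free (edge⇒pair f (ℕ.<-trans q r))) (p , q , r)
    free⇒noncrossing c<d free p q r (inj₂ (inj₂ (refl , refl))) (inj₁ f) = ℕ.<-asym c<d (ℕ.<-trans p q)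
    free⇒noncrossing c<d free p q r (inj₂ (inj₁ (refl , refl))) (inj₂ (inj₁ (refl , _))) = ℕ.<-irrefl refl p
    free⇒noncrossing c<d free p q r (inj₂ (inj₁ (refl , refl))) (inj₂ (inj₂ (refl , _))) = ℕ.<-irrefl refl q
    free⇒noncrossing c<d free p q r (inj₂ (inj₂ (refl , refl))) (inj₂ e) = ℕ.<-asym c<d (ℕ.<-trans p q)

    noncrossing⇒free : ∀ {c d} → (Noncrossing λ u v → Adj graph u v ⊎ Joins c d u v) → Free (pairs W) c d
    noncrossing⇒free nx e∈ =
      let (_ , e) = pair⇒edge e∈ in
      (λ (p , q , r) → nx p q r (inj₁ e) (inj₂ (inj₁ (refl , refl)))) ,
      (λ (p , q , r) → nx p q r (inj₂ (inj₁ (refl , refl))) (inj₁ e))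

  reduced-pairs : ∀ {G : Graph n} (T : ReducedTree G) (o : EdgeOrder (ReducedTree.tree T)) →
                  Reduced (Adj G) (pairs (EdgeOrder.word o))
  reduced-pairs {G} T o = record
    { up        = up
    ; inside    = λ e∈ → inside _ _ (proj₂ (pair⇒edge tree o e∈))
    ; uncrossed = λ ac bd p q r → noncrossing p q r (proj₂ (pair⇒edge tree o ac)) (proj₂ (pair⇒edge tree o bd))
    ; linked    = λ u v → Star.map link (connected u v)
    ; saturated = λ ad ax p c<d g free → let open Polygon (polygon up ax p c<d) in
        reduced i increasing
          (λ { (inj₁ (refl , refl)) → subst₂ (Adj graph) (sym first≡) (sym last≡) (edge ad)
             ; (inj₂ (refl , refl)) → Graph.symm graph (subst₂ (Adj graph) (sym first≡) (sym last≡) (edge ad)) })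
          (λ j → λ { (inj₁ (refl , refl)) → edge (sides j)
                   ; (inj₂ (refl , refl)) → Graph.symm graph (edge (sides j)) })
          (λ { (inj₁ (refl , refl)) → subst₂ (Adj G) (sym corner≡) (sym last≡) g
             ; (inj₂ (refl , refl)) → Graph.symm G (subst₂ (Adj G) (sym corner≡) (sym last≡) g) })
          (subst₂ (λ c d → Noncrossing (λ u v → Adj graph u v ⊎ Joins c d u v)) (sym corner≡) (sym last≡)
            (λ {a} {b} {c} {d} → free⇒noncrossing tree o c<d free {a} {b} {c} {d}))
    ; unique    = AllPairs.map⁺ (AllPairs.map (λ g≢h e → g≢h (same e)) (EdgeOrder.once o)) }
    where
    open ReducedTree T
    up : ∀ {u v} → (u , v) ∈ pairs (EdgeOrder.word o) → u Fin.< v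
    up = pairs-up tree o
    edge : ∀ {u v} → (u , v) ∈ pairs (EdgeOrder.word o) → Adj graph u v
    edge = proj₂ ∘ pair⇒edge tree o
    link : ∀ {u v} → Adj graph u v → (u , v) ∈ pairs (EdgeOrder.word o) ⊎ (v , u) ∈ pairs (EdgeOrder.word o)
    link {u} {v} a with Fin.<-cmp u v
    ... | tri< u<v _ _  = inj₁ (edge⇒pair tree o a u<v)
    ... | tri≈ _ refl _ = contradiction a (Graph.irrefl graph)
    ... | tri> _ _ v<u  = inj₂ (edge⇒pair tree o (Graph.symm graph a) v<u)
    same : ∀ {g h : Generator n} → (src g , tgt g) ≡ (src h , tgt h) → g ≡ h
    same refl = refl

module Independence {n : ℕ} (G : Graph n) (order : (T : NoncrossingTree n) → EdgeOrder T) where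
  open TreeProducts G order
  open Formal (reducedDecSetoid G)
  open FormalProperties (reducedDecSetoid G)

  private
    word : ReducedTree G → Monomial n
    word T = EdgeOrder.word (order (ReducedTree.tree T))

    reduced-word : ∀ T → Reduced (Adj G) (pairs (word T))
    reduced-word T = reduced-pairs T (order (ReducedTree.tree T))

    code-of : ReducedTree G → Choices n
    code-of T = code (reduced-word T)

    same-code : ∀ T T′ → code-of T ≡ code-of T′ → ReducedTree.graph T ≐ᴳ ReducedTree.graph T′
    same-code T T′ eq = include T T′ eq , include T′ T (sym eq)
      where
      include : ∀ T T′ → code-of T ≡ code-of T′ → ReducedTree.graph T ⊆ᴳ ReducedTree.graph T′
      include T T′ eq u v a with Fin.<-cmp u v
      ... | tri< u<v _ _  = proj₂ (pair⇒edge _ (order (ReducedTree.tree T′))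
              (code-injective (reduced-word T) (reduced-word T′) eq (edge⇒pair _ (order (ReducedTree.tree T)) a u<v)))
      ... | tri≈ _ refl _ = contradiction a (Graph.irrefl (ReducedTree.graph T))
      ... | tri> _ _ v<u  = Graph.symm (ReducedTree.graph T′) (proj₂ (pair⇒edge _ (order (ReducedTree.tree T′))
              (code-injective (reduced-word T) (reduced-word T′) eq
                (edge⇒pair _ (order (ReducedTree.tree T)) (Graph.symm (ReducedTree.graph T) a) v<u))))

    module At (p : Choices n) where
      open Model (model p) using (top; top-cong; top-+; top-*; evaluate; evaluate-cong; evaluate-∏; weight-resp; scalar-0; module R)

      f : ReducedTree G → ℚ
      f T = value p (pairs (word T))

      f-cong : ∀ {T T′} → ReducedTree.graph T ≐ᴳ ReducedTree.graph T′ → f T ≡ f T′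
      f-cong {T} {T′} T≐T′ = top-cong (weight-resp (↭-map⁺ (λ g → src g , tgt g)
        (∼⇒↭ (edgeOrder-unique T≐T′ (order (ReducedTree.tree T)) (order (ReducedTree.tree T′))))))

      -- Coefficients multiplied by the values of the functional; their sum is the functional at
      -- `⟦ c ⟧ xʳ`. In this form the sum can be computed from collected coefficients.
      scale : Comb (ReducedTree G) → Comb (ReducedTree G)
      scale = List.map λ (q , T) → q ℚ.* f T , T

      module ℚ-linear = Linear (TensorUnit.leftModule {R = ℚ.+-*-ring})

      top-0 : top (evaluate (ι 0ℚ)) ≡ 0ℚ
      top-0 = trans (top-cong (R.trans scalar-0 (R.sym (R.zeroʳ _)))) (trans (top-* 0ℚ R.0#) (ℚ.*-zeroˡ (top R.0#)))

      top-eval : ∀ c → top (evaluate (⟦ c ⟧ xʳ)) ≡ ℚ-linear.⟦ scale c ⟧ (λ _ → 1ℚ)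
      top-eval []            = top-0
      top-eval ((q , T) ∷ c) = trans (top-+ _ _) (cong₂ ℚ._+_
        (trans (top-* q _) (trans (cong (q ℚ.*_) (top-cong (evaluate-∏ (word T)))) (sym (ℚ.*-identityʳ _))))
        (top-eval c))

  -- Apply the functional of the code of `T`. A tree with another graph contributes 0: its value is
  -- 0, or its code is smaller and its coefficient vanishes by induction, or its code is equal,
  -- which forces the graph of `T`. What remains is the coefficient of `T` times 1.
  coeff-zero : ∀ c → ⟦ c ⟧ xʳ ≈ ι 0ℚ → ∀ T → Acc _<ᶜ_ (code-of T) → coeff c T ≡ 0ℚ
  coeff-zero c z T (acc rec) = begin
    coeff c T                                        ≡⟨ ℚ.+-identityʳ _ ⟨
    coeff c T ℚ.+ 0ℚ                                 ≡⟨ cong (ℚ._+ 0ℚ) (ℚ.*-identityʳ (coeff c T)) ⟨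
    ℚ-linear.⟦ (coeff c T , T) ∷ [] ⟧ (λ _ → 1ℚ)     ≡⟨ Evaluation.⟦⟧-cong TensorUnit.leftModule (λ _ → 1ℚ) (λ _ → refl) {scale c} {(coeff c T , T) ∷ []} concentrated ⟨
    ℚ-linear.⟦ scale c ⟧ (λ _ → 1ℚ)                  ≡⟨ top-eval c ⟨
    top (evaluate (⟦ c ⟧ xʳ))                        ≡⟨ top-cong (evaluate-cong z) ⟩
    top (evaluate (ι 0ℚ))                            ≡⟨ top-0 ⟩
    0ℚ                                               ∎
    where
    open ≡-Reasoning
    p = code-of T
    open At p
    open Model (model p) using (top; top-cong; evaluate; evaluate-cong)
    open DecSetoid (reducedDecSetoid G) using (_≟_)
    fT≡1 : f T ≡ 1ℚ
    fT≡1 = code-value (reduced-word T)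
    elsewhere : ∀ T′ → ¬ (ReducedTree.graph T ≐ᴳ ReducedTree.graph T′) → coeff c T′ ℚ.* f T′ ≡ 0ℚ
    elsewhere T′ T≢T′ with f T′ ℚ.≟ 0ℚ
    ... | yes f≡0 = trans (cong (coeff c T′ ℚ.*_) f≡0) (ℚ.*-zeroʳ (coeff c T′))
    ... | no f≢0 with code-triangular (reduced-word T) (reduced-word T′) f≢0
    ...   | inj₁ lt = trans (cong (ℚ._* f T′) (coeff-zero c z T′ (rec lt))) (ℚ.*-zeroˡ (f T′))
    ...   | inj₂ eq = contradiction (same-code T T′ (sym eq)) T≢T′
    concentrated : scale c ≋ ((coeff c T , T) ∷ [])
    concentrated T′ = trans (coeff-map f (λ {T} {T′} → f-cong {T} {T′}) c T′) (at T′ (T ≟ T′))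
      where
      at : ∀ T′ → Dec (ReducedTree.graph T ≐ᴳ ReducedTree.graph T′) → coeff c T′ ℚ.* f T′ ≡ coeff ((coeff c T , T) ∷ []) T′
      at T′ (yes e) = trans (cong₂ ℚ._*_ (sym (coeff-cong c {T} {T′} e)) (trans (sym (f-cong {T} {T′} e)) fT≡1))
        (trans (ℚ.*-identityʳ (coeff c T)) (sym (trans (coeff-here (coeff c T) [] {T} {T′} e) (ℚ.+-identityʳ _))))
      at T′ (no ¬e) = trans (elsewhere T′ ¬e) (sym (coeff-there (coeff c T) [] {T} {T′} ¬e))

  independent : ∀ c → ⟦ c ⟧ xʳ ≈ ι 0ℚ → c ≋ []
  independent c z T = coeff-zero c z T (<ᶜ-wellFounded _)

-- Reducible trees

module _ {n : ℕ} where

  onCycle? : ∀ {k} (i : Fin (3 ℕ.+ k) → Fin n) u v → Dec (OnCycle i u v)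
  onCycle? i u v = joins? _ _ u v ⊎-dec Fin.any? λ j → joins? (i (inject₁ j)) (i (suc j)) u v

  module _ {t : Rel (Fin n) 0ℓ} (t-sym : Symmetric t) (t-acyclic : Acyclic t) {c d : Fin n} where

    private
      H : Rel (Fin n) 0ℓ
      H u v = t u v ⊎ Joins c d u v

    through-edge : ∀ {k} (i : Fin (3 ℕ.+ k) → Fin n) → IsCycle H i → OnCycle i c d
    through-edge i (inj , on) with onCycle? i c d
    ... | yes cd = cd
    ... | no ¬cd = contradiction ((λ {p} {q} → inj {p} {q}) , λ {u} {v} → kept {u} {v}) (t-acyclic i)
      where
      kept : OnCycle i ⊑ t
      kept o with on o
      ... | inj₁ e                    = e
      ... | inj₂ (inj₁ (refl , refl)) = contradiction o ¬cd
      ... | inj₂ (inj₂ (refl , refl)) = contradiction (onCycle-sym i inj o) ¬cd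

    -- Suppose `uv` is on `i′` but not on `i`. It is an edge of the tree `t`, because `cd` is on
    -- `i`. The rest of `i′`, with `cd` rerouted along the rest of `i`, is then a detour around `uv`
    -- inside `t`.
    cycles-agree : ∀ {k l} (i : Fin (3 ℕ.+ k) → Fin n) (i′ : Fin (3 ℕ.+ l) → Fin n) →
                   IsCycle H i → IsCycle H i′ → ∀ {u v} → OnCycle i′ u v → OnCycle i u v
    cycles-agree i i′ cyc@(inj , on) cyc′@(inj′ , on′) {u} {v} o′ with onCycle? i u v
    ... | yes o = o
    ... | no ¬o = contradiction (Star.kleisliStar id reroute (around i′ inj′ o′)) (no-detour t-sym t-acyclic u≢v uv)
      where
      cd : OnCycle i c d
      cd = through-edge i cyc
      uv : t u v
      uv with on′ o′
      ... | inj₁ e                    = e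
      ... | inj₂ (inj₁ (refl , refl)) = contradiction cd ¬o
      ... | inj₂ (inj₂ (refl , refl)) = contradiction (onCycle-sym i inj cd) ¬o
      u≢v : u ≢ v
      u≢v refl = loop o′
        where
        loop : ∀ {u} → ¬ OnCycle i′ u u
        loop (inj₁ (inj₁ (refl , e)))     with () ← inj′ e
        loop (inj₁ (inj₂ (refl , e)))     with () ← inj′ e
        loop (inj₂ (j , inj₁ (refl , e))) = inject₁≢suc (inj′ e)
        loop (inj₂ (j , inj₂ (refl , e))) = inject₁≢suc (sym (inj′ e))
      S : Rel (Fin n) 0ℓ
      S x y = t x y × ¬ Joins u v x y
      S-sym : Symmetric S
      S-sym (e , ¬e) = t-sym e , ¬e ∘ joins-sym
      kept : ∀ {x y} → Rest i inj c d x y → S x y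
      kept {x} {y} (o , ¬cd) = [ id , (λ e → contradiction e ¬cd) ]′ (on o) , λ
        { (inj₁ (refl , refl)) → ¬o o ; (inj₂ (refl , refl)) → ¬o (onCycle-sym i inj o) }
      reroute : ∀ {x y} → Rest i′ inj′ u v x y → Star S x y
      reroute (o , ¬uv) with on′ o
      ... | inj₁ e                    = (e , ¬uv) ◅ ε
      ... | inj₂ (inj₁ (refl , refl)) = Star.map kept (around i inj cd)
      ... | inj₂ (inj₂ (refl , refl)) = Star.reverse S-sym (Star.map kept (around i inj cd))

  add-edge : (t : Graph n) {c d : Fin n} → c ≢ d → Graph n
  add-edge t {c} {d} c≢d = record
    { adj    = λ u v → isYes (edge? u v)
    ; symm   = λ {u} {v} a → fromWitness {a? = edge? v u} (Sum.map (Graph.symm t) joins-sym (toWitness {a? = edge? u v} a))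
    ; irrefl = λ {u} a → case toWitness {a? = edge? u u} a of λ
        { (inj₁ a)                    → Graph.irrefl t a
        ; (inj₂ (inj₁ (refl , refl))) → c≢d refl
        ; (inj₂ (inj₂ (refl , refl))) → c≢d refl } }
    where
    edge? : ∀ u v → Dec (Adj t u v ⊎ Joins c d u v)
    edge? u v = T? (Graph.adj t u v) ⊎-dec joins? c d u v

  adj-add-edge : ∀ (t : Graph n) {c d} (c≢d : c ≢ d) {u v} → Adj (add-edge t c≢d) u v ⇔ (Adj t u v ⊎ Joins c d u v)
  adj-add-edge t {c} {d} c≢d {u} {v} = mk⇔ (toWitness {a? = e?}) (fromWitness {a? = e?})
    where e? = T? (Graph.adj t u v) ⊎-dec joins? c d u v

  -- Steps lead upwards, so the search for a continuation ends.
  climb? : ∀ {L : List (Fin n × Fin n)} → (∀ {u v} → (u , v) ∈ L → u Fin.< v) → ∀ x c → Dec (Climb L x c)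
  climb? {L} up x c = go x (Fin->-wellFounded x)
    where
    go : ∀ x → Acc Fin._>_ x → Dec (Climb L x c)
    go x (acc rec) = map′ to from (x Fin.≟ c ⊎-dec Fin.any? next?)
      where
      next? : ∀ y → Dec ((x , y) ∈ L × Climb L y c)
      next? y with (x , y) ∈? L
      ... | no ∉  = no (∉ ∘ proj₁)
      ... | yes e = map′ (e ,_) proj₂ (go y (rec (up e)))
      to : x ≡ c ⊎ (∃[ y ] (x , y) ∈ L × Climb L y c) → Climb L x c
      to (inj₁ refl)        = ε
      to (inj₂ (y , e , p)) = e ◅ p
      from : Climb L x c → x ≡ c ⊎ (∃[ y ] (x , y) ∈ L × Climb L y c)
      from ε       = inj₁ refl
      from (e ◅ p) = inj₂ (_ , e , p)

  free? : ∀ (L : List (Fin n × Fin n)) c d → Dec (Free L c d)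
  free? L c d = map′ (λ al {u} {v} e → All.lookup al e) (λ free → All.tabulate λ e → free e)
    (All.all? (λ (u , v) → ¬? (u Fin.<? c ×-dec c Fin.<? v ×-dec v Fin.<? d) ×-dec
                           ¬? (c Fin.<? u ×-dec u Fin.<? d ×-dec d Fin.<? v)) L)

  module _ {G : Graph n} (T : TreeIn G) where
    open TreeIn T

    private
      o : EdgeOrder tree
      o = tree-edgeOrder tree
      L : List (Fin n × Fin n)
      L = pairs (EdgeOrder.word o)
      up : ∀ {u v} → (u , v) ∈ L → u Fin.< v
      up = pairs-up tree o
      edge : ∀ {u v} → (u , v) ∈ L → Adj graph u v
      edge = proj₂ ∘ pair⇒edge tree o

    -- The failure of reducedness in terms of four vertices and an increasing walk, so that a finite
    -- search decides it.
    Violation : Set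
    Violation = ∃[ a ] ∃[ x ] ∃[ c ] ∃[ d ]
      (a , d) ∈ L × (a , x) ∈ L × Climb L x c × c Fin.< d × Adj G c d × Free L c d

    violation? : Dec Violation
    violation? = Fin.any? λ a → Fin.any? λ x → Fin.any? λ c → Fin.any? λ d →
      ((a , d) ∈? L) ×-dec ((a , x) ∈? L) ×-dec climb? up x c ×-dec (c Fin.<? d) ×-dec T? (Graph.adj G c d) ×-dec free? L c d

    no-violation⇒reduced : ¬ Violation → IsReduced G T
    no-violation⇒reduced ¬viol {k} i inc chord⊆ sides⊆ last⊆ nx = ¬viol
      ( i zero , i (suc zero) , i (inject₁ lastSide) , i (fromℕ (2 ℕ.+ k))
      , edge⇒pair tree o (chord⊆ (inj₁ (refl , refl))) (inc (s≤s z≤n))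
      , side zero
      , chain (i ∘ suc ∘ inject₁) (side ∘ suc)
      , last<
      , last⊆ (inj₁ (refl , refl))
      , noncrossing⇒free tree o (λ {a} {b} {c} {d} → nx {a} {b} {c} {d}) )
      where
      step< : ∀ j → i (inject₁ j) Fin.< i (suc j)
      step< j = inc (ℕ.≤-reflexive (cong suc (Fin.toℕ-inject₁ j)))
      last< = step< lastSide
      side : ∀ j → (i (inject₁ (inject₁ j)) , i (suc (inject₁ j))) ∈ L
      side j = edge⇒pair tree o (sides⊆ j (inj₁ (refl , refl))) (step< (inject₁ j))

    module _ {a c d} (P : Polygon (λ u v → (u , v) ∈ L) a c d) (ad : (a , d) ∈ L) (c<d : c Fin.< d)
             (g : Adj G c d) (free : Free L c d) where

      open Polygon P

      private
        c≢d : c ≢ d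
        c≢d refl = ℕ.<-irrefl refl c<d
        H : Graph n
        H = add-edge graph c≢d
        H-adj : ∀ {u v} → Adj H u v ⇔ (Adj graph u v ⊎ Joins c d u v)
        H-adj = adj-add-edge graph c≢d
        inj : Inj i
        inj = Increasing⇒Inj increasing

        chord⊆ : Chord i ⊑ Adj graph
        chord⊆ (inj₁ (refl , refl)) = subst₂ (Adj graph) (sym first≡) (sym last≡) (edge ad)
        chord⊆ (inj₂ (refl , refl)) = Graph.symm graph (subst₂ (Adj graph) (sym first≡) (sym last≡) (edge ad))

        sides⊆ : ∀ j → Side i (inject₁ j) ⊑ Adj graph
        sides⊆ j (inj₁ (refl , refl)) = edge (sides j)
        sides⊆ j (inj₂ (refl , refl)) = Graph.symm graph (edge (sides j))

        on : OnCycle i ⊑ (λ u v → Adj graph u v ⊎ Joins c d u v)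
        on (inj₁ ch) = inj₁ (chord⊆ ch)
        on (inj₂ (j , s)) with view j
        ... | ‵inject₁ j = inj₁ (sides⊆ j s)
        ... | ‵fromℕ     = inj₂ (subst₂ (λ c d → Joins c d _ _) corner≡ last≡ s)

        cycle : IsCycle (λ u v → Adj graph u v ⊎ Joins c d u v) i
        cycle = (λ {p} {q} → inj {p} {q}) , λ {u} {v} → on {u} {v}

        new : ¬ Adj graph c d
        new cd = acyclic i ((λ {p} {q} → inj {p} {q}) , λ o → case on o of λ
          { (inj₁ e) → e
          ; (inj₂ (inj₁ (refl , refl))) → cd
          ; (inj₂ (inj₂ (refl , refl))) → Graph.symm graph cd })

        from-H : ∀ {l} {i′ : Fin (3 ℕ.+ l) → Fin n} → IsCycle (Adj H) i′ → IsCycle (λ u v → Adj graph u v ⊎ Joins c d u v) i′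
        from-H (inj′ , on′) = (λ {p} {q} → inj′ {p} {q}) , λ o → Equivalence.to H-adj (on′ o)

      closed-relation : TreeRelation G
      closed-relation = record
        { i             = i
        ; increasing    = λ {p} {q} → increasing {p} {q}
        ; H             = H
        ; H⊆G           = λ u v a → case Equivalence.to H-adj a of λ
            { (inj₁ e)                    → inside u v e
            ; (inj₂ (inj₁ (refl , refl))) → g
            ; (inj₂ (inj₂ (refl , refl))) → Graph.symm G g }
        ; H-connected   = λ u v → Star.map (Equivalence.from H-adj ∘ inj₁) (connected u v)
        ; H-noncrossing = λ p q r e f → free⇒noncrossing tree o c<d free p q r (Equivalence.to H-adj e) (Equivalence.to H-adj f)
        ; H-cycle       = ((λ {p} {q} → inj {p} {q}) , λ o → Equivalence.from H-adj (on o)) , λ i′ cyc′ u v → mk⇔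
            (cycles-agree (Graph.symm graph) acyclic i i′ cycle (from-H cyc′))
            (cycles-agree (Graph.symm graph) acyclic i′ i (from-H cyc′) cycle)
        }

      closed-lhs : TreeIn.graph (TreeRelation.lhs closed-relation) ≐ᴳ graph
      closed-lhs =
        (λ u v a → case Equivalence.to (adj-∖ H {i (inject₁ lastSide)} {i (suc lastSide)}) a of λ (h , ¬s) →
          [ id , (λ cd → contradiction (subst₂ (λ c d → Joins c d u v) (sym corner≡) (sym last≡) cd) ¬s) ]′ (Equivalence.to H-adj h)) ,
        (λ u v a → Equivalence.from (adj-∖ H {i (inject₁ lastSide)} {i (suc lastSide)})
          (Equivalence.from H-adj (inj₁ a) , λ s → case subst₂ (λ c d → Joins c d u v) corner≡ last≡ s of λ
            { (inj₁ (refl , refl)) → new a ; (inj₂ (refl , refl)) → new (Graph.symm graph a) }))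

    reduced-or-lhs : IsReduced G T ⊎ (Σ[ R ∈ TreeRelation G ] TreeIn.graph (TreeRelation.lhs R) ≐ᴳ graph)
    reduced-or-lhs with violation?
    ... | no ¬viol = inj₁ (no-violation⇒reduced ¬viol)
    ... | yes (a , x , c , d , ad , ax , p , c<d , g , free) =
      let P = polygon up ax p c<d in inj₂ (closed-relation P ad c<d g free , closed-lhs P ad c<d g free)

-- Weights

module _ {n : ℕ} where

  letter-weight : Generator n → ℕ
  letter-weight g = toℕ (src g) ℕ.+ toℕ (tgt g)

  word-weight : Monomial n → ℕ
  word-weight = List.foldr (λ g s → letter-weight g ℕ.+ s) 0

  word-weight-resp : ∀ {P Q} → P ↭ Q → word-weight P ≡ word-weight Q
  word-weight-resp _↭_.refl                   = refl
  word-weight-resp (_↭_.prep g p)             = cong (letter-weight g ℕ.+_) (word-weight-resp p)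
  word-weight-resp (_↭_.swap {P} {Q} g h p)   =
    trans (sym (ℕ.+-assoc (letter-weight g) (letter-weight h) (word-weight P)))
      (trans (cong₂ ℕ._+_ (ℕ.+-comm (letter-weight g) (letter-weight h)) (word-weight-resp p))
             (ℕ.+-assoc (letter-weight h) (letter-weight g) (word-weight Q)))
  word-weight-resp (_↭_.trans p q)            = trans (word-weight-resp p) (word-weight-resp q)

  -- There are at most `n` letters, each of weight at most `n + n`.
  max-weight : ℕ
  max-weight = n ℕ.* (n ℕ.+ n)

  word-weight-≤ : ∀ P → word-weight P ℕ.≤ length P ℕ.* (n ℕ.+ n)
  word-weight-≤ []      = z≤n
  word-weight-≤ (g ∷ P) = ℕ.+-mono-≤ (ℕ.+-mono-≤ (ℕ.<⇒≤ (Fin.toℕ<n (src g))) (ℕ.<⇒≤ (Fin.toℕ<n (tgt g)))) (word-weight-≤ P)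

  weight : NoncrossingTree n → ℕ
  weight T = word-weight (EdgeOrder.word (tree-edgeOrder T))

  weight-≤ : ∀ T → weight T ℕ.≤ max-weight
  weight-≤ T = ℕ.≤-trans (word-weight-≤ W) (ℕ.*-monoˡ-≤ (n ℕ.+ n)
    (ℕ.≤-trans (ℕ.m≤n+m (length W) (n ℕ.⊓ 1)) (ℕ.≤-reflexive (TreeWord.size (word-treeWord T o)))))
    where
    o = tree-edgeOrder T
    W = EdgeOrder.word o

  weight-cong : ∀ {T T′ : NoncrossingTree n} → NoncrossingTree.graph T ≐ᴳ NoncrossingTree.graph T′ → weight T ≡ weight T′
  weight-cong {T} {T′} T≐T′ = word-weight-resp (∼⇒↭ (edgeOrder-unique T≐T′ (tree-edgeOrder T) (tree-edgeOrder T′)))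

  module _ {H : Graph n} where

    private
      Removed : NoncrossingTree n → Generator n → Set
      Removed T e = ∀ {u v} → Adj (NoncrossingTree.graph T) u v ⇔ (Adj H u v × ¬ Ends e u v)

      word-of : NoncrossingTree n → Monomial n
      word-of T = EdgeOrder.word (tree-edgeOrder T)

      completed : ∀ {T e} → Positive e → Adj H (src e) (tgt e) → Removed T e →
                  ∀ {g} → g ∈ e ∷ word-of T ⇔ (Positive g × Adj H (src g) (tgt g))
      completed {T} {e} pos a rem {g} = mk⇔
        (λ { (here refl) → pos , a
           ; (there g∈) → let (p , b) = Equivalence.to (EdgeOrder.edges o g) g∈ in p , proj₁ (Equivalence.to rem b) })
        (λ (p , b) → case joins? (src e) (tgt e) (src g) (tgt g) of λ
           { (yes e-g) → here (sym (positive-≡ {g = e} {g} pos p e-g))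
           ; (no ¬e)   → there (Equivalence.from (EdgeOrder.edges o g) (p , Equivalence.from rem (b , ¬e))) })
        where o = tree-edgeOrder T

      completed-unique : ∀ {T e} → Removed T e → Unique (e ∷ word-of T)
      completed-unique {T} {e} rem = All.tabulate (λ { g∈ refl → proj₂ (Equivalence.to rem
        (proj₂ (Equivalence.to (EdgeOrder.edges o e) g∈))) (self-ends e) }) ∷ EdgeOrder.once o
        where o = tree-edgeOrder T

    -- Adding the removed letter back gives the total weight of `H` for both trees, so the one
    -- without the heavier edge is lighter.
    weight-removed : ∀ {T T′ e e′} → Positive e → Adj H (src e) (tgt e) → Removed T e →
                     Positive e′ → Adj H (src e′) (tgt e′) → Removed T′ e′ →
                     letter-weight e′ ℕ.< letter-weight e → weight T ℕ.< weight T′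
    weight-removed {T} {T′} {e} {e′} pos a rem pos′ a′ rem′ lighter =
      ℕ.+-cancelˡ-< (letter-weight e) _ _ (ℕ.≤-<-trans (ℕ.≤-reflexive same) (ℕ.+-monoˡ-< (weight T′) lighter))
      where
      same : letter-weight e ℕ.+ weight T ≡ letter-weight e′ ℕ.+ weight T′
      same = word-weight-resp (∼bag⇒↭ (unique∧set⇒bag (completed-unique {T} {e} rem) (completed-unique {T′} {e′} rem′)
        λ {g} → mk⇔ (Equivalence.from (completed {T′} {e′} pos′ a′ rem′ {g}) ∘ Equivalence.to (completed {T} {e} pos a rem {g}))
                    (Equivalence.from (completed {T} {e} pos a rem {g}) ∘ Equivalence.to (completed {T′} {e′} pos′ a′ rem′ {g}))))

  module _ {G : Graph n} (R : TreeRelation G) where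
    open TreeRelation R

    rhs-trees : List (TreeIn G)
    rhs-trees = T₁ ∷ List.map (T₂₊ ∘ inject₁) (List.allFin (1 ℕ.+ k))

    private
      inj : Inj i
      inj = Increasing⇒Inj increasing
      last : Fin (3 ℕ.+ k)
      last = fromℕ (2 ℕ.+ k)
      chord-letter : Generator n
      chord-letter = gen (i 0F) (i last) λ e → case inj {0F} {last} e of λ ()
      chord-positive : Positive chord-letter
      chord-positive = increasing {0F} {last} (s≤s z≤n)

      below : ∀ {p q} → toℕ p ℕ.< toℕ q → toℕ (i p) ℕ.< toℕ (i q)
      below {p} {q} = increasing {p} {q}

      -- The left-hand side lacks the last side of the cycle, which joins its two largest vertices
      -- and so outweighs every other edge.
      lhs-lighter : ∀ {T e} → Positive e → Adj H (src e) (tgt e) →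
        (∀ {u v} → Adj (TreeIn.graph {G = G} T) u v ⇔ (Adj H u v × ¬ Ends e u v)) →
        letter-weight e ℕ.< letter-weight (side-letter i inj lastSide) → weight (TreeIn.tree lhs) ℕ.< weight (TreeIn.tree T)
      lhs-lighter {T} {e} pos a rem = weight-removed {H} {TreeIn.tree lhs} {TreeIn.tree T} {side-letter i inj lastSide} {e}
        (step-< R lastSide) (side-edge R lastSide) (adj-∖ H {i (inject₁ lastSide)} {i (suc lastSide)}) pos a rem

      weight-T₁ : weight (TreeIn.tree lhs) ℕ.< weight (TreeIn.tree T₁)
      weight-T₁ = lhs-lighter {T₁} {chord-letter} chord-positive (chord-edge R) (adj-∖ H {i 0F} {i last})
        (ℕ.+-mono-<-≤ (below {0F} {inject₁ lastSide} (s≤s z≤n)) ℕ.≤-refl)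

      weight-T₂₊ : ∀ j → weight (TreeIn.tree lhs) ℕ.< weight (TreeIn.tree (T₂₊ (inject₁ j)))
      weight-T₂₊ j = lhs-lighter {T₂₊ (inject₁ j)} {side-letter i inj (inject₁ j)}
        (step-< R (inject₁ j)) (side-edge R (inject₁ j)) (adj-∖ H {i (inject₁ (inject₁ j))} {i (suc (inject₁ j))})
        (ℕ.+-mono-< (below {inject₁ (inject₁ j)} {inject₁ lastSide} (subst₂ ℕ._<_ (sym (Fin.toℕ-inject₁ (inject₁ j))) (sym (Fin.toℕ-inject₁ lastSide)) j<last))
                    (below {suc (inject₁ j)} {last} (s≤s j<last)))
        where
        j<last : toℕ (inject₁ j) ℕ.< toℕ (lastSide {k})
        j<last = subst₂ ℕ._<_ (sym (Fin.toℕ-inject₁ j)) (sym (Fin.toℕ-fromℕ (suc k))) (Fin.toℕ<n j)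

    rhs-heavier : ∀ {T} → T ∈ rhs-trees → weight (TreeIn.tree lhs) ℕ.< weight (TreeIn.tree T)
    rhs-heavier (here refl) = weight-T₁
    rhs-heavier (there T∈) with ∈.∈-map⁻ (T₂₊ ∘ inject₁) T∈
    ... | j , _ , refl = weight-T₂₊ j

    rhs-support : ∀ {q T} → (q , T) ∈ rhs → T ∈ rhs-trees
    rhs-support (here refl) = here refl
    rhs-support (there qT∈) with ∈.∈-map⁻ (λ j → ℚ.- 1ℚ , T₂₊ (inject₁ j)) qT∈
    ... | j , j∈ , refl = there (∈.∈-map⁺ (T₂₊ ∘ inject₁) j∈)

    -- A cycle of `m` distinct vertices gives `m - 1` trees on the right.
    rhs-count : length rhs-trees ℕ.< n
    rhs-count = ℕ.≤-trans (ℕ.≤-reflexive (cong (λ m → 2 ℕ.+ m) (trans (length-map (T₂₊ ∘ inject₁) (List.allFin (1 ℕ.+ k))) (length-tabulate {n = 1 ℕ.+ k} id))))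
                          (Fin.injective⇒≤ {f = i} inj)

-- Formal rewriting

mapComb-⊛ : ∀ {A B : Set} (f : A → B) q c → mapComb f (q ⊛ c) ≡ q ⊛ mapComb f c
mapComb-⊛ f q []            = refl
mapComb-⊛ f q ((p , a) ∷ c) = cong ((q ℚ.* p , f a) ∷_) (mapComb-⊛ f q c)

-- Linear combinations over I modulo relations left R = right R, to be
-- expressed in the family f.
module Relations (I : DecSetoid 0ℓ 0ℓ) {A : Set} (left : A → DecSetoid.Carrier I)
                 (right : A → Comb (DecSetoid.Carrier I)) {B : Set} (f : B → DecSetoid.Carrier I) where
  open DecSetoid I using (Carrier; _≟_) renaming (_≈_ to _≃_; sym to ≃-sym; trans to ≃-trans)
  open Formal I
  open FormalProperties I
  open CommutativeSemigroupProperties (CommutativeMonoid.commutativeSemigroup ℚ.+-0-commutativeMonoid) using (interchange; x∙yz≈y∙xz)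
  open RingProperties ℚ.+-*-ring using (-‿involutive)
  private module F = Formal (On.decSetoid I f)

  relation : A → Comb Carrier
  relation R = (ℚ.- 1ℚ , left R) ∷ right R

  generated : Comb A → Comb Carrier
  generated = List.concatMap λ (q , R) → q ⊛ relation R

  coeff-generated-++ : ∀ ρ ρ′ T → coeff (generated (ρ ++ ρ′)) T ≡ coeff (generated ρ) T ℚ.+ coeff (generated ρ′) T
  coeff-generated-++ ρ ρ′ T =
    trans (cong (λ c → coeff c T) (concatMap-++ (λ (q , R) → q ⊛ relation R) ρ ρ′)) (coeff-++ (generated ρ) (generated ρ′) T)

  coeff-generated-⊛ : ∀ r ρ T → coeff (generated (r ⊛ ρ)) T ≡ r ℚ.* coeff (generated ρ) T
  coeff-generated-⊛ r []            T = sym (ℚ.*-zeroʳ r)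
  coeff-generated-⊛ r ((q , R) ∷ ρ) T = begin
    coeff ((r ℚ.* q) ⊛ relation R ++ generated (r ⊛ ρ)) T     ≡⟨ coeff-++ ((r ℚ.* q) ⊛ relation R) (generated (r ⊛ ρ)) T ⟩
    coeff ((r ℚ.* q) ⊛ relation R) T ℚ.+ coeff (generated (r ⊛ ρ)) T
      ≡⟨ cong₂ ℚ._+_ (coeff-⊛ (r ℚ.* q) (relation R) T) (coeff-generated-⊛ r ρ T) ⟩
    (r ℚ.* q) ℚ.* a ℚ.+ r ℚ.* g                               ≡⟨ trans (cong (ℚ._+ r ℚ.* g) (ℚ.*-assoc r q a)) (sym (ℚ.*-distribˡ-+ r (q ℚ.* a) g)) ⟩
    r ℚ.* (q ℚ.* a ℚ.+ g)                                     ≡⟨ cong (λ s → r ℚ.* (s ℚ.+ g)) (coeff-⊛ q (relation R) T) ⟨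
    r ℚ.* (coeff (q ⊛ relation R) T ℚ.+ g)                    ≡⟨ cong (r ℚ.*_) (coeff-++ (q ⊛ relation R) (generated ρ) T) ⟨
    r ℚ.* coeff (generated ((q , R) ∷ ρ)) T                   ∎
    where
    open ≡-Reasoning
    a = coeff (relation R) T
    g = coeff (generated ρ) T

  embed : Comb B → Comb Carrier
  embed = mapComb f

  -- The relations used are kept as the witness `ρ`: `b` yields the expansions, and `ρ` shows that
  -- the relations generate all others.
  Normalized : Comb Carrier → Set
  Normalized c = Σ[ b ∈ Comb B ] Σ[ ρ ∈ Comb A ] c ≋ embed b ++ generated ρ

  normalized-cons : ∀ q S {c} → Normalized ((1ℚ , S) ∷ []) → Normalized c → Normalized ((q , S) ∷ c)
  normalized-cons q S {c} (b , ρ , e) (b′ , ρ′ , e′) = q ⊛ b ++ b′ , q ⊛ ρ ++ ρ′ , λ T → begin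
    coeff ((q , S) ∷ c) T                                       ≡⟨ coeff-cons q S c T ⟩
    q ℚ.* coeff ((1ℚ , S) ∷ []) T ℚ.+ coeff c T                 ≡⟨ cong₂ (λ a d → q ℚ.* a ℚ.+ d)
                                                                     (trans (e T) (coeff-++ (embed b) (generated ρ) T))
                                                                     (trans (e′ T) (coeff-++ (embed b′) (generated ρ′) T)) ⟩
    q ℚ.* (m T ℚ.+ g T) ℚ.+ (m′ T ℚ.+ g′ T)                     ≡⟨ trans (cong (ℚ._+ (m′ T ℚ.+ g′ T)) (ℚ.*-distribˡ-+ q (m T) (g T)))
                                                                     (interchange (q ℚ.* m T) (q ℚ.* g T) (m′ T) (g′ T)) ⟩
    (q ℚ.* m T ℚ.+ m′ T) ℚ.+ (q ℚ.* g T ℚ.+ g′ T)               ≡⟨ cong₂ ℚ._+_ (embedded T) (generates T) ⟨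
    coeff (embed (q ⊛ b ++ b′)) T ℚ.+ coeff (generated (q ⊛ ρ ++ ρ′)) T
      ≡⟨ coeff-++ (embed (q ⊛ b ++ b′)) (generated (q ⊛ ρ ++ ρ′)) T ⟨
    coeff (embed (q ⊛ b ++ b′) ++ generated (q ⊛ ρ ++ ρ′)) T    ∎
    where
    open ≡-Reasoning
    m m′ g g′ : Carrier → ℚ
    m  = coeff (embed b)
    m′ = coeff (embed b′)
    g  = coeff (generated ρ)
    g′ = coeff (generated ρ′)
    embedded : ∀ T → coeff (embed (q ⊛ b ++ b′)) T ≡ q ℚ.* m T ℚ.+ m′ T
    embedded T = begin
      coeff (embed (q ⊛ b ++ b′)) T            ≡⟨ cong (λ c → coeff c T) (map-++ (λ (q , i) → q , f i) (q ⊛ b) b′) ⟩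
      coeff (embed (q ⊛ b) ++ embed b′) T      ≡⟨ cong (λ c → coeff (c ++ embed b′) T) (mapComb-⊛ f q b) ⟩
      coeff (q ⊛ embed b ++ embed b′) T        ≡⟨ coeff-++ (q ⊛ embed b) (embed b′) T ⟩
      coeff (q ⊛ embed b) T ℚ.+ m′ T           ≡⟨ cong (ℚ._+ m′ T) (coeff-⊛ q (embed b) T) ⟩
      q ℚ.* m T ℚ.+ m′ T                       ∎
    generates : ∀ T → coeff (generated (q ⊛ ρ ++ ρ′)) T ≡ q ℚ.* g T ℚ.+ g′ T
    generates T = trans (coeff-generated-++ (q ⊛ ρ) ρ′ T) (cong (ℚ._+ g′ T) (coeff-generated-⊛ q ρ T))

  normalized-all : ∀ c → (∀ {q S} → (q , S) ∈ c → Normalized ((1ℚ , S) ∷ [])) → Normalized c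
  normalized-all []            nf = [] , [] , λ _ → refl
  normalized-all ((q , S) ∷ c) nf = normalized-cons q S {c} (nf (here refl)) (normalized-all c (nf ∘ there))

  -- `left R` is `right R` minus `relation R`, whence the coefficient -1 of `R`.
  normalized-left : ∀ R {S} → left R ≃ S → Normalized (right R) → Normalized ((1ℚ , S) ∷ [])
  normalized-left R {S} left≃S (b , ρ , e) = b , (ℚ.- 1ℚ , R) ∷ ρ , λ T → begin
    coeff ((1ℚ , S) ∷ []) T                                     ≡⟨ coeff-head-cong 1ℚ [] left≃S T ⟨
    δ T                                                         ≡⟨ regroup (δ T) (m T) (g T) ⟨
    m T ℚ.+ (ℚ.- 1ℚ ℚ.* (ℚ.- 1ℚ ℚ.* δ T ℚ.+ (m T ℚ.+ g T)) ℚ.+ g T)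
      ≡⟨ cong (λ r → m T ℚ.+ (ℚ.- 1ℚ ℚ.* (ℚ.- 1ℚ ℚ.* δ T ℚ.+ r) ℚ.+ g T)) (trans (e T) (coeff-++ (embed b) (generated ρ) T)) ⟨
    m T ℚ.+ (ℚ.- 1ℚ ℚ.* (ℚ.- 1ℚ ℚ.* δ T ℚ.+ coeff (right R) T) ℚ.+ g T)
      ≡⟨ cong (λ r → m T ℚ.+ (ℚ.- 1ℚ ℚ.* r ℚ.+ g T)) (coeff-cons (ℚ.- 1ℚ) (left R) (right R) T) ⟨
    m T ℚ.+ (ℚ.- 1ℚ ℚ.* coeff (relation R) T ℚ.+ g T)
      ≡⟨ cong (m T ℚ.+_) (trans (coeff-++ (ℚ.- 1ℚ ⊛ relation R) (generated ρ) T) (cong (ℚ._+ g T) (coeff-⊛ (ℚ.- 1ℚ) (relation R) T))) ⟨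
    m T ℚ.+ coeff (generated ((ℚ.- 1ℚ , R) ∷ ρ)) T              ≡⟨ coeff-++ (embed b) (generated ((ℚ.- 1ℚ , R) ∷ ρ)) T ⟨
    coeff (embed b ++ generated ((ℚ.- 1ℚ , R) ∷ ρ)) T           ∎
    where
    open ≡-Reasoning
    m g δ : Carrier → ℚ
    m = coeff (embed b)
    g = coeff (generated ρ)
    δ = coeff ((1ℚ , left R) ∷ [])
    regroup : ∀ d m g → m ℚ.+ (ℚ.- 1ℚ ℚ.* (ℚ.- 1ℚ ℚ.* d ℚ.+ (m ℚ.+ g)) ℚ.+ g) ≡ d
    regroup d m g = begin
      m ℚ.+ (ℚ.- 1ℚ ℚ.* (ℚ.- 1ℚ ℚ.* d ℚ.+ (m ℚ.+ g)) ℚ.+ g)   ≡⟨ cong (λ r → m ℚ.+ (ℚ.- 1ℚ ℚ.* (r ℚ.+ (m ℚ.+ g)) ℚ.+ g)) (ℚ-minus d) ⟩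
      m ℚ.+ (ℚ.- 1ℚ ℚ.* (ℚ.- d ℚ.+ (m ℚ.+ g)) ℚ.+ g)          ≡⟨ cong (λ r → m ℚ.+ (r ℚ.+ g)) (trans (ℚ-minus (ℚ.- d ℚ.+ (m ℚ.+ g))) (ℚ.neg-distrib-+ (ℚ.- d) (m ℚ.+ g))) ⟩
      m ℚ.+ ((ℚ.- (ℚ.- d) ℚ.+ ℚ.- (m ℚ.+ g)) ℚ.+ g)           ≡⟨ x∙yz≈y∙xz m (ℚ.- (ℚ.- d) ℚ.+ ℚ.- (m ℚ.+ g)) g ⟩
      (ℚ.- (ℚ.- d) ℚ.+ ℚ.- (m ℚ.+ g)) ℚ.+ (m ℚ.+ g)           ≡⟨ ℚ.+-assoc (ℚ.- (ℚ.- d)) (ℚ.- (m ℚ.+ g)) (m ℚ.+ g) ⟩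
      ℚ.- (ℚ.- d) ℚ.+ (ℚ.- (m ℚ.+ g) ℚ.+ (m ℚ.+ g))           ≡⟨ cong₂ ℚ._+_ (-‿involutive d) (ℚ.+-inverseˡ (m ℚ.+ g)) ⟩
      d ℚ.+ 0ℚ                                                ≡⟨ ℚ.+-identityʳ d ⟩
      d                                                       ∎

  -- The hypothesis gives coefficients only at indices of the form `f S`. At an index that matches
  -- no entry both sides are zero; otherwise a matching entry supplies `S`.
  embed-cong : ∀ {b b′} → b F.≋ b′ → embed b ≋ embed b′
  embed-cong {b} {b′} e T with Any.any? (λ (q , S) → S ≟ T) (embed b ++ embed b′)
  ... | no ¬∃ = trans (absent b (¬∃ ∘ Any.++⁺ˡ)) (sym (absent b′ (¬∃ ∘ Any.++⁺ʳ (embed b))))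
    where
    absent : ∀ b → ¬ Any (λ (q , S) → S ≃ T) (embed b) → coeff (embed b) T ≡ 0ℚ
    absent b ¬∃ = coeff-absent (embed b) T λ S∈ e → ¬∃ (lose S∈ e)
  ... | yes ∃T = [ via ∘ Any.map⁻ , via ∘ Any.map⁻ ]′ (Any.++⁻ (embed b) ∃T)
    where
    via : ∀ {c : Comb B} → Any (λ (q , S) → f S ≃ T) c → coeff (embed b) T ≡ coeff (embed b′) T
    via a with find a
    ... | (q , S) , _ , S≃T = begin
      coeff (embed b) T           ≡⟨ coeff-cong (embed b) S≃T ⟨
      coeff (embed b) (f S)       ≡⟨ coeff-pullback I f b S ⟩
      F.coeff b S                 ≡⟨ e S ⟩
      F.coeff b′ S                ≡⟨ coeff-pullback I f b′ S ⟨
      coeff (embed b′) (f S)      ≡⟨ coeff-cong (embed b′) S≃T ⟩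
      coeff (embed b′) T          ∎
      where open ≡-Reasoning

  module _ (d : Comb Carrier) (lift : ∀ S → coeff d S ≢ 0ℚ → ∃[ b ] f b ≡ S) where

    private
      Restriction : Comb Carrier → Comb B → Set
      Restriction c b = ∀ T → (coeff d T ≢ 0ℚ → coeff (embed b) T ≡ coeff c T) × (coeff d T ≡ 0ℚ → coeff (embed b) T ≡ 0ℚ)

      -- Entries of `d` may cancel, and those whose total coefficient is zero need not have a lift.
      -- Entries with equal indices are kept or dropped together, so the remaining coefficients do
      -- not change.
      restrict : ∀ c → ∃[ b ] Restriction c b
      restrict []            = [] , λ T → (λ _ → refl) , (λ _ → refl)
      restrict ((q , S) ∷ c) with restrict c | coeff d S ℚ.≟ 0ℚ
      ... | b , r | yes ≡0 = b , λ T →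
        (λ ≢0 → trans (proj₁ (r T) ≢0) (sym (coeff-there q c λ S≃T → ≢0 (trans (sym (coeff-cong d S≃T)) ≡0)))) , proj₂ (r T)
      ... | b , r | no ≢0 with lift S ≢0
      ...   | S′ , refl = (q , S′) ∷ b , λ T → head T (f S′ ≟ T)
        where
        head : ∀ T → Dec (f S′ ≃ T) →
               (coeff d T ≢ 0ℚ → coeff (embed ((q , S′) ∷ b)) T ≡ coeff ((q , f S′) ∷ c) T) ×
               (coeff d T ≡ 0ℚ → coeff (embed ((q , S′) ∷ b)) T ≡ 0ℚ)
        head T (yes S≃T) =
          (λ T≢0 → trans (coeff-here q (embed b) S≃T) (trans (cong (q ℚ.+_) (proj₁ (r T) T≢0)) (sym (coeff-here q c S≃T)))) ,
          (λ T≡0 → contradiction (trans (coeff-cong d S≃T) T≡0) ≢0)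
        head T (no S≄T) =
          (λ T≢0 → trans (coeff-there q (embed b) S≄T) (trans (proj₁ (r T) T≢0) (sym (coeff-there q c S≄T)))) ,
          (λ T≡0 → trans (coeff-there q (embed b) S≄T) (proj₂ (r T) T≡0))

    embedded : ∃[ b ] d ≋ embed b
    embedded with restrict d
    ... | b , r = b , λ T → case coeff d T ℚ.≟ 0ℚ of λ
      { (yes ≡0) → trans ≡0 (sym (proj₂ (r T) ≡0)) ; (no ≢0) → sym (proj₁ (r T) ≢0) }

  Rewrites : Rel (Comb Carrier) 0ℓ
  Rewrites c d = Σ[ R ∈ A ] coeff c (left R) ≢ 0ℚ × d ≋ c ++ coeff c (left R) ⊛ relation R

  Supports : List Carrier → Comb Carrier → Set
  Supports L c = ∀ T → coeff c T ≢ 0ℚ → Any (_≃ T) L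

  supports : ∀ c → Supports (List.map proj₂ c) c
  supports c T ≢0 with Any.any? (_≟ T) (List.map proj₂ c)
  ... | yes a = a
  ... | no ¬a = contradiction (coeff-absent c T λ S∈ e → ¬a (Any.map⁺ (lose S∈ e))) ≢0

  -- A step replaces an element of height h by fewer than n elements of smaller
  -- height, so the sum of n ^ height over the support decreases.
  module Termination (n : ℕ) (height : Carrier → ℕ) (height-cong : ∀ {S T} → S ≃ T → height S ≡ height T)
                     (support : A → List Carrier) (right⊆ : ∀ R {q S} → (q , S) ∈ right R → S ∈ support R)
                     (lower : ∀ R {S} → S ∈ support R → height S ℕ.< height (left R))
                     (count : ∀ R → length (support R) ℕ.< n) where

    measure : List Carrier → ℕ
    measure = List.foldr (λ T s → n ℕ.^ height T ℕ.+ s) 0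

    measure-++ : ∀ L M → measure (L ++ M) ≡ measure L ℕ.+ measure M
    measure-++ []      M = refl
    measure-++ (T ∷ L) M = trans (cong (n ℕ.^ height T ℕ.+_) (measure-++ L M)) (sym (ℕ.+-assoc (n ℕ.^ height T) _ _))

    without : Carrier → List Carrier → List Carrier
    without S = List.filter λ T → ¬? (T ≟ S)

    measure-without-≤ : ∀ S L → measure (without S L) ℕ.≤ measure L
    measure-without-≤ S []      = z≤n
    measure-without-≤ S (T ∷ L) with T ≟ S
    ... | yes _ = ℕ.≤-trans (measure-without-≤ S L) (ℕ.m≤n+m _ _)
    ... | no _  = ℕ.+-monoʳ-≤ (n ℕ.^ height T) (measure-without-≤ S L)

    measure-without : ∀ S L → Any (_≃ S) L → n ℕ.^ height S ℕ.+ measure (without S L) ℕ.≤ measure L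
    measure-without S (T ∷ L) a with T ≟ S
    ... | yes T≃S = ℕ.+-mono-≤ (ℕ.≤-reflexive (cong (n ℕ.^_) (sym (height-cong T≃S)))) (measure-without-≤ S L)
    ... | no T≄S with a
    ...   | here T≃S = contradiction T≃S T≄S
    ...   | there a  = begin
      s ℕ.+ (t ℕ.+ measure (without S L))   ≡⟨ ℕ.+-assoc s t (measure (without S L)) ⟨
      (s ℕ.+ t) ℕ.+ measure (without S L)   ≡⟨ cong (ℕ._+ measure (without S L)) (ℕ.+-comm s t) ⟩
      (t ℕ.+ s) ℕ.+ measure (without S L)   ≡⟨ ℕ.+-assoc t s (measure (without S L)) ⟩
      t ℕ.+ (s ℕ.+ measure (without S L))   ≤⟨ ℕ.+-monoʳ-≤ t (measure-without S L a) ⟩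
      t ℕ.+ measure L                       ∎
      where
      open ℕ.≤-Reasoning
      s = n ℕ.^ height S
      t = n ℕ.^ height T

    measure-bound : ∀ L h → .{{_ : ℕ.NonZero n}} → (∀ {T} → T ∈ L → height T ℕ.≤ h) → measure L ℕ.≤ length L ℕ.* n ℕ.^ h
    measure-bound []      h low = z≤n
    measure-bound (T ∷ L) h low = ℕ.+-mono-≤ (ℕ.^-monoʳ-≤ n (low (here refl))) (measure-bound L h (low ∘ there))

    -- Fewer than `n` elements of height at most `h` contribute at most `n ^ h` each, which stays
    -- below `n ^ suc h`. At height 0 the support is empty.
    measure-support : ∀ R → measure (support R) ℕ.< n ℕ.^ height (left R)
    measure-support R = go (height (left R)) (λ T∈ → lower R T∈)
      where
      instance
        n≢0 : ℕ.NonZero n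
        n≢0 = ℕ.>-nonZero (ℕ.≤-<-trans z≤n (count R))
      go : ∀ h → (∀ {T} → T ∈ support R → height T ℕ.< h) → measure (support R) ℕ.< n ℕ.^ h
      go zero    low = subst (λ L → measure L ℕ.< 1) (sym (empty (support R) low)) (s≤s z≤n)
        where
        empty : ∀ L → (∀ {T} → T ∈ L → height T ℕ.< 0) → L ≡ []
        empty []      low = refl
        empty (T ∷ L) low with () ← low (here refl)
      go (suc h) low = begin-strict
        measure (support R)                  ≤⟨ measure-bound (support R) h (λ T∈ → ℕ.≤-pred (low T∈)) ⟩
        length (support R) ℕ.* n ℕ.^ h       <⟨ ℕ.*-monoˡ-< (n ℕ.^ h) {{ℕ.m^n≢0 n h}} (count R) ⟩
        n ℕ.* n ℕ.^ h                        ∎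
        where open ℕ.≤-Reasoning

    -- The scalar of the step makes the coefficient of `left R` vanish, so `left R` may leave the
    -- list; new indices come from the right-hand side only.
    supports-step : ∀ R {L c d} → Supports L c → d ≋ c ++ coeff c (left R) ⊛ relation R →
                    Supports (without (left R) L ++ support R) d
    supports-step R {L} {c} {d} sup e T ≢0 with Any.any? (_≟ T) (support R)
    ... | yes a = Any.++⁺ʳ (without (left R) L) a
    ... | no ¬a = Any.++⁺ˡ kept
      where
      open ≡-Reasoning
      l = coeff c (left R)
      δ = coeff ((1ℚ , left R) ∷ []) T
      d≡ : coeff d T ≡ coeff c T ℚ.+ l ℚ.* (ℚ.- 1ℚ ℚ.* δ ℚ.+ 0ℚ)
      d≡ = begin
        coeff d T                                                        ≡⟨ e T ⟩
        coeff (c ++ l ⊛ relation R) T                                    ≡⟨ coeff-++ c (l ⊛ relation R) T ⟩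
        coeff c T ℚ.+ coeff (l ⊛ relation R) T                           ≡⟨ cong (coeff c T ℚ.+_) (coeff-⊛ l (relation R) T) ⟩
        coeff c T ℚ.+ l ℚ.* coeff (relation R) T                         ≡⟨ cong (λ r → coeff c T ℚ.+ l ℚ.* r) (coeff-cons (ℚ.- 1ℚ) (left R) (right R) T) ⟩
        coeff c T ℚ.+ l ℚ.* (ℚ.- 1ℚ ℚ.* δ ℚ.+ coeff (right R) T)
          ≡⟨ cong (λ r → coeff c T ℚ.+ l ℚ.* (ℚ.- 1ℚ ℚ.* δ ℚ.+ r)) (coeff-absent (right R) T λ S∈ e → ¬a (lose (right⊆ R S∈) e)) ⟩
        coeff c T ℚ.+ l ℚ.* (ℚ.- 1ℚ ℚ.* δ ℚ.+ 0ℚ)                       ∎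
      left≄T : ¬ left R ≃ T
      left≄T left≃T = ≢0 (begin
        coeff d T                                          ≡⟨ d≡ ⟩
        coeff c T ℚ.+ l ℚ.* (ℚ.- 1ℚ ℚ.* δ ℚ.+ 0ℚ)
          ≡⟨ cong₂ (λ a δ → a ℚ.+ l ℚ.* (ℚ.- 1ℚ ℚ.* δ ℚ.+ 0ℚ)) (sym (coeff-cong c left≃T)) (coeff-here 1ℚ [] left≃T) ⟩
        l ℚ.+ l ℚ.* (ℚ.- 1ℚ ℚ.* (1ℚ ℚ.+ 0ℚ) ℚ.+ 0ℚ)
          ≡⟨ trans (cong (l ℚ.+_) (trans (ℚ.*-comm l (ℚ.- 1ℚ)) (ℚ-minus l))) (ℚ.+-inverseʳ l) ⟩
        0ℚ                                                 ∎)
      c≢0 : coeff c T ≢ 0ℚ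
      c≢0 c≡0 = ≢0 (begin
        coeff d T                                          ≡⟨ d≡ ⟩
        coeff c T ℚ.+ l ℚ.* (ℚ.- 1ℚ ℚ.* δ ℚ.+ 0ℚ)
          ≡⟨ cong₂ (λ a δ → a ℚ.+ l ℚ.* (ℚ.- 1ℚ ℚ.* δ ℚ.+ 0ℚ)) c≡0 (coeff-there 1ℚ [] left≄T) ⟩
        0ℚ ℚ.+ l ℚ.* (ℚ.- 1ℚ ℚ.* 0ℚ ℚ.+ 0ℚ)
          ≡⟨ trans (ℚ.+-identityˡ _) (ℚ.*-zeroʳ l) ⟩
        0ℚ                                                 ∎)
      kept : Any (_≃ T) (without (left R) L)
      kept with find (sup T c≢0)
      ... | S , S∈ , S≃T = lose (∈.∈-filter⁺ (λ T → ¬? (T ≟ left R)) S∈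
        λ S≃left → left≄T (≃-trans (≃-sym S≃left) S≃T)) S≃T

    -- The recursion runs on a list that bounds the support, not on the state: a state is given only
    -- up to `≋`, and its entries may be repeated or cancel.
    strongly-normalizing : StronglyNormalizing Rewrites
    strongly-normalizing c = go (List.map proj₂ c) (<-wellFounded _) c (supports c)
      where
      go : ∀ L → Acc ℕ._<_ (measure L) → ∀ c → Supports L c → Acc (flip Rewrites) c
      go L (acc rec) c sup = acc λ {d} (R , ≢0 , e) →
        go (without (left R) L ++ support R) (rec (smaller R (sup (left R) ≢0))) d (supports-step R {L} {c} {d} sup e)
        where
        open ℕ.≤-Reasoning
        smaller : ∀ R → Any (_≃ left R) L → measure (without (left R) L ++ support R) ℕ.< measure L
        smaller R a = begin-strict
          measure (without (left R) L ++ support R)                 ≡⟨ measure-++ (without (left R) L) (support R) ⟩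
          measure (without (left R) L) ℕ.+ measure (support R)      <⟨ ℕ.+-monoʳ-< (measure (without (left R) L)) (measure-support R) ⟩
          measure (without (left R) L) ℕ.+ n ℕ.^ height (left R)    ≡⟨ ℕ.+-comm (measure (without (left R) L)) _ ⟩
          n ℕ.^ height (left R) ℕ.+ measure (without (left R) L)    ≤⟨ measure-without (left R) L a ⟩
          measure L                                                 ∎

    normalized : (∀ S → (∃[ b ] f b ≡ S) ⊎ (Σ[ R ∈ A ] left R ≃ S)) → ∀ c → Normalized c
    normalized decide c = normalized-all c λ {q} {S} _ → go S (<-wellFounded _)
      where
      go : ∀ S → Acc ℕ._<_ (height S) → Normalized ((1ℚ , S) ∷ [])
      go S (acc rec) with decide S
      ... | inj₁ (b , refl)     = (1ℚ , b) ∷ [] , [] , λ _ → refl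
      ... | inj₂ (R , left≃S) = normalized-left R left≃S (normalized-all (right R) λ qT∈ →
        go _ (rec (subst (height _ ℕ.<_) (height-cong left≃S) (lower R (right⊆ R qT∈)))))

  module Sound (V : LeftModule ℚ.+-*-ring 0ℓ 0ℓ) (v : Carrier → LeftModule.Carrierᴹ V)
               (v-cong : ∀ {S T} → S ≃ T → LeftModule._≈ᴹ_ V (v S) (v T))
               (sound : ∀ R → LeftModule._≈ᴹ_ V (Linear.⟦_⟧ V (relation R) v) (LeftModule.0ᴹ V)) where
    open LeftModule V
    open Linear V
    open Evaluation V v v-cong
    open SetoidReasoning ≈ᴹ-setoid

    ⟦embed⟧ : ∀ b → ⟦ embed b ⟧ v ≈ᴹ ⟦ b ⟧ (v ∘ f)
    ⟦embed⟧ []            = ≈ᴹ-refl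
    ⟦embed⟧ ((q , T) ∷ b) = +ᴹ-congˡ (⟦embed⟧ b)

    ⟦generated⟧ : ∀ ρ → ⟦ generated ρ ⟧ v ≈ᴹ 0ᴹ
    ⟦generated⟧ []            = ≈ᴹ-refl
    ⟦generated⟧ ((q , R) ∷ ρ) = begin
      ⟦ q ⊛ relation R ++ generated ρ ⟧ v             ≈⟨ ⟦⟧-++ (q ⊛ relation R) ⟩
      ⟦ q ⊛ relation R ⟧ v +ᴹ ⟦ generated ρ ⟧ v       ≈⟨ +ᴹ-cong (≈ᴹ-trans (⟦⟧-⊛ q (relation R)) (*ₗ-congˡ (sound R))) (⟦generated⟧ ρ) ⟩
      q *ₗ 0ᴹ +ᴹ 0ᴹ                                   ≈⟨ ≈ᴹ-trans (+ᴹ-identityʳ _) (*ₗ-zeroʳ q) ⟩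
      0ᴹ                                              ∎

    normalized-value : ∀ {c b ρ} → c ≋ embed b ++ generated ρ → ⟦ c ⟧ v ≈ᴹ ⟦ b ⟧ (v ∘ f)
    normalized-value {c} {b} {ρ} e = begin
      ⟦ c ⟧ v                               ≈⟨ ⟦⟧-cong {c} {embed b ++ generated ρ} e ⟩
      ⟦ embed b ++ generated ρ ⟧ v          ≈⟨ ⟦⟧-++ (embed b) ⟩
      ⟦ embed b ⟧ v +ᴹ ⟦ generated ρ ⟧ v    ≈⟨ +ᴹ-cong (⟦embed⟧ b) (⟦generated⟧ ρ) ⟩
      ⟦ b ⟧ (v ∘ f) +ᴹ 0ᴹ                   ≈⟨ +ᴹ-identityʳ _ ⟩
      ⟦ b ⟧ (v ∘ f)                         ∎

    rewrites-value : ∀ {c d} → Star Rewrites c d → ⟦ d ⟧ v ≈ᴹ ⟦ c ⟧ v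
    rewrites-value ε = ≈ᴹ-refl
    rewrites-value {c} (_◅_ {j = d} (R , _ , e) p) = ≈ᴹ-trans (rewrites-value p) (begin
      ⟦ d ⟧ v                                       ≈⟨ ⟦⟧-cong {d} {c ++ l ⊛ relation R} e ⟩
      ⟦ c ++ l ⊛ relation R ⟧ v                     ≈⟨ ⟦⟧-++ c ⟩
      ⟦ c ⟧ v +ᴹ ⟦ l ⊛ relation R ⟧ v               ≈⟨ +ᴹ-congˡ (≈ᴹ-trans (⟦⟧-⊛ l (relation R)) (≈ᴹ-trans (*ₗ-congˡ (sound R)) (*ₗ-zeroʳ l))) ⟩
      ⟦ c ⟧ v +ᴹ 0ᴹ                                 ≈⟨ +ᴹ-identityʳ _ ⟩
      ⟦ c ⟧ v                                       ∎)
      where l = coeff c (left R)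

    -- The generated part evaluates to zero. So if `c` does, then so does `b`; independence removes
    -- `b`, and `ρ` remains.
    generated⇔zero : (∀ b → ⟦ b ⟧ (v ∘ f) ≈ᴹ 0ᴹ → b F.≋ []) → (∀ c → Normalized c) →
                     ∀ c → ⟦ c ⟧ v ≈ᴹ 0ᴹ ⇔ (∃[ ρ ] c ≋ generated ρ)
    generated⇔zero independent normalized c = mk⇔ to λ (ρ , e) → ≈ᴹ-trans (⟦⟧-cong {c} {generated ρ} e) (⟦generated⟧ ρ)
      where
      to : ⟦ c ⟧ v ≈ᴹ 0ᴹ → ∃[ ρ ] c ≋ generated ρ
      to z with normalized c
      ... | b , ρ , e = ρ , λ T → trans (e T) (trans (coeff-++ (embed b) (generated ρ) T)
        (trans (cong (ℚ._+ coeff (generated ρ) T) (embed-cong {b} {[]} (independent b b≈0) T)) (ℚ.+-identityˡ _)))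
        where
        b≈0 : ⟦ b ⟧ (v ∘ f) ≈ᴹ 0ᴹ
        b≈0 = ≈ᴹ-trans (≈ᴹ-sym (normalized-value {c} {b} {ρ} e)) z

-- Trees and simple monomials

module Trees {n : ℕ} (G : Graph n) (order : (T : NoncrossingTree n) → EdgeOrder T) where
  open TreeProducts G order
  open TreeRelation using (lhs; rhs; rhs-lhs; T₁; T₂₊)
  open Ring (FK-ring n) using (semiring; setoid; +-congˡ; +-congʳ; *-congˡ; *-congʳ; +-identityʳ)
  open RingProperties (FK-ring n) using (-‿+-comm; -0#≈0#)
  open SemiringSum semiring using (sum; sum-init-last)
  open SetoidReasoning setoid

  x-cong : ∀ {T T′} → TreeIn.graph {G = G} T ≐ᴳ TreeIn.graph {G = G} T′ → x T ≈ x T′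
  x-cong {T} {T′} e = ∼⇒≈ (edgeOrder-unique e (order (TreeIn.tree T)) (order (TreeIn.tree T′)))

  ⟦⟧-negative : ∀ {m} {A : Set} (f : Fin m → A) (t : A → TreeIn G) →
                ⟦ List.map (λ a → ℚ.- 1ℚ , t a) (List.tabulate f) ⟧ x ≈ - sum (x ∘ t ∘ f)
  ⟦⟧-negative {zero}  f t = ≈-sym -0#≈0#
  ⟦⟧-negative {suc m} f t = ≈-trans (+-cong (ι-minus _) (⟦⟧-negative (f ∘ suc) t)) (-‿+-comm _ _)

  relation-zero : ∀ R → ⟦ rhs-lhs R ⟧ x ≈ ι 0ℚ
  relation-zero R = begin
    ι (ℚ.- 1ℚ) * x (lhs R) + (ι 1ℚ * x (T₁ R) + ⟦ List.map (λ j → ℚ.- 1ℚ , T₂₊ R (inject₁ j)) (List.allFin _) ⟧ x)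
      ≈⟨ +-cong (ι-minus _) (+-cong (≈-trans (*-identityˡ _) first-tree) (⟦⟧-negative id (T₂₊ R ∘ inject₁))) ⟩
    - x (lhs R) + ((S + x (lhs R)) + - S)    ≈⟨ +-congˡ (+-congʳ (+-comm _ _)) ⟩
    - x (lhs R) + ((x (lhs R) + S) + - S)    ≈⟨ +-congˡ (+-assoc _ _ _) ⟩
    - x (lhs R) + (x (lhs R) + (S + - S))    ≈⟨ +-congˡ (+-congˡ (≈-trans (+-comm _ _) (-‿inverseˡ S))) ⟩
    - x (lhs R) + (x (lhs R) + ι 0ℚ)         ≈⟨ +-congˡ (+-identityʳ _) ⟩
    - x (lhs R) + x (lhs R)                  ≈⟨ -‿inverseˡ _ ⟩
    ι 0ℚ                                     ∎
    where
    S = sum (x ∘ T₂₊ R ∘ inject₁)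
    first-tree : x (T₁ R) ≈ S + x (lhs R)
    first-tree = ≈-trans (cycle-relation R (order (TreeIn.tree (T₁ R))) (λ j → order (TreeIn.tree (T₂₊ R j))))
                         (sum-init-last (x ∘ T₂₊ R))

  -- The letters of a factorization of the long cycle form a noncrossing tree; the scalar is the
  -- sign from orienting them upwards.
  simple-tree : (P : SimpleMonomial G (longCycle n)) →
                Σ[ T ∈ TreeIn G ] ∃[ q ] ∏ (SimpleMonomial.monomial P) ≈ ι q * x T
  simple-tree P = record { tree = T ; inside = inside } , signs monomial , spelled T f (spells-link-graph monomial) (order T)
    where
    open SimpleMonomial P
    f : Factorization monomial
    f = simple⇒factorization simple perm
    T = link-graph-tree f
    inside : link-graph monomial ⊆ᴳ G
    inside u v a with find (Equivalence.to (spells-link-graph monomial) a)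
    ... | g , g∈ , inj₁ (refl , refl) = All.lookup inG g∈
    ... | g , g∈ , inj₂ (refl , refl) = Graph.symm G (All.lookup inG g∈)

  combination : ∀ {y} → 𝓔[ G , longCycle n ] y → ∃[ c ] y ≈ ⟦ c ⟧ x
  combination (s , y≈) = let (c , e) = go s in c , ≈-trans y≈ e
    where
    go : ∀ s → ∃[ c ] ⟦ s ⟧ (∏ ∘ SimpleMonomial.monomial) ≈ ⟦ c ⟧ x
    go []            = [] , ≈-refl
    go ((p , P) ∷ s) =
      let (T , q , e) = simple-tree P
          (c , e′)    = go s
      in (p ℚ.* q , T) ∷ c , +-cong (≈-trans (*-congˡ e) (≈-trans (≈-sym (*-assoc _ _ _)) (*-congʳ (≈-sym (ι-* p q))))) e′

  tree-in-𝓔 : ∀ T → 𝓔[ G , longCycle n ] (x T)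
  tree-in-𝓔 T = (1ℚ , P) ∷ [] , ≈-sym (≈-trans (+-identityʳ _) (*-identityˡ _))
    where
    o = order (TreeIn.tree T)
    f = word-factorization (TreeIn.tree T) o
    P : SimpleMonomial G (longCycle n)
    P = record
      { monomial = EdgeOrder.word o
      ; inG      = All.tabulate λ {g} g∈ → TreeIn.inside T _ _ (proj₂ (Equivalence.to (EdgeOrder.edges o g) g∈))
      ; simple   = factorization⇒simple f
      ; perm     = Factorization.cycle f }

  open Independence G order using (independent)
  open Formal (treeInDecSetoid G) using (coeff; _≋_)
  open Relations (treeInDecSetoid G) (lhs {G = G}) rhs (ReducedTree.treeIn {G = G})

  -- Weights increase along the relations, so their distance from the bound decreases.
  height : TreeIn G → ℕ
  height T = max-weight {n} ℕ.∸ weight (TreeIn.tree T)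

  open Termination n height
    (λ {S} {T} e → cong (max-weight {n} ℕ.∸_) (weight-cong {n} {TreeIn.tree S} {TreeIn.tree T} e))
    rhs-trees (λ R → rhs-support R)
    (λ R {T} T∈ → ℕ.∸-monoʳ-< (rhs-heavier R T∈) (weight-≤ (TreeIn.tree T)))
    rhs-count

  decide : ∀ T → (∃[ S ] ReducedTree.treeIn S ≡ T) ⊎ (Σ[ R ∈ TreeRelation G ] TreeIn.graph (lhs R) ≐ᴳ TreeIn.graph T)
  decide T with reduced-or-lhs T
  ... | inj₁ reduced = inj₁ (record { treeIn = T ; reduced = reduced } , refl)
  ... | inj₂ R       = inj₂ R

  open Sound (FK-module n) x (λ {T} {T′} → x-cong {T} {T′}) relation-zero

  expansion : ∀ c → ∃[ b ] ⟦ c ⟧ x ≈ ⟦ b ⟧ xʳ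
  expansion c with normalized decide c
  ... | b , ρ , e = b , normalized-value {c} {b} {ρ} e

  basis : ReducedTreesFormBasis
  basis = record
    { contained   = tree-in-𝓔 ∘ ReducedTree.treeIn
    ; independent = independent
    ; spanning    = λ y∈ → let (c , y≈c) = combination y∈ ; (b , c≈b) = expansion c in b , ≈-trans y≈c c≈b }

  relations-generate : RelationsAreGenerated
  relations-generate = generated⇔zero independent (normalized decide)

  expansion-unique : ∀ b b′ → ⟦ b ⟧ xʳ ≈ ⟦ b′ ⟧ xʳ → Formal._≋_ (reducedDecSetoid G) b b′
  expansion-unique b b′ = FormalProperties.Evaluation.⟦⟧-injective (reducedDecSetoid G) (FK-module n) xʳ
    (λ {T} {T′} → x-cong {ReducedTree.treeIn T} {ReducedTree.treeIn T′}) independent {b} {b′}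

  -- A tree with nonzero coefficient that is not reduced is the left-hand side of a relation and
  -- would permit a step.
  normal-form-embedded : ∀ {d} → IsNormalForm (_⟶_ G) d → ∃[ b ] d ≋ embed b
  normal-form-embedded {d} normal = embedded d lift
    where
    lift : ∀ T → coeff d T ≢ 0ℚ → ∃[ S ] ReducedTree.treeIn S ≡ T
    lift T ≢0 with decide T
    ... | inj₁ S             = S
    ... | inj₂ (R , lhs≐T) = ⊥-elim (normal (d ++ coeff d (lhs R) ⊛ rhs-lhs R , R ,
      ≢0 ∘ trans (sym (FormalProperties.coeff-cong (treeInDecSetoid G) d {lhs R} {T} lhs≐T)) , λ _ → refl))

  rewriting : RewritingTerminatesInExpansion
  rewriting = strongly-normalizing , λ y y∈ →
    let (c₀ , y≈c₀) = combination y∈ ; (b , c₀≈b) = expansion c₀ ; y≈b = ≈-trans y≈c₀ c₀≈b in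
    b ,
    (y≈b , λ b′ y≈b′ → expansion-unique b′ b (≈-trans (≈-sym y≈b′) y≈b)) ,
    λ c d y≈c c→d normal T → let (b′ , d≋b′) = normal-form-embedded {d} normal in
      trans (d≋b′ T) (embed-cong {b′} {b} (expansion-unique b′ b
        -- With the empty list of relations, `d` counts as normalized with basis part `b′`.
        (≈-trans (≈-sym (normalized-value {d} {b′} {[]}
                   (λ T → trans (d≋b′ T) (cong (λ c → coeff c T) (sym (++-identityʳ (embed b′)))))))
          (≈-trans (rewrites-value {c} {d} c→d) (≈-trans (≈-sym y≈c) y≈b)))) T)

theorem3p14 : ∀ {n : ℕ} (G : Graph n) →
    ((T : NoncrossingTree n) → EdgeOrder T) ×
    ((order : (T : NoncrossingTree n) → EdgeOrder T) →
    let open TreeProducts G order in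
    ReducedTreesFormBasis × RelationsAreGenerated × RewritingTerminatesInExpansion)
theorem3p14 G = tree-edgeOrder , λ order →
  let open Trees G order in basis , relations-generate , rewriting
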